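{- Let $q$ be a prime power. Let $P(x,y)$ and $Q(x,y)$ be polynomials in $\mathbb{F}_q[x,y]$ such that $Q(0,0)\neq0$. Let $$F=\mathcal{D}\!\left(\frac{P(x,y)}{Q(x,y)}\right),$$ and write $F(x)=\sum_{n\ge0}a(n)x^n$. Let $h=\max(\deg_x P,\deg_x Q)$ and $d=\max(\deg_y P,\deg_y Q)$, and assume $h\ge1$ and $d\ge1$. Then the size of $\ker_q(a(n)_{n\ge0})$ is at most $$q^{hd}+q^{(h-1)(d-1)}\,\mathcal{L}(h,h,d,d)+2\lfloor\log_q\max(h,d)\rfloor+2.$$ Consequently, $|\ker_q(a(n)_{n\ge0})|$ is in $(1+o(1))\,q^{hd}$ as any one of $q$, $h$, or $d$ tends to infinity and the other two remain constant. That is: if two of the three parameters $q,h,d$ are fixed, there is a function $\varepsilon$ of the remaining parameter, tending to $0$ as that parameter tends to infinity, such that for all such $P,Q$ with these values of $q,h,d$, one has $|\ker_q(a(n)_{n\ge0})|\le(1+\varepsilon)q^{hd}$.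
   Context: The diagonal operator $\mathcal{D}:\mathbb{F}_q[[x,y]]\to\mathbb{F}_q[[x]]$ is $\mathcal{D}\big(\sum_{m,n\ge0}a(m,n)x^my^n\big)=\sum_{n\ge0}a(n,n)x^n$; since $Q(0,0)\neq0$, $P/Q$ is a power series in $\mathbb{F}_q[[x,y]]$. The $q$-kernel of a sequence is $\ker_q(a(n)_{n\ge0})=\{a(q^e n+r)_{n\ge0}: e\ge 0,\ 0\le r\le q^e-1\}$. For a partition $\sigma$ of a positive integer, $\mathrm{lcm}(\sigma)$ is the least common multiple of its parts. $\mathcal{L}(n_1,n_2,n_3,n_4)$ denotes the maximum value of $\mathrm{lcm}(\mathrm{lcm}(\sigma_1),\mathrm{lcm}(\sigma_2),\mathrm{lcm}(\sigma_3),\mathrm{lcm}(\sigma_4))$ where, for each $i$, $\sigma_i$ ranges over integer partitions of integers in $\{1,2,\dots,n_i\}$. -}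

module Defs where

open import Algebra.Apartness.Bundles using (HeytingField; HeytingCommutativeRing)
open import Algebra.Bundles using (CommutativeRing)
open import Algebra.Definitions using (Invertible)
import Algebra.Properties.CommutativeMonoid.Sum
import Algebra.Properties.Ring
open import Data.Fin.Base using (Fin; toℕ)
import Data.Fin.Properties as Fin
open import Data.List.Base using (List; []; _∷_; length; map; filter; foldr; concatMap; cartesianProduct; cartesianProductWith; upTo)
open import Data.List.Extrema.Nat using (max)
open import Data.List.Membership.Propositional using (_∈_; find; lose)
open import Data.List.Membership.Propositional.Properties
open import Data.List.Relation.Unary.All using (All; all?)
import Data.List.Relation.Unary.All as All
open import Data.List.Relation.Unary.Any using (Any; any?; here; there)
open import Data.List.Relation.Unary.Linked using (Linked; linked?)
open import Data.Nat.Base hiding (_+_; _*_; _⊔_; _/_)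
import Data.Nat.Base as ℕ
open import Data.Nat.LCM using (lcm)
open import Data.Nat.ListAction using (sum)
open import Data.Nat.Primality using (Prime)
import Data.Nat.Properties as ℕ
import Data.Rational as ℚ
open import Data.Rational using (ℚ; 0ℚ)
open import Data.Product.Base using (∃₂; ∃-syntax; _×_; _,_; proj₁; proj₂)
open import Data.Sum.Base using (_⊎_; inj₁; inj₂)
open import Function.Bundles using (Inverse)
open import Function.Properties.Inverse using (Inverse⇒Injection)
open import Level using (Level; _⊔_) renaming (suc to lsuc)
open import Relation.Binary.Core using (Rel)
open import Relation.Binary.Definitions using (Decidable)
open import Relation.Binary.PropositionalEquality as ≡ using (_≡_)
open import Relation.Nullary using (¬_; Dec; ¬?)
open import Relation.Nullary.Decidable using (map′; via-injection; decidable-stable; _×-dec_)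
open import Relation.Unary using (Pred)

PrimePower : ℕ → Set
PrimePower q = ∃₂ λ p k → Prime p × 1 ≤ k × q ≡ p ^ k

-- The largest k with q ^ k ≤ m, for q ≥ 2 and m ≥ 1: all such k satisfy
-- k < q ^ k ≤ m, which bounds the search.
⌊log[_]_⌋ : ℕ → ℕ → ℕ
⌊log[ q ] m ⌋ = max 0 (filter (λ k → q ^ k ℕ.≤? m) (upTo m))

IsPartition : ℕ → List ℕ → Set
IsPartition n σ = Linked _≥_ σ × All (1 ≤_) σ × sum σ ≡ n

isPartition? : ∀ n σ → Dec (IsPartition n σ)
isPartition? n σ = linked? ℕ._≥?_ σ ×-dec all? (1 ℕ.≤?_) σ ×-dec (sum σ ℕ.≟ n)

lists : ℕ → ℕ → List (List ℕ)
lists zero    b = [] ∷ []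
lists (suc k) b = [] ∷ cartesianProductWith _∷_ (upTo (suc b)) (lists k b)

partitions : ℕ → List (List ℕ)
partitions n = filter (isPartition? n) (lists n n)

∈-lists : ∀ {k b} σ → All (1 ≤_) σ → sum σ ≤ k → sum σ ≤ b → σ ∈ lists k b
∈-lists {zero}  []          _           _  _  = here ≡.refl
∈-lists {suc k} []          _           _  _  = here ≡.refl
∈-lists {zero}  (zero ∷ σ)  (() All.∷ _) _ _
∈-lists {suc k} (zero ∷ σ)  (() All.∷ _) _ _
∈-lists {suc k} {b} (suc x ∷ σ) (_ All.∷ pos) s≤k s≤b =
  there (∈-cartesianProductWith⁺ _∷_
    (∈-upTo⁺ (s≤s (ℕ.≤-trans (ℕ.m≤m+n (suc x) (sum σ)) s≤b)))
    (∈-lists σ pos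
      (ℕ.≤-trans (ℕ.m≤n+m (sum σ) x) (s≤s⁻¹ s≤k))
      (ℕ.≤-trans (ℕ.m≤n+m (sum σ) (suc x)) s≤b)))

∈-partitions⁺ : ∀ {n σ} → IsPartition n σ → σ ∈ partitions n
∈-partitions⁺ {n} {σ} p@(_ , pos , ≡.refl) =
  ∈-filter⁺ (isPartition? n) (∈-lists σ pos ℕ.≤-refl ℕ.≤-refl) p

∈-partitions⁻ : ∀ {n σ} → σ ∈ partitions n → IsPartition n σ
∈-partitions⁻ {n} σ∈ = proj₂ (∈-filter⁻ (isPartition? n) {xs = lists n n} σ∈)

partitionsUpTo : ℕ → List (List ℕ)
partitionsUpTo n = concatMap partitions (map suc (upTo n))

∈-partitionsUpTo⁺ : ∀ {n k σ} → 1 ≤ k → k ≤ n → IsPartition k σ → σ ∈ partitionsUpTo n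
∈-partitionsUpTo⁺ {k = suc k} _ k≤n p =
  ∈-concatMap⁺ partitions
    (lose (∈-map⁺ suc (∈-upTo⁺ k≤n)) (∈-partitions⁺ p))

∈-partitionsUpTo⁻ : ∀ {n σ} → σ ∈ partitionsUpTo n → ∃[ k ] 1 ≤ k × k ≤ n × IsPartition k σ
∈-partitionsUpTo⁻ {n} σ∈ with find (∈-concatMap⁻ partitions {xs = map suc (upTo n)} σ∈)
... | k , k∈ , σ∈k with ∈-map⁻ suc k∈
...   | _ , i∈ , ≡.refl = k , s≤s z≤n , ∈-upTo⁻ i∈ , ∈-partitions⁻ σ∈k

lcmOfParts : List ℕ → ℕ
lcmOfParts = foldr lcm 1

lcm₄ : List ℕ × List ℕ × List ℕ × List ℕ → ℕ
lcm₄ (σ₁ , σ₂ , σ₃ , σ₄) =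
  lcm (lcmOfParts σ₁) (lcm (lcmOfParts σ₂) (lcm (lcmOfParts σ₃) (lcmOfParts σ₄)))

-- Each lcm below is at least 1, so for n₁ , … , n₄ ≥ 1 the default value 0 of
-- max plays no role.
𝓛 : ℕ → ℕ → ℕ → ℕ → ℕ
𝓛 n₁ n₂ n₃ n₄ =
  max 0 (map lcm₄
    (cartesianProduct (partitionsUpTo n₁)
    (cartesianProduct (partitionsUpTo n₂)
    (cartesianProduct (partitionsUpTo n₃) (partitionsUpTo n₄)))))

-- A Heyting field on a finite setoid is the same thing as a finite field: both
-- equality and invertibility are then decidable, so _#_ is the negation of _≈_
-- and every element ≉ 0# is invertible (see `invertible` below).
record FiniteField (c ℓ₁ ℓ₂ : Level) (q : ℕ) : Set (lsuc (c ⊔ ℓ₁ ⊔ ℓ₂)) where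
  field
    heytingField : HeytingField c ℓ₁ ℓ₂

  open HeytingField heytingField public

  commutativeRing : CommutativeRing c ℓ₁
  commutativeRing = HeytingCommutativeRing.commutativeRing heytingCommutativeRing

  field
    enumeration : Inverse setoid (≡.setoid (Fin q))

  private module E = Inverse enumeration

  _≈?_ : Decidable _≈_
  _≈?_ = via-injection (Inverse⇒Injection enumeration) Fin._≟_

  invertible : ∀ {x} → ¬ x ≈ 0# → Invertible _≈_ 1# _*_ x
  invertible {x} x≉0 = decidable-stable invertible? λ ¬inv →
    x≉0 (proj₁ (tight x 0#) λ x#0 → ¬inv (inv (#⇒invertible x#0)))
    where
    open Algebra.Properties.Ring (CommutativeRing.ring commutativeRing) using (-0#≈0#)

    x-0≈x : (x - 0#) ≈ x
    x-0≈x = trans (+-congˡ -0#≈0#) (+-identityʳ x)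

    inv : Invertible _≈_ 1# _*_ (x - 0#) → Invertible _≈_ 1# _*_ x
    inv (y , l , r) =
      y , trans (*-congˡ (sym x-0≈x)) l , trans (*-congʳ (sym x-0≈x)) r

    invertible? : Dec (Invertible _≈_ 1# _*_ x)
    invertible? = map′
      (λ (i , e) → E.from i , trans (*-comm (E.from i) x) e , e)
      (λ (y , _ , e) → E.to y , trans (*-congˡ (E.strictlyInverseʳ y)) e)
      (Fin.any? λ i → (x * E.from i) ≈? 1#)

module _ {c ℓ₁ ℓ₂ q} (𝔽 : FiniteField c ℓ₁ ℓ₂ q) where

  open FiniteField 𝔽 hiding (zero)
  open CommutativeRing commutativeRing using (+-commutativeMonoid)
  open Algebra.Properties.CommutativeMonoid.Sum +-commutativeMonoid using (sum-syntax; sum⁺-syntax; sum-cong-≋)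

  Sequence : Set c
  Sequence = ℕ → Carrier

  -- A m n is the coefficient of xᵐ yⁿ.
  PowerSeries : Set c
  PowerSeries = ℕ → ℕ → Carrier

  record Polynomial : Set (c ⊔ ℓ₁) where
    field
      coeff     : PowerSeries
      bound     : ℕ
      vanishing : ∀ i j → bound ≤ i ⊎ bound ≤ j → coeff i j ≈ 0#

    -- The largest i such that some xⁱ yʲ has a nonzero coefficient; the zero
    -- polynomial gets degree 0.  Likewise for degʸ.
    degˣ degʸ : ℕ
    degˣ = max 0 (filter (λ i → any? (λ j → ¬? (coeff i j ≈? 0#)) (upTo bound)) (upTo bound))
    degʸ = max 0 (filter (λ j → any? (λ i → ¬? (coeff i j ≈? 0#)) (upTo bound)) (upTo bound))

  open Polynomial

  infixl 7 _⊛_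

  _⊛_ : PowerSeries → PowerSeries → PowerSeries
  (A ⊛ B) m n = ∑[ i ≤ m ] ∑[ j ≤ n ] (A (toℕ i) (toℕ j) * B (m ∸ toℕ i) (n ∸ toℕ j))

  module Division (P Q : PowerSeries) (Q₀≉0 : ¬ Q 0 0 ≈ 0#) where

    -- (Q ⊛ A) m n without its term Q 0 0 * A m n.
    restˣ restʸ : PowerSeries → PowerSeries
    restʸ A m n = ∑[ j < n ] (Q 0 (suc (toℕ j)) * A m (n ∸ suc (toℕ j)))
    restˣ A m n = ∑[ i < m ] ∑[ j ≤ n ] (Q (suc (toℕ i)) (toℕ j) * A (m ∸ suc (toℕ i)) (n ∸ toℕ j))

    -- Solve the equation (Q ⊛ A) m n = P m n for its term A m n.
    solve : PowerSeries → PowerSeries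
    solve A m n = proj₁ (invertible Q₀≉0) * (P m n - (restʸ A m n + restˣ A m n))

    -- approx k has the right coefficients in total degree less than k.
    approx : ℕ → PowerSeries
    approx zero    m n = 0#
    approx (suc k)     = solve (approx k)

    quotient : PowerSeries
    quotient m n = approx (suc (m ℕ.+ n)) m n

    private
      Agree : ℕ → Rel PowerSeries ℓ₁
      Agree k A B = ∀ m n → m ℕ.+ n < k → A m n ≈ B m n

      m∸s : ∀ {m} (i : Fin m) → suc (m ∸ suc (toℕ i)) ≤ m
      m∸s {suc m} i = s≤s (ℕ.m∸n≤m m (toℕ i))

      restʸ-cong : ∀ {A B} m n → Agree (m ℕ.+ n) A B → restʸ A m n ≈ restʸ B m n
      restʸ-cong m n A≈B = sum-cong-≋ λ j → *-congˡ
        (A≈B m _ (ℕ.+-monoʳ-< m (m∸s j)))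

      restˣ-cong : ∀ {A B} m n → Agree (m ℕ.+ n) A B → restˣ A m n ≈ restˣ B m n
      restˣ-cong m n A≈B = sum-cong-≋ λ i → sum-cong-≋ λ (j : Fin (suc n)) →
        *-congˡ {x = Q (suc (toℕ i)) (toℕ j)} (A≈B (m ∸ suc (toℕ i)) (n ∸ toℕ j) (ℕ.+-mono-<-≤ (m∸s i) (ℕ.m∸n≤m n (toℕ j))))

      approx-agree : ∀ k l → Agree k (approx k) (approx (k ℕ.+ l))
      approx-agree (suc k) l m n m+n<k = *-congˡ (+-congˡ (-‿cong
        (+-cong (restʸ-cong m n agree) (restˣ-cong m n agree))))
        where
        agree : Agree (m ℕ.+ n) (approx k) (approx (k ℕ.+ l))
        agree i j lt = approx-agree k l i j (ℕ.<-≤-trans lt (s≤s⁻¹ m+n<k))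

      quotient-agree : ∀ k → Agree k quotient (approx k)
      quotient-agree k m n lt = trans
        (approx-agree (suc (m ℕ.+ n)) (k ∸ suc (m ℕ.+ n)) m n ℕ.≤-refl)
        (reflexive (≡.cong (λ k → approx k m n) (ℕ.m+[n∸m]≡n lt)))

    quotient-correct : ∀ m n → (Q ⊛ quotient) m n ≈ P m n
    quotient-correct m n = begin
      (Q 0 0 * quotient m n + restʸ quotient m n) + restˣ quotient m n
        ≈⟨ +-assoc _ _ _ ⟩
      Q 0 0 * (u * (P m n - R)) + (restʸ quotient m n + restˣ quotient m n)
        ≈⟨ +-cong (*-assoc _ _ _) (sym rest) ⟨
      (Q 0 0 * u) * (P m n - R) + R
        ≈⟨ +-congʳ (trans (*-congʳ (proj₂ (proj₂ (invertible Q₀≉0)))) (*-identityˡ _)) ⟩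
      (P m n - R) + R
        ≈⟨ trans (+-assoc _ _ _) (+-congˡ (-‿inverseˡ R)) ⟩
      P m n + 0#
        ≈⟨ +-identityʳ _ ⟩
      P m n ∎
      where
      open import Relation.Binary.Reasoning.Setoid setoid

      u = proj₁ (invertible Q₀≉0)
      R = restʸ (approx (m ℕ.+ n)) m n + restˣ (approx (m ℕ.+ n)) m n

      rest : (restʸ quotient m n + restˣ quotient m n) ≈ R
      rest = +-cong (restʸ-cong m n (quotient-agree (m ℕ.+ n)))
                    (restˣ-cong m n (quotient-agree (m ℕ.+ n)))

  divide : (P Q : Polynomial) → ¬ coeff Q 0 0 ≈ 0# → PowerSeries
  divide P Q = Division.quotient (coeff P) (coeff Q)

  𝒟 : PowerSeries → Sequence
  𝒟 A n = A n n

  _≋_ : Rel Sequence ℓ₁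
  s ≋ t = ∀ n → s n ≈ t n

  ker : ℕ → Sequence → Pred Sequence ℓ₁
  ker k a s = ∃₂ λ e r → r < k ^ e × s ≋ (λ n → a (k ^ e ℕ.* n ℕ.+ r))

  -- S, as a set of sequences up to _≋_, has at most k elements.  The sequences ts
  -- need not lie in S, and S need not be decidable.
  HasSize≤ : ∀ {ℓ} → Pred Sequence ℓ → ℕ → Set (c ⊔ ℓ₁ ⊔ ℓ)
  HasSize≤ S k = ∃[ ts ] length ts ≤ k × (∀ s → S s → Any (s ≋_) ts)

-- Whenever P and Q over a field with q elements have h and d as the maxima of
-- their x- and y-degrees, the size of the q-kernel of the diagonal of P / Q is at
-- most some k with B k.  B is an upper bound: k ≤ N, or k ≤ r for a rational r.
KernelBound : (c ℓ₁ ℓ₂ : Level) (q h d : ℕ) (B : ℕ → Set) → Set (lsuc (c ⊔ ℓ₁ ⊔ ℓ₂))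
KernelBound c ℓ₁ ℓ₂ q h d B =
  PrimePower q →
  (𝔽 : FiniteField c ℓ₁ ℓ₂ q) → let open FiniteField 𝔽 using (_≈_; 0#); open Polynomial in
  (P Q : Polynomial 𝔽) (Q₀≉0 : ¬ coeff Q 0 0 ≈ 0#) →
  h ≡ degˣ P ℕ.⊔ degˣ Q → d ≡ degʸ P ℕ.⊔ degʸ Q →
  1 ≤ h → 1 ≤ d →
  ∃[ k ] HasSize≤ 𝔽 (ker 𝔽 q (𝒟 𝔽 (divide 𝔽 P Q Q₀≉0))) k × B k

TendsToZero : (ℕ → ℚ) → Set
TendsToZero ε = ∀ δ → 0ℚ ℚ.< δ → ∃[ N ] ∀ n → N ≤ n → ℚ.∣ ε n ∣ ℚ.< δ

{-# OPTIONS --safe #-}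
-- Let Λᵣ map Σ a(m,n) xᵐ yⁿ to Σ a(qm+r,qn+r) xᵐ yⁿ.  Since Λᵣ(f^q g) = f Λᵣ(g), we
-- have Λᵣ(S / Q) = Λᵣ(S Q^{q-1}) / Q, so every kernel element is the diagonal of S / Q
-- for a numerator S obtained from P by a word in the maps S ↦ Λᵣ(S Q^{q-1}).  These
-- preserve bidegree ≤ (h , d), and those with r > 0 lead into the q^{hd} polynomials of
-- bidegree ≤ (h - 1 , d - 1), which all of them preserve.  What remains is the orbit of P
-- under r = 0.  There each of the four borders of S evolves by s ↦ Λ₀(s R^{q-1}), where R
-- is the corresponding border of Q.  If the irreducible factors of R have degrees σ, with
-- l = lcm σ, and q^e exceeds the degree of R, then R divides x^{q^e} - x^{q^{e+l}}; so the
-- coefficients of s / R have period q^e (q^l - 1), and s has period l after e + 1 steps.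
-- A numerator is then determined by the phase of its borders and its (h - 1) (d - 1)
-- interior coefficients.  The asymptotics hold because parts m ≥ 16 satisfy m⁴ ≤ 2ᵐ, so
-- that lcm(σ)⁴ ≤ C 2^{|σ|} and 𝓛 is dominated by the missing factor q^{h+d-1}.
module Submission where

open import Algebra.Bundles using (CommutativeRing)
import Algebra.Properties.CommutativeMonoid.Sum
import Algebra.Properties.CommutativeSemigroup
import Algebra.Properties.CommutativeSemigroup.Divisibility
import Algebra.Properties.CommutativeSemiring.Binomial
import Algebra.Properties.CommutativeSemiring.Exp
import Algebra.Properties.Group
import Algebra.Properties.Ring
import Algebra.Properties.Semiring.Mult
import Algebra.Solver.Ring.NaturalCoefficients.Default
open import Data.Fin.Base as Fin using (Fin; toℕ; fromℕ<; punchIn; finToFun; funToFin; combine; remQuot)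
open import Data.Fin.Permutation using (permutation)
import Data.Fin.Properties as Fin
import Data.Integer.Base as ℤ
import Data.Integer.Properties as ℤ
open import Data.List.Base using (List; []; _∷_; _++_; foldr; length; tabulate; map; filter; upTo; cartesianProduct)
open import Data.List.Extrema.Nat using (max; xs≤max; max≤v⁺; argmax-all)
open import Data.List.Membership.Propositional using (_∈_; lose)
open import Data.List.Membership.Propositional.Properties
open import Data.List.Properties using (length-++; length-tabulate)
open import Data.List.Relation.Binary.Permutation.Propositional using (↭-sym)
open import Data.List.Relation.Binary.Permutation.Propositional.Properties using (All-resp-↭)
open import Data.List.Relation.Unary.All as All using (All; []; _∷_)
import Data.List.Relation.Unary.All.Properties as All
open import Data.List.Relation.Unary.Any using (Any; any?)
import Data.List.Relation.Unary.Any.Properties as Any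
open import Data.List.Relation.Unary.Linked using ([-])
import Data.List.Sort
open import Data.Nat.Base as ℕ using (ℕ; zero; suc; _∸_; _≤_; _<_; z≤n; s≤s)
import Data.Nat.Combinatorics as ℕ using (_C_; nCk≡n!/k![n-k]!; k![n∸k]!∣n!; nCn≡1)
import Data.Nat.Divisibility as ℕ∣
open import Data.Nat.DivMod using (_/_; _%_; m/n*n≡m; m≡m%n+[m/n]*n; m%n<n; m<n*o⇒m/o<n)
open import Data.Nat.Induction using (<-rec)
open import Data.Nat.LCM using (lcm; m∣lcm[m,n]; n∣lcm[m,n]; lcm-least)
import Data.Nat.ListAction as ℕ using (sum)
open import Data.Nat.ListAction.Properties using (sum-++; sum-↭)
open import Data.Nat.Primality using (Prime; euclidsLemma; prime⇒nonTrivial)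
import Data.Nat.Properties as ℕ
open import Data.Nat.Solver using (module +-*-Solver)
open import Data.Product.Base using (_×_; _,_; proj₁; proj₂; ∃-syntax; ∃₂)
import Data.Rational as ℚ
open import Data.Rational using (ℚ; mkℚ; 0ℚ; 1ℚ)
import Data.Rational.Properties as ℚ
open import Data.Rational.Unnormalised.Base as ℚᵘ using (mkℚᵘ; *≤*; *<*)
import Data.Rational.Unnormalised.Properties as ℚᵘ
open import Data.Sum.Base using (_⊎_; inj₁; inj₂)
open import Data.Unit.Base using (tt)
open import Data.Vec.Functional using (removeAt; replicate)
open import Defs
open import Function.Base using (_∘_)
open import Function.Bundles using (Inverse)
open import Level using (Level)
import Relation.Binary.Construct.Flip.EqAndOrd as Flip
open import Relation.Binary.PropositionalEquality as ≡ using (_≡_)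
import Relation.Binary.Reasoning.Setoid
open import Relation.Nullary using (¬_; Dec; yes; no; contradiction; ¬?)

-- Formal power series

-- Only Q(0,0) ≠ 0 is known about Q: a border may vanish, be divisible by the variable or have
-- repeated factors. This is why the orbit under r = 0 has a preperiod. Taking K = q^e₀ above h and
-- d settles the last two cases together. The K-th power absorbs the multiplicities, and the factor
-- x^K in the common denominator x^K (1 - x^L) is harmless after e₀ + 1 steps: a coefficient at a
-- negative exponent would then have to come from an exponent below - K.
--
-- Borders can be followed separately because extreme coefficients of a product are products of
-- extreme coefficients. Interior coefficients mix, so they are counted and no period is claimed for
-- them.
--
-- The state of the recursion is the expanded fraction A, and its numerator is recovered as `Q ⋆ A`;
-- membership in a space of numerators is thus a degree condition on a product. Series are taken
-- over arbitrary commutative rings, so that a series in two variables is a series of series and the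
-- operator in y acts on the coefficients met by the operator in x.

module PowerSeries {c ℓ} (R : CommutativeRing c ℓ) where

  open CommutativeRing R hiding (zero)
  open Algebra.Properties.CommutativeMonoid.Sum +-commutativeMonoid using (sum-syntax; sum⁺-syntax; sum-cong-≋)
  open Algebra.Solver.Ring.NaturalCoefficients.Default commutativeSemiring using (solve; _:+_; _:*_; _:=_)
  open Relation.Binary.Reasoning.Setoid setoid

  -- Without η-equality and with operations given by copatterns, products of
  -- series do not unfold, so that Agda can infer their factors.
  record Series : Set c where
    no-eta-equality
    constructor series
    field
      coef : ℕ → Carrier
  open Series public

  infix 4 _≗_
  record _≗_ (f g : Series) : Set ℓ where
    constructor pointwise
    field
      at : ∀ n → coef f n ≈ coef g n
  open _≗_ public

  infixl 7 _⋆_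
  infixl 6 _⊞_

  _⊞_ _⋆_ : Series → Series → Series
  coef (f ⊞ g) n = coef f n + coef g n
  coef (f ⋆ g) n = ∑[ i ≤ n ] (coef f (toℕ i) * coef g (n ∸ toℕ i))

  ⊟_ tail x·_ : Series → Series
  coef (⊟ f) n = - coef f n
  coef (tail f) n = coef f (suc n)
  coef (x· f) zero    = 0#
  coef (x· f) (suc n) = coef f n

  𝟘 : Series
  coef 𝟘 n = 0#

  C : Carrier → Series
  coef (C a) zero    = a
  coef (C a) (suc n) = 0#

  ⋆-cong : ∀ {f f′ g g′} → f ≗ f′ → g ≗ g′ → f ⋆ g ≗ f′ ⋆ g′
  at (⋆-cong p q) n = sum-cong-≋ {suc n} λ i → *-cong (at p (toℕ i)) (at q (n ∸ toℕ i))

  ≗-refl : ∀ {f} → f ≗ f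
  at ≗-refl n = refl

  ⋆-zeroˡ-at : ∀ f g n → (∀ i → coef f i ≈ 0#) → coef (f ⋆ g) n ≈ 0#
  ⋆-zeroˡ-at f g zero    f≈0 = trans (+-identityʳ _) (trans (*-congʳ (f≈0 0)) (zeroˡ _))
  ⋆-zeroˡ-at f g (suc n) f≈0 = trans
    (+-cong (trans (*-congʳ (f≈0 0)) (zeroˡ _)) (⋆-zeroˡ-at (tail f) g n λ i → f≈0 (suc i)))
    (+-identityˡ _)

  C-⋆ : ∀ a g n → coef (C a ⋆ g) n ≈ a * coef g n
  C-⋆ a g zero    = +-identityʳ _
  C-⋆ a g (suc n) = trans (+-congˡ (⋆-zeroˡ-at (tail (C a)) g n λ _ → refl)) (+-identityʳ _)

  x·-⋆ : ∀ f g → (x· f) ⋆ g ≗ x· (f ⋆ g)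
  at (x·-⋆ f g) zero    = trans (+-identityʳ _) (zeroˡ _)
  at (x·-⋆ f g) (suc n) = trans (+-congʳ (zeroˡ _)) (+-identityˡ _)

  ⋆-distribʳ-at : ∀ n f g h → coef ((f ⊞ g) ⋆ h) n ≈ coef (f ⋆ h ⊞ g ⋆ h) n
  ⋆-distribʳ-at zero    f g h =
    solve 3 (λ a b c → (a :+ b) :* c :+ con 0 := (a :* c :+ con 0) :+ (b :* c :+ con 0)) refl
      (coef f 0) (coef g 0) (coef h 0)
    where open Algebra.Solver.Ring.NaturalCoefficients.Default commutativeSemiring using (con)
  ⋆-distribʳ-at (suc n) f g h = begin
    (f₀ + g₀) * h₁ + coef (tail (f ⊞ g) ⋆ h) n
      ≈⟨ +-congˡ (trans (at (⋆-cong {tail (f ⊞ g)} {tail f ⊞ tail g} (pointwise λ _ → refl) (≗-refl {h})) n)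
          (⋆-distribʳ-at n (tail f) (tail g) h)) ⟩
    (f₀ + g₀) * h₁ + (s + t)
      ≈⟨ solve 5 (λ a b c s t → (a :+ b) :* c :+ (s :+ t) := (a :* c :+ s) :+ (b :* c :+ t)) refl f₀ g₀ h₁ s t ⟩
    (f₀ * h₁ + s) + (g₀ * h₁ + t) ∎
    where
    f₀ = coef f 0
    g₀ = coef g 0
    h₁ = coef h (suc n)
    s = coef (tail f ⋆ h) n
    t = coef (tail g ⋆ h) n

  -- The sum defining a product unfolds from the constant term of `f`. Commutativity also needs it
  -- unfolded from the constant term of `g`.
  ⋆-suc-last : ∀ n f g → coef (f ⋆ g) (suc n) ≈ coef (f ⋆ tail g) n + coef f (suc n) * coef g 0
  ⋆-suc-last zero    f g = trans (+-congˡ (+-identityʳ _)) (+-congʳ (sym (+-identityʳ _)))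
  ⋆-suc-last (suc n) f g = trans (+-congˡ (⋆-suc-last n (tail f) g)) (sym (+-assoc _ _ _))

  ⋆-comm-at : ∀ n f g → coef (f ⋆ g) n ≈ coef (g ⋆ f) n
  ⋆-comm-at zero    f g = +-congʳ (*-comm _ _)
  ⋆-comm-at (suc n) f g = begin
    coef (f ⋆ g) (suc n)                                   ≈⟨ ⋆-suc-last n f g ⟩
    coef (f ⋆ tail g) n + coef f (suc n) * coef g 0        ≈⟨ +-cong (⋆-comm-at n f (tail g)) (*-comm _ _) ⟩
    coef (tail g ⋆ f) n + coef g 0 * coef f (suc n)        ≈⟨ +-comm _ _ ⟩
    coef (g ⋆ f) (suc n)                                   ∎

  -- By `tail-⋆` the tail of `f ⋆ g` is a sum of two products, so distributivity leaves two triple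
  -- products to compare at the smaller index.
  ⋆-assoc-at : ∀ n f g h → coef ((f ⋆ g) ⋆ h) n ≈ coef (f ⋆ (g ⋆ h)) n
  ⋆-assoc-at zero    f g h = begin
    (f₀ * g₀ + 0#) * h₀ + 0#    ≈⟨ +-congʳ (*-congʳ (+-identityʳ _)) ⟩
    (f₀ * g₀) * h₀ + 0#         ≈⟨ +-congʳ (*-assoc _ _ _) ⟩
    f₀ * (g₀ * h₀) + 0#         ≈⟨ +-congʳ (*-congˡ (+-identityʳ _)) ⟨
    f₀ * (g₀ * h₀ + 0#) + 0#    ∎
    where
    f₀ = coef f 0
    g₀ = coef g 0
    h₀ = coef h 0
  ⋆-assoc-at (suc n) f g h = begin
    (f₀ * g₀ + 0#) * h₁ + coef (tail (f ⋆ g) ⋆ h) n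
      ≈⟨ +-cong (*-congʳ (+-identityʳ _)) (at (⋆-cong tail-⋆ (≗-refl {h})) n) ⟩
    f₀ * g₀ * h₁ + coef ((C f₀ ⋆ tail g ⊞ tail f ⋆ g) ⋆ h) n
      ≈⟨ +-congˡ (⋆-distribʳ-at n (C f₀ ⋆ tail g) (tail f ⋆ g) h) ⟩
    f₀ * g₀ * h₁ + (coef (C f₀ ⋆ tail g ⋆ h) n + coef (tail f ⋆ g ⋆ h) n)
      ≈⟨ +-congˡ (+-cong (trans (⋆-assoc-at n (C f₀) (tail g) h) (C-⋆ f₀ (tail g ⋆ h) n))
        (⋆-assoc-at n (tail f) g h)) ⟩
    f₀ * g₀ * h₁ + (f₀ * s + t)
      ≈⟨ solve 5 (λ a b c s t → a :* b :* c :+ (a :* s :+ t) := a :* (b :* c :+ s) :+ t) refl f₀ g₀ h₁ s t ⟩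
    f₀ * (g₀ * h₁ + s) + t ∎
    where
    f₀ = coef f 0
    g₀ = coef g 0
    h₁ = coef h (suc n)
    s = coef (tail g ⋆ h) n
    t = coef (tail f ⋆ (g ⋆ h)) n

    tail-⋆ : tail (f ⋆ g) ≗ C f₀ ⋆ tail g ⊞ tail f ⋆ g
    at tail-⋆ n = +-congʳ (sym (C-⋆ f₀ (tail g) n))

  seriesRing : CommutativeRing c ℓ
  seriesRing = record
    { Carrier = Series
    ; _≈_ = _≗_
    ; _+_ = _⊞_
    ; _*_ = _⋆_
    ; -_ = ⊟_
    ; 0# = 𝟘
    ; 1# = C 1#
    ; isCommutativeRing = record
      { isRing = record
        { +-isAbelianGroup = record
          { isGroup = record
            { isMonoid = record
              { isSemigroup = record
                { isMagma = record
                  { isEquivalence = record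
                    { refl = ≗-refl
                    ; sym = λ p → pointwise λ n → sym (at p n)
                    ; trans = λ p q → pointwise λ n → trans (at p n) (at q n)
                    }
                  ; ∙-cong = λ p q → pointwise λ n → +-cong (at p n) (at q n)
                  }
                ; assoc = λ f g h → pointwise λ n → +-assoc _ _ _
                }
              ; identity = (λ f → pointwise λ n → +-identityˡ _) , (λ f → pointwise λ n → +-identityʳ _)
              }
            ; inverse = (λ f → pointwise λ n → -‿inverseˡ _) , (λ f → pointwise λ n → -‿inverseʳ _)
            ; ⁻¹-cong = λ p → pointwise λ n → -‿cong (at p n)
            }
          ; comm = λ f g → pointwise λ n → +-comm _ _
          }
        ; *-cong = ⋆-cong
        ; *-assoc = λ f g h → pointwise λ n → ⋆-assoc-at n f g h
        ; *-identity = 1-⋆ , λ f → pointwise λ n → trans (⋆-comm-at n f (C 1#)) (at (1-⋆ f) n)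
        ; distrib =
          (λ f g h → pointwise λ n → trans (⋆-comm-at n f (g ⊞ h)) (trans (⋆-distribʳ-at n g h f)
            (+-cong (⋆-comm-at n g f) (⋆-comm-at n h f)))) ,
          (λ f g h → pointwise λ n → ⋆-distribʳ-at n g h f)
        }
      ; *-comm = λ f g → pointwise λ n → ⋆-comm-at n f g
      }
    }
    where
    1-⋆ : ∀ f → C 1# ⋆ f ≗ f
    at (1-⋆ f) n = trans (C-⋆ 1# f n) (*-identityˡ _)

-- Finite commutative rings

prime∤! : ∀ {p} → Prime p → ∀ k → k < p → ¬ p ℕ∣.∣ k ℕ.!
prime∤! pp zero    _   p∣1 = ℕ.<⇒≱ (ℕ.nonTrivial⇒n>1 _ {{prime⇒nonTrivial pp}}) (ℕ∣.∣⇒≤ p∣1)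
prime∤! pp (suc k) k<p p∣k! with euclidsLemma (suc k) (k ℕ.!) pp p∣k!
... | inj₁ p∣1+k = ℕ.<⇒≱ k<p (ℕ∣.∣⇒≤ p∣1+k)
... | inj₂ p∣k!′ = prime∤! pp k (ℕ.<-trans ℕ.≤-refl k<p) p∣k!′

-- The prime divides p! = C(p,k) k! (p - k)! but neither of the two factorials, by `prime∤!`.
prime∣C : ∀ {p} → Prime p → ∀ k → 0 < k → k < p → p ℕ∣.∣ p ℕ.C k
prime∣C {suc p} pp k 0<k k<p with
  euclidsLemma (suc p ℕ.C k) (k ℕ.! ℕ.* (suc p ∸ k) ℕ.!) pp (≡.subst (suc p ℕ∣.∣_) p!≡ (ℕ∣.m∣m*n (p ℕ.!)))
  where
  instance
    k!≢0 : ℕ.NonZero (k ℕ.! ℕ.* (suc p ∸ k) ℕ.!)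
    k!≢0 = ℕ._!*_!≢0 k (suc p ∸ k)
  p!≡ : suc p ℕ.! ≡ (suc p ℕ.C k) ℕ.* (k ℕ.! ℕ.* (suc p ∸ k) ℕ.!)
  p!≡ = ≡.sym (≡.trans (≡.cong (ℕ._* (k ℕ.! ℕ.* (suc p ∸ k) ℕ.!)) (ℕ.nCk≡n!/k![n-k]! (ℕ.<⇒≤ k<p)))
    (m/n*n≡m (ℕ.k![n∸k]!∣n! (ℕ.<⇒≤ k<p))))
... | inj₁ p∣C = p∣C
... | inj₂ p∣!! with euclidsLemma (k ℕ.!) ((suc p ∸ k) ℕ.!) pp p∣!!
...   | inj₁ p∣! = contradiction p∣! (prime∤! pp k k<p)
...   | inj₂ p∣! = contradiction p∣! (prime∤! pp (suc p ∸ k) (ℕ.∸-monoʳ-< 0<k (ℕ.<⇒≤ k<p)))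

module Powers {c ℓ} (R : CommutativeRing c ℓ) where

  open CommutativeRing R hiding (zero)
  open Algebra.Properties.CommutativeSemiring.Exp commutativeSemiring public
  open Algebra.Properties.Semiring.Mult semiring public using () renaming (_×_ to _·_)
  open Algebra.Properties.Semiring.Mult semiring using (×1-homo-*; ×-congʳ; ×-assoc-*)
  open Relation.Binary.Reasoning.Setoid setoid

  Additive : ℕ → Set (c Level.⊔ ℓ)
  Additive n = ∀ a b → (a + b) ^ n ≈ a ^ n + b ^ n

  0^ : ∀ {n} → 0 < n → 0# ^ n ≈ 0#
  0^ (s≤s _) = zeroˡ _

  1^ : ∀ n → 1# ^ n ≈ 1#
  1^ zero    = refl
  1^ (suc n) = trans (*-identityˡ _) (1^ n)

  additive-^ : ∀ {n} → Additive n → ∀ k → Additive (n ℕ.^ k)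
  additive-^ add zero    a b = trans (*-identityʳ _) (+-cong (sym (*-identityʳ a)) (sym (*-identityʳ b)))
  additive-^ {n} add (suc k) a b = begin
    (a + b) ^ (n ℕ.* m)              ≈⟨ ^-assocʳ (a + b) n m ⟨
    ((a + b) ^ n) ^ m                ≈⟨ ^-congˡ m (add a b) ⟩
    (a ^ n + b ^ n) ^ m              ≈⟨ additive-^ add k _ _ ⟩
    (a ^ n) ^ m + (b ^ n) ^ m        ≈⟨ +-cong (^-assocʳ a n m) (^-assocʳ b n m) ⟩
    a ^ (n ℕ.* m) + b ^ (n ℕ.* m)    ∎
    where m = n ℕ.^ k

  ×-zero : ∀ {p} → p · 1# ≈ 0# → ∀ {n} → p ℕ∣.∣ n → ∀ x → n · x ≈ 0#
  ×-zero {p} p×1≈0 (ℕ∣.divides m ≡.refl) x = begin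
    (m ℕ.* p) · x              ≈⟨ ×-congʳ (m ℕ.* p) (*-identityˡ x) ⟨
    (m ℕ.* p) · (1# * x)       ≈⟨ ×-assoc-* (m ℕ.* p) 1# x ⟨
    ((m ℕ.* p) · 1#) * x       ≈⟨ *-congʳ (×1-homo-* m p) ⟩
    ((m · 1#) * (p · 1#)) * x  ≈⟨ *-congʳ (trans (*-congˡ p×1≈0) (zeroʳ _)) ⟩
    0# * x                     ≈⟨ zeroˡ x ⟩
    0#                         ∎

  private module Binom = Algebra.Properties.CommutativeSemiring.Binomial commutativeSemiring
  open Algebra.Properties.CommutativeMonoid.Sum +-commutativeMonoid
    using (sum; sum-init-last; sum-cong-≋; sum-replicate-zero)

  -- In the binomial theorem `sum-init-last` isolates the two extreme terms; p divides every
  -- coefficient between them.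
  frobenius : ∀ {p} → Prime p → p · 1# ≈ 0# → Additive p
  frobenius {suc p} pp p×1≈0 a b = begin
    (a + b) ^ suc p                                       ≈⟨ Binom.theorem (suc p) a b ⟩
    t Fin.zero + sum (t ∘ Fin.suc)                        ≈⟨ +-congˡ (sum-init-last (t ∘ Fin.suc)) ⟩
    t Fin.zero + (sum (t ∘ Fin.suc ∘ Fin.inject₁) + t (Fin.suc (Fin.fromℕ p)))
      ≈⟨ +-cong first (trans (+-cong middle last) (+-identityˡ _)) ⟩
    b ^ suc p + a ^ suc p                                 ≈⟨ +-comm _ _ ⟩
    a ^ suc p + b ^ suc p                                 ∎
    where
    t = Binom.binomialTerm a b (suc p)

    first : t Fin.zero ≈ b ^ suc p
    first = trans (+-identityʳ _) (*-identityˡ _)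

    last : t (Fin.suc (Fin.fromℕ p)) ≈ a ^ suc p
    last = begin
      t (Fin.suc (Fin.fromℕ p))
        ≡⟨ ≡.cong (λ k → (suc p ℕ.C suc k) · (a ^ suc k * b ^ (p ∸ k))) (Fin.toℕ-fromℕ p) ⟩
      (suc p ℕ.C suc p) · (a ^ suc p * b ^ (p ∸ p))
        ≡⟨ ≡.cong₂ (λ m k → m · (a ^ suc p * b ^ k)) (ℕ.nCn≡1 (suc p)) (ℕ.n∸n≡0 p) ⟩
      1 · (a ^ suc p * 1#)
        ≈⟨ trans (+-identityʳ _) (*-identityʳ _) ⟩
      a ^ suc p ∎

    middle : sum (t ∘ Fin.suc ∘ Fin.inject₁) ≈ 0#
    middle = trans
      (sum-cong-≋ {p} λ i → ×-zero p×1≈0 (prime∣C pp (suc (toℕ (Fin.inject₁ i))) (s≤s z≤n)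
        (s≤s (≡.subst (_< p) (≡.sym (Fin.toℕ-inject₁ i)) (Fin.toℕ<n i)))) _)
      (sum-replicate-zero p)

  -- Obtained from (a - b) + b = a, which avoids evaluating the n-th power of - 1.
  additive-minus : ∀ {n} → Additive n → ∀ a b → (a - b) ^ n ≈ a ^ n - b ^ n
  additive-minus {n} add a b = begin
    (a - b) ^ n                          ≈⟨ +-identityʳ _ ⟨
    (a - b) ^ n + 0#                     ≈⟨ +-congˡ (-‿inverseʳ (b ^ n)) ⟨
    (a - b) ^ n + (b ^ n - b ^ n)        ≈⟨ +-assoc _ _ _ ⟨
    (a - b) ^ n + b ^ n - b ^ n          ≈⟨ +-congʳ (add (a - b) b) ⟨
    (a - b + b) ^ n - b ^ n              ≈⟨ +-congʳ (^-congˡ n (trans (+-assoc a (- b) b)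
                                              (trans (+-congˡ (-‿inverseˡ b)) (+-identityʳ a)))) ⟩
    a ^ n - b ^ n                        ∎

  Unit : Carrier → Set (c Level.⊔ ℓ)
  Unit x = ∃[ y ] x * y ≈ 1#

  unit-cancel : ∀ {x y z} → Unit x → x * y ≈ x * z → y ≈ z
  unit-cancel {x} {y} {z} (x⁻¹ , x*x⁻¹≈1) eq = begin
    y               ≈⟨ inverse y ⟨
    x⁻¹ * (x * y)   ≈⟨ *-congˡ eq ⟩
    x⁻¹ * (x * z)   ≈⟨ inverse z ⟩
    z               ∎
    where
    inverse : ∀ w → x⁻¹ * (x * w) ≈ w
    inverse w = trans (sym (*-assoc _ _ _)) (trans (*-congʳ (trans (*-comm _ _) x*x⁻¹≈1)) (*-identityˡ w))

  unit-* : ∀ {x y} → Unit x → Unit y → Unit (x * y)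
  unit-* {x} {y} (x⁻¹ , ex) (y⁻¹ , ey) = x⁻¹ * y⁻¹ , (begin
    x * y * (x⁻¹ * y⁻¹)      ≈⟨ *-assoc _ _ _ ⟩
    x * (y * (x⁻¹ * y⁻¹))    ≈⟨ *-congˡ (trans (*-congˡ (*-comm _ _)) (sym (*-assoc _ _ _))) ⟩
    x * (y * y⁻¹ * x⁻¹)      ≈⟨ *-congˡ (trans (*-congʳ ey) (*-identityˡ _)) ⟩
    x * x⁻¹                  ≈⟨ ex ⟩
    1#                       ∎)

  unit-1 : Unit 1#
  unit-1 = 1# , *-identityˡ 1#

  unit-^ : ∀ {x} → Unit x → ∀ n → Unit (x ^ n)
  unit-^ u zero    = unit-1
  unit-^ u (suc n) = unit-* u (unit-^ u n)

  -- p ^ k · 1 is the k-th power of p · 1. If p · 1 is a unit, then so is 0, and the ring is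
  -- trivial, where the conclusion still holds.
  characteristic : ∀ p k → p · 1# ≈ 0# ⊎ Unit (p · 1#) → (p ℕ.^ k) · 1# ≈ 0# → p · 1# ≈ 0#
  characteristic p k (inj₁ p≈0) _ = p≈0
  characteristic p k (inj₂ u) pᵏ≈0 = trans (sym (*-identityʳ _)) (trans (*-congˡ 1≈0) (zeroʳ _))
    where
    power : ∀ k → (p ℕ.^ k) · 1# ≈ (p · 1#) ^ k
    power zero    = +-identityʳ 1#
    power (suc k) = trans (×1-homo-* p (p ℕ.^ k)) (*-congˡ (power k))
    1≈0 : 1# ≈ 0#
    1≈0 = unit-cancel (unit-^ u k)
      (trans (*-congʳ (trans (sym (power k)) pᵏ≈0)) (trans (zeroˡ 1#) (sym (zeroʳ _))))

  module Translation {N} (elem : Fin N → Carrier) (index : Carrier → Fin N)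
    (elem∘index : ∀ a → elem (index a) ≈ a) (elem-injective : ∀ i j → elem i ≈ elem j → i ≡ j) where

    private
      module + = Algebra.Properties.CommutativeMonoid.Sum +-commutativeMonoid

    -- Translation by 1 permutes the elements, so it preserves their sum.
    N×1≈0 : N · 1# ≈ 0#
    N×1≈0 = begin
      N · 1#                                  ≈⟨ +.sum-replicate N ⟨
      +.sum (replicate N 1#)                  ≈⟨ +-identityˡ _ ⟨
      0# + +.sum (replicate N 1#)             ≈⟨ +-congʳ (-‿inverseˡ (+.sum elem)) ⟨
      - +.sum elem + +.sum elem + +.sum (replicate N 1#) ≈⟨ +-assoc _ _ _ ⟩
      - +.sum elem + (+.sum elem + +.sum (replicate N 1#)) ≈⟨ +-congˡ (+.∑-distrib-+ elem (λ _ → 1#)) ⟨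
      - +.sum elem + +.sum (λ i → elem i + 1#) ≈⟨ +-congˡ (+.sum-cong-≋ {N} λ i → elem∘index (elem i + 1#)) ⟨
      - +.sum elem + +.sum (λ i → elem (index (elem i + 1#)))
        ≈⟨ +-congˡ (+.sum-permute elem (permutation (λ i → index (elem i + 1#))
          (λ i → index (elem i - 1#)) right left)) ⟨
      - +.sum elem + +.sum elem               ≈⟨ -‿inverseˡ _ ⟩
      0#                                      ∎
      where
      right : ∀ i → index (elem (index (elem i - 1#)) + 1#) ≡ i
      right i = elem-injective _ _ (trans (elem∘index _) (trans (+-congʳ (elem∘index _))
        (trans (+-assoc _ _ _) (trans (+-congˡ (-‿inverseˡ 1#)) (+-identityʳ _)))))
      left : ∀ i → index (elem (index (elem i + 1#)) - 1#) ≡ i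
      left i = elem-injective _ _ (trans (elem∘index _) (trans (+-congʳ (elem∘index _))
        (trans (+-assoc _ _ _) (trans (+-congˡ (-‿inverseʳ 1#)) (+-identityʳ _)))))

  -- Multiplication by a unit u permutes the nonzero elements, so it preserves
  -- their product.
  module UnitPower {n} (elem : Fin (suc n) → Carrier) (index : Carrier → Fin (suc n))
    (elem∘index : ∀ a → elem (index a) ≈ a) (elem-injective : ∀ i j → elem i ≈ elem j → i ≡ j)
    (unit? : ∀ a → a ≈ 0# ⊎ Unit a) {u u⁻¹} (uu⁻¹≈1 : u * u⁻¹ ≈ 1#) where

    private
      module * = Algebra.Properties.CommutativeMonoid.Sum *-commutativeMonoid

    i₀ = index 0#

    choose : Carrier → ∀ i → Dec (i ≡ i₀) → Carrier
    choose a i (yes _) = 1#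
    choose a i (no _)  = a

    -- `nz` replaces 0 by 1, so that a product over all elements is the product of the nonzero ones.
    -- `w` records the factor by which each entry changes under multiplication by u; its product is
    -- u ^ n.
    nz w : Fin (suc n) → Carrier
    nz i = choose (elem i) i (i Fin.≟ i₀)
    w  i = choose u i (i Fin.≟ i₀)

    w-i₀ : w i₀ ≡ 1#
    w-i₀ with i₀ Fin.≟ i₀
    ... | yes _ = ≡.refl
    ... | no ¬p = contradiction ≡.refl ¬p

    w-punch : ∀ j → w (punchIn i₀ j) ≡ u
    w-punch j with punchIn i₀ j Fin.≟ i₀
    ... | yes p = contradiction p (Fin.punchInᵢ≢i i₀ j)
    ... | no _  = ≡.refl

    nz-unit : ∀ i → Unit (nz i)
    nz-unit i with i Fin.≟ i₀
    ... | yes _ = unit-1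
    ... | no i≢i₀ with unit? (elem i)
    ...   | inj₁ e≈0 = contradiction (elem-injective i i₀ (trans e≈0 (sym (elem∘index 0#)))) i≢i₀
    ...   | inj₂ v   = v

    product-unit : ∀ {m} (f : Fin m → Carrier) → (∀ i → Unit (f i)) → Unit (*.sum f)
    product-unit {zero}  f v = unit-1
    product-unit {suc m} f v = unit-* (v Fin.zero) (product-unit (f ∘ Fin.suc) (v ∘ Fin.suc))

    P-unit : Unit (*.sum nz)
    P-unit = product-unit nz nz-unit

    π π⁻¹ : Fin (suc n) → Fin (suc n)
    π i   = index (u * elem i)
    π⁻¹ i = index (u⁻¹ * elem i)

    u⁻¹u : ∀ x → u⁻¹ * (u * x) ≈ x
    u⁻¹u x = trans (sym (*-assoc _ _ _)) (trans (*-congʳ (trans (*-comm _ _) uu⁻¹≈1)) (*-identityˡ x))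

    uu⁻¹ : ∀ x → u * (u⁻¹ * x) ≈ x
    uu⁻¹ x = trans (sym (*-assoc _ _ _)) (trans (*-congʳ uu⁻¹≈1) (*-identityˡ x))

    π-right : ∀ i → π (π⁻¹ i) ≡ i
    π-right i = elem-injective _ _ (trans (elem∘index _) (trans (*-congˡ (elem∘index _)) (uu⁻¹ _)))

    π-left : ∀ i → π⁻¹ (π i) ≡ i
    π-left i = elem-injective _ _ (trans (elem∘index _) (trans (*-congˡ (elem∘index _)) (u⁻¹u _)))

    π-i₀ : ∀ i → i ≡ i₀ → π i ≡ i₀
    π-i₀ i ≡.refl = elem-injective _ _ (trans (elem∘index _) (trans (*-congˡ (elem∘index 0#))
      (trans (zeroʳ u) (sym (elem∘index 0#)))))

    π-i₀⁻¹ : ∀ i → π i ≡ i₀ → i ≡ i₀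
    π-i₀⁻¹ i eq = elem-injective _ _ (begin
      elem i                ≈⟨ u⁻¹u (elem i) ⟨
      u⁻¹ * (u * elem i)    ≈⟨ *-congˡ (elem∘index (u * elem i)) ⟨
      u⁻¹ * elem (π i)      ≈⟨ *-congˡ (trans (reflexive (≡.cong elem eq)) (elem∘index 0#)) ⟩
      u⁻¹ * 0#              ≈⟨ zeroʳ u⁻¹ ⟩
      0#                    ≈⟨ elem∘index 0# ⟨
      elem i₀               ∎)

    nz-π : ∀ i → nz (π i) ≈ nz i * w i
    nz-π i with i Fin.≟ i₀ | π i Fin.≟ i₀
    ... | yes _ | yes _ = sym (*-identityˡ _)
    ... | yes p | no ¬q = contradiction (π-i₀ i p) ¬q
    ... | no ¬p | yes q = contradiction (π-i₀⁻¹ i q) ¬p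
    ... | no _  | no _  = trans (elem∘index _) (*-comm _ _)

    P*w : *.sum nz * *.sum w ≈ *.sum nz * 1#
    P*w = begin
      *.sum nz * *.sum w          ≈⟨ *.∑-distrib-+ nz w ⟨
      *.sum (λ i → nz i * w i)    ≈⟨ *.sum-cong-≋ {suc n} nz-π ⟨
      *.sum (λ i → nz (π i))      ≈⟨ *.sum-permute nz (permutation π π⁻¹ π-right π-left) ⟨
      *.sum nz                    ≈⟨ *-identityʳ _ ⟨
      *.sum nz * 1#               ∎

    unit-power : u ^ suc n ≈ u
    unit-power = begin
      u * u ^ n                                 ≈⟨ *-congˡ (*.sum-replicate n) ⟨
      u * *.sum (replicate n u)                 ≈⟨ *-congˡ (*.sum-cong-≋ {n} λ j → reflexive (w-punch j)) ⟨
      u * *.sum (removeAt w i₀)                 ≈⟨ *-congˡ (trans (*-congʳ (reflexive w-i₀)) (*-identityˡ _)) ⟨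
      u * (w i₀ * *.sum (removeAt w i₀))        ≈⟨ *-congˡ (*.sum-remove {i = i₀} w) ⟨
      u * *.sum w                               ≈⟨ *-congˡ (unit-cancel P-unit P*w) ⟩
      u * 1#                                    ≈⟨ *-identityʳ u ⟩
      u                                         ∎

  -- Stated for any finite ring whose elements are zero or units, since it serves both for the field
  -- of coefficients and, in `field-or-factors`, for the residues modulo a polynomial.
  fermat : ∀ {N} (elem : Fin N → Carrier) (index : Carrier → Fin N) →
    (∀ a → elem (index a) ≈ a) → (∀ i j → elem i ≈ elem j → i ≡ j) →
    (∀ a → a ≈ 0# ⊎ Unit a) → ∀ u → u ^ N ≈ u
  fermat {zero}  _    index _  _   _     _ = contradiction (index 0#) λ ()
  fermat {suc n} elem index ei inj unit? u with unit? u
  ... | inj₁ u≈0 = trans (*-congʳ u≈0) (trans (zeroˡ _) (sym u≈0))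
  ... | inj₂ (u⁻¹ , uu⁻¹≈1) = UnitPower.unit-power elem index ei inj unit? uu⁻¹≈1

-- Cartier operators

module SeriesProperties {c ℓ} (R : CommutativeRing c ℓ) where

  open CommutativeRing R hiding (zero)
  open PowerSeries R public
  open Powers R using (_^_; _·_)
  module S = CommutativeRing seriesRing
  module Sᵖ = Powers seriesRing
  open Algebra.Properties.Ring ring using (-0#≈0#)
  open Relation.Binary.Reasoning.Setoid setoid

  head-⋆ : ∀ f g → coef (f ⋆ g) 0 ≈ coef f 0 * coef g 0
  head-⋆ f g = +-identityʳ _

  head-^ : ∀ f k → coef (f Sᵖ.^ k) 0 ≈ coef f 0 ^ k
  head-^ f zero    = refl
  head-^ f (suc k) = trans (head-⋆ f (f Sᵖ.^ k)) (*-congˡ (head-^ f k))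

  C-cong : ∀ {a b} → a ≈ b → C a ≗ C b
  at (C-cong a≈b) zero    = a≈b
  at (C-cong a≈b) (suc n) = refl

  C-homo-⋆ : ∀ a b → C a ⋆ C b ≗ C (a * b)
  at (C-homo-⋆ a b) zero    = C-⋆ a (C b) 0
  at (C-homo-⋆ a b) (suc n) = trans (C-⋆ a (C b) (suc n)) (zeroʳ a)

  C-homo-^ : ∀ a k → C a Sᵖ.^ k ≗ C (a ^ k)
  C-homo-^ a zero    = ≗-refl
  C-homo-^ a (suc k) = S.trans (S.*-congˡ (C-homo-^ a k)) (C-homo-⋆ a (a ^ k))

  C-homo-× : ∀ k → k Sᵖ.· C 1# ≗ C (k · 1#)
  C-homo-× k = pointwise (go k)
    where
    go : ∀ k n → coef (k Sᵖ.· C 1#) n ≈ coef (C (k · 1#)) n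
    go zero    zero    = refl
    go zero    (suc n) = refl
    go (suc k) zero    = +-congˡ (go k 0)
    go (suc k) (suc n) = trans (+-identityˡ _) (go k (suc n))

  head-tail : ∀ f → f ≗ C (coef f 0) ⊞ x· tail f
  at (head-tail f) zero    = sym (+-identityʳ _)
  at (head-tail f) (suc n) = sym (+-identityˡ _)

  shift : ℕ → Series → Series
  shift zero    f = f
  shift (suc k) f = x· shift k f

  x·-cong : ∀ {f g} → f ≗ g → x· f ≗ x· g
  at (x·-cong p) zero    = refl
  at (x·-cong p) (suc n) = at p n

  shift-cong : ∀ k {f g} → f ≗ g → shift k f ≗ shift k g
  shift-cong zero    p = p
  shift-cong (suc k) p = x·-cong (shift-cong k p)

  coef-shift : ∀ k f n → coef (shift k f) (k ℕ.+ n) ≡ coef f n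
  coef-shift zero    f n = ≡.refl
  coef-shift (suc k) f n = coef-shift k f n

  coef-shift-< : ∀ k f n → n < k → coef (shift k f) n ≈ 0#
  coef-shift-< (suc k) f zero    _         = refl
  coef-shift-< (suc k) f (suc n) (s≤s n<k) = coef-shift-< k f n n<k

  shift-injective : ∀ k {f g} → shift k f ≗ shift k g → f ≗ g
  at (shift-injective k {f} {g} p) n =
    trans (reflexive (≡.sym (coef-shift k f n))) (trans (at p (k ℕ.+ n)) (reflexive (coef-shift k g n)))

  shift-⋆ : ∀ k f g → shift k f ⋆ g ≗ shift k (f ⋆ g)
  shift-⋆ zero    f g = ≗-refl
  shift-⋆ (suc k) f g = S.trans (x·-⋆ (shift k f) g) (x·-cong (shift-⋆ k f g))

  ⋆-shift : ∀ k f g → f ⋆ shift k g ≗ shift k (f ⋆ g)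
  ⋆-shift k f g = S.trans (S.*-comm f _) (S.trans (shift-⋆ k g f) (shift-cong k (S.*-comm g f)))

  shift-shift : ∀ j k f → shift j (shift k f) ≡ shift (j ℕ.+ k) f
  shift-shift zero    k f = ≡.refl
  shift-shift (suc j) k f = ≡.cong x·_ (shift-shift j k f)

  shift-^ : ∀ j f k → shift j f Sᵖ.^ k ≗ shift (k ℕ.* j) (f Sᵖ.^ k)
  shift-^ j f zero    = ≗-refl
  shift-^ j f (suc k) = S.trans (S.*-congˡ (shift-^ j f k))
    (S.trans (shift-⋆ j f _) (S.trans (shift-cong j (⋆-shift (k ℕ.* j) f (f Sᵖ.^ k)))
      (S.reflexive (shift-shift j (k ℕ.* j) _))))

  x·-^ : ∀ f k → (x· f) Sᵖ.^ k ≗ shift k (f Sᵖ.^ k)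
  x·-^ f k = S.trans (shift-^ 1 f k) (S.reflexive (≡.cong (λ i → shift i (f Sᵖ.^ k)) (ℕ.*-identityʳ k)))

  Deg≤ : Series → ℕ → Set ℓ
  Deg≤ f d = ∀ i → d < i → coef f i ≈ 0#

  Deg≤-cong : ∀ {f g d} → f ≗ g → Deg≤ f d → Deg≤ g d
  Deg≤-cong p h i d<i = trans (sym (at p i)) (h i d<i)

  Deg≤-mono : ∀ {f d d′} → d ≤ d′ → Deg≤ f d → Deg≤ f d′
  Deg≤-mono d≤d′ h i d′<i = h i (ℕ.≤-<-trans d≤d′ d′<i)

  Deg≤-0⋆ : ∀ f g → Deg≤ f 0 → ∀ n → coef (f ⋆ g) n ≈ coef f 0 * coef g n
  Deg≤-0⋆ f g h zero    = +-identityʳ _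
  Deg≤-0⋆ f g h (suc n) = trans (+-congˡ (⋆-zeroˡ-at (tail f) g n λ i → h (suc i) (s≤s z≤n))) (+-identityʳ _)

  Deg≤-⋆ : ∀ {a b} f g → Deg≤ f a → Deg≤ g b → Deg≤ (f ⋆ g) (a ℕ.+ b)
  Deg≤-⋆ {zero}  f g hf hg i b<i = trans (Deg≤-0⋆ f g hf i) (trans (*-congˡ (hg i b<i)) (zeroʳ _))
  Deg≤-⋆ {suc a} f g hf hg (suc i) (s≤s lt) = trans
    (+-cong (trans (*-congˡ (hg (suc i) (ℕ.≤-<-trans (ℕ.m≤n+m _ a) (ℕ.<-trans lt ℕ.≤-refl)))) (zeroʳ _))
      (Deg≤-⋆ {a} (tail f) g (λ j a<j → hf (suc j) (s≤s a<j)) hg i lt))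
    (+-identityˡ 0#)

  top-⋆ : ∀ {a b} f g → Deg≤ f a → Deg≤ g b → coef (f ⋆ g) (a ℕ.+ b) ≈ coef f a * coef g b
  top-⋆ {zero}  f g hf hg = Deg≤-0⋆ f g hf _
  top-⋆ {suc a} {b} f g hf hg = trans
    (+-cong (trans (*-congˡ (hg (suc (a ℕ.+ b)) (s≤s (ℕ.m≤n+m b a)))) (zeroʳ _))
      (top-⋆ {a} (tail f) g (λ j a<j → hf (suc j) (s≤s a<j)) hg))
    (+-identityˡ _)

  Deg≤-C : ∀ a → Deg≤ (C a) 0
  Deg≤-C a (suc i) _ = refl

  Deg≤-^ : ∀ {a} f k → Deg≤ f a → Deg≤ (f Sᵖ.^ k) (k ℕ.* a)
  Deg≤-^ f zero    h = Deg≤-C 1#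
  Deg≤-^ {a} f (suc k) h = Deg≤-⋆ f (f Sᵖ.^ k) h (Deg≤-^ f k h)

  top-^ : ∀ {a} f k → Deg≤ f a → coef (f Sᵖ.^ k) (k ℕ.* a) ≈ coef f a ^ k
  top-^ f zero    h = refl
  top-^ {a} f (suc k) h = trans (top-⋆ f (f Sᵖ.^ k) h (Deg≤-^ f k h)) (*-congˡ (top-^ f k h))

  Deg≤-⊞ : ∀ {f g d} → Deg≤ f d → Deg≤ g d → Deg≤ (f ⊞ g) d
  Deg≤-⊞ hf hg i d<i = trans (+-cong (hf i d<i) (hg i d<i)) (+-identityˡ 0#)

  Deg≤-⊟ : ∀ {f d} → Deg≤ f d → Deg≤ (⊟ f) d
  Deg≤-⊟ hf i d<i = trans (-‿cong (hf i d<i)) -0#≈0#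

  Deg≤-shift : ∀ k {f d} → Deg≤ f d → Deg≤ (shift k f) (k ℕ.+ d)
  Deg≤-shift zero    h = h
  Deg≤-shift (suc k) h (suc i) (s≤s lt) = Deg≤-shift k h i lt

module _ {c ℓ} (R : CommutativeRing c ℓ) where

  open CommutativeRing R hiding (zero)
  open SeriesProperties R
  open Powers R using (_^_)
  open Relation.Binary.Reasoning.Setoid setoid

  -- θ is q⁻¹-linear, and so is the map on series built from it.
  module Cartier (q : ℕ)
    (θ : Carrier → Carrier) (θ-cong : ∀ {a b} → a ≈ b → θ a ≈ θ b)
    (θ-+ : ∀ a b → θ (a + b) ≈ θ a + θ b)
    (θ-frobenius : ∀ a b → θ (a ^ q * b) ≈ a * θ b)
    (additive : Sᵖ.Additive q)
    where

    Λ : ℕ → Series → Series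
    coef (Λ r f) n = θ (coef f (q ℕ.* n ℕ.+ r))

    Λ-cong : ∀ r {f g} → f ≗ g → Λ r f ≗ Λ r g
    at (Λ-cong r p) n = θ-cong (at p _)

    Λ-⊞ : ∀ r f g → Λ r (f ⊞ g) ≗ Λ r f ⊞ Λ r g
    at (Λ-⊞ r f g) n = θ-+ _ _

    -- Writing f = c + x t, additivity of the q-th power gives f^q = c^q + x^q t^q.
    ^q-⋆ : ∀ f g i → coef (f Sᵖ.^ q ⋆ g) i ≈ coef f 0 ^ q * coef g i + coef (shift q (tail f Sᵖ.^ q ⋆ g)) i
    ^q-⋆ f g i = trans (at (S.*-congʳ {g} fq) i) (trans
      (at (S.distribʳ g (C (coef f 0 ^ q)) (shift q (tail f Sᵖ.^ q))) i)
      (+-cong (C-⋆ _ g i) (at (shift-⋆ q (tail f Sᵖ.^ q) g) i)))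
      where
      fq : f Sᵖ.^ q ≗ C (coef f 0 ^ q) ⊞ shift q (tail f Sᵖ.^ q)
      fq = S.trans (Sᵖ.^-congˡ q (head-tail f)) (S.trans (additive _ _)
        (S.+-cong (C-homo-^ (coef f 0) q) (x·-^ (tail f) q)))

    -- Induction on n through `^q-⋆`: `θ-frobenius` extracts the constant term of f, and the shift
    -- by q in the other part lowers n by one. At n = 0 that part is absent because r < q.
    Λ-frobenius-at : ∀ r → r < q → ∀ n f g → coef (Λ r (f Sᵖ.^ q ⋆ g)) n ≈ coef (f ⋆ Λ r g) n
    Λ-frobenius-at r r<q zero f g = begin
      θ (coef (f Sᵖ.^ q ⋆ g) i)                      ≈⟨ θ-cong (^q-⋆ f g i) ⟩
      θ (coef f 0 ^ q * coef g i + coef (shift q (tail f Sᵖ.^ q ⋆ g)) i)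
        ≈⟨ θ-cong (trans (+-congˡ (coef-shift-< q _ i (≡.subst (_< q) (≡.sym (≡.cong (ℕ._+ r) (ℕ.*-zeroʳ q))) r<q)))
          (+-identityʳ _)) ⟩
      θ (coef f 0 ^ q * coef g i)                    ≈⟨ θ-frobenius _ _ ⟩
      coef f 0 * θ (coef g i)                        ≈⟨ +-identityʳ _ ⟨
      coef f 0 * θ (coef g i) + 0#                   ∎
      where i = q ℕ.* 0 ℕ.+ r
    Λ-frobenius-at r r<q (suc n) f g = begin
      θ (coef (f Sᵖ.^ q ⋆ g) i)                      ≈⟨ θ-cong (^q-⋆ f g i) ⟩
      θ (coef f 0 ^ q * coef g i + coef (shift q h) i)   ≈⟨ θ-+ _ _ ⟩
      θ (coef f 0 ^ q * coef g i) + θ (coef (shift q h) i)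
        ≈⟨ +-cong (θ-frobenius _ _) (θ-cong (reflexive (≡.trans (≡.cong (coef (shift q h)) i≡) (coef-shift q h _)))) ⟩
      coef f 0 * θ (coef g i) + coef (Λ r h) n       ≈⟨ +-congˡ (Λ-frobenius-at r r<q n (tail f) g) ⟩
      coef f 0 * θ (coef g i) + coef (tail f ⋆ Λ r g) n ∎
      where
      i = q ℕ.* suc n ℕ.+ r
      h = tail f Sᵖ.^ q ⋆ g
      i≡ : i ≡ q ℕ.+ (q ℕ.* n ℕ.+ r)
      i≡ = ≡.trans (≡.cong (ℕ._+ r) (ℕ.*-suc q n)) (ℕ.+-assoc q (q ℕ.* n) r)

    Λ-frobenius : ∀ r → r < q → ∀ f g → Λ r (f Sᵖ.^ q ⋆ g) ≗ f ⋆ Λ r g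
    at (Λ-frobenius r r<q f g) n = Λ-frobenius-at r r<q n f g

-- Polynomials and factorisation

module Quotient {c ℓ} (A : CommutativeRing c ℓ) (m : CommutativeRing.Carrier A) where

  open CommutativeRing A
  open Algebra.Properties.Ring ring using (-‿distribʳ-*; -‿+-comm)
  open Algebra.Solver.Ring.NaturalCoefficients.Default commutativeSemiring using (solve; _:+_; _:*_; _:=_)
  open Relation.Binary.Reasoning.Setoid setoid
  open Powers A using (_^_)

  infix 4 _≈ₘ_
  -- The quotient ring keeps carrier and operations and coarsens only the equality. The stored
  -- quotient becomes a cofactor when a congruence is read back as a divisibility.
  record _≈ₘ_ (a b : Carrier) : Set (c Level.⊔ ℓ) where
    constructor multiple
    field
      quotient : Carrier
      equation : a ≈ b + m * quotient
  open _≈ₘ_ public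

  ≈⇒≈ₘ : ∀ {a b} → a ≈ b → a ≈ₘ b
  ≈⇒≈ₘ a≈b = multiple 0# (trans a≈b (trans (sym (+-identityʳ _)) (+-congˡ (sym (zeroʳ m)))))

  private
    ≈ₘ-sym : ∀ {a b} → a ≈ₘ b → b ≈ₘ a
    ≈ₘ-sym {a} {b} (multiple k e) = multiple (- k) (begin
      b                              ≈⟨ +-identityʳ b ⟨
      b + 0#                         ≈⟨ +-congˡ (-‿inverseʳ (m * k)) ⟨
      b + (m * k - m * k)            ≈⟨ +-assoc _ _ _ ⟨
      b + m * k - m * k              ≈⟨ +-cong (sym e) (-‿distribʳ-* m k) ⟩
      a + m * - k                    ∎)

    ≈ₘ-trans : ∀ {a b d} → a ≈ₘ b → b ≈ₘ d → a ≈ₘ d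
    ≈ₘ-trans {a} {b} {d} (multiple k e) (multiple l e′) = multiple (l + k) (trans e (trans (+-congʳ e′)
      (trans (+-assoc _ _ _) (+-congˡ (sym (distribˡ m l k))))))

    +-congₘ : ∀ {a a′ b b′} → a ≈ₘ a′ → b ≈ₘ b′ → a + b ≈ₘ a′ + b′
    +-congₘ {a} {a′} {b} {b′} (multiple k e) (multiple l e′) = multiple (k + l) (trans (+-cong e e′)
      (solve 5 (λ a b m k l → (a :+ m :* k) :+ (b :+ m :* l) := (a :+ b) :+ m :* (k :+ l)) refl a′ b′ m k l))

    *-congₘ : ∀ {a a′ b b′} → a ≈ₘ a′ → b ≈ₘ b′ → a * b ≈ₘ a′ * b′
    *-congₘ {a} {a′} {b} {b′} (multiple k e) (multiple l e′) = multiple (k * b′ + a′ * l + k * (m * l))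
      (trans (*-cong e e′)
      (solve 5 (λ a b m k l → (a :+ m :* k) :* (b :+ m :* l) := (a :* b) :+ m :*
        (k :* b :+ a :* l :+ k :* (m :* l))) refl a′ b′ m k l))

    -‿congₘ : ∀ {a b} → a ≈ₘ b → - a ≈ₘ - b
    -‿congₘ (multiple k e) = multiple (- k) (trans (-‿cong e)
      (trans (sym (-‿+-comm _ _)) (+-congˡ (-‿distribʳ-* m k))))

  quotientRing : CommutativeRing c (c Level.⊔ ℓ)
  quotientRing = record
    { Carrier = Carrier
    ; _≈_ = _≈ₘ_
    ; _+_ = _+_
    ; _*_ = _*_
    ; -_ = -_
    ; 0# = 0#
    ; 1# = 1#
    ; isCommutativeRing = record
      { isRing = record
        { +-isAbelianGroup = record
          { isGroup = record
            { isMonoid = record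
              { isSemigroup = record
                { isMagma = record
                  { isEquivalence = record { refl = ≈⇒≈ₘ refl ; sym = ≈ₘ-sym ; trans = ≈ₘ-trans }
                  ; ∙-cong = +-congₘ
                  }
                ; assoc = λ a b d → ≈⇒≈ₘ (+-assoc a b d)
                }
              ; identity = (λ a → ≈⇒≈ₘ (+-identityˡ a)) , (λ a → ≈⇒≈ₘ (+-identityʳ a))
              }
            ; inverse = (λ a → ≈⇒≈ₘ (-‿inverseˡ a)) , (λ a → ≈⇒≈ₘ (-‿inverseʳ a))
            ; ⁻¹-cong = -‿congₘ
            }
          ; comm = λ a b → ≈⇒≈ₘ (+-comm a b)
          }
        ; *-cong = *-congₘ
        ; *-assoc = λ a b d → ≈⇒≈ₘ (*-assoc a b d)
        ; *-identity = (λ a → ≈⇒≈ₘ (*-identityˡ a)) , (λ a → ≈⇒≈ₘ (*-identityʳ a))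
        ; distrib = (λ a b d → ≈⇒≈ₘ (distribˡ a b d)) , (λ a b d → ≈⇒≈ₘ (distribʳ a b d))
        }
      ; *-comm = λ a b → ≈⇒≈ₘ (*-comm a b)
      }
    }

  ^-quotient : ∀ a n → Powers._^_ quotientRing a n ≡ a ^ n
  ^-quotient a zero    = ≡.refl
  ^-quotient a (suc n) = ≡.cong (a *_) (^-quotient a n)

module Polynomials {c ℓ} (R : CommutativeRing c ℓ) where

  open CommutativeRing R hiding (zero)
  open SeriesProperties R public
  open Powers R using (Unit)

  Deg< : Series → ℕ → Set ℓ
  Deg< f d = ∀ i → d ≤ i → coef f i ≈ 0#

  Deg<-cong : ∀ {f g d} → f ≗ g → Deg< f d → Deg< g d
  Deg<-cong p h i d≤i = trans (sym (at p i)) (h i d≤i)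

  Deg<-mono : ∀ {f d d′} → d ≤ d′ → Deg< f d → Deg< f d′
  Deg<-mono d≤d′ h i d′≤i = h i (ℕ.≤-trans d≤d′ d′≤i)

  Deg<-pred : ∀ {f d} → Deg< f (suc d) → coef f d ≈ 0# → Deg< f d
  Deg<-pred h fd≈0 i d≤i with ℕ.m≤n⇒m<n∨m≡n d≤i
  ... | inj₁ d<i    = h i d<i
  ... | inj₂ ≡.refl = fd≈0

  Deg<-0 : ∀ {f} → Deg< f 0 → f ≗ 𝟘
  at (Deg<-0 h) i = h i z≤n

  -- `degree` is any upper bound, and equal polynomials may carry different ones; it starts the
  -- recursions of `division` and `cofactor-deg`. True degrees are recorded by `Exact`.
  record Poly : Set (c Level.⊔ ℓ) where
    no-eta-equality
    field
      ser    : Series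
      degree : ℕ
      Deg≤ser : Deg≤ ser degree
  open Poly public

  poly : ∀ {f d} → Deg≤ f d → Poly
  poly {f} {d} h = record { ser = f ; degree = d ; Deg≤ser = h }

  infix 4 _≈ᵖ_
  record _≈ᵖ_ (f g : Poly) : Set ℓ where
    constructor ≗⇒≈ᵖ
    field
      ≈ᵖ⇒≗ : ser f ≗ ser g
  open _≈ᵖ_ public

  infixl 6 _+ᵖ_
  infixl 7 _*ᵖ_
  _+ᵖ_ _*ᵖ_ : Poly → Poly → Poly
  ser (f +ᵖ g) = ser f ⊞ ser g
  degree (f +ᵖ g) = degree f ℕ.⊔ degree g
  Deg≤ser (f +ᵖ g) = Deg≤-⊞ {ser f} {ser g}
    (Deg≤-mono {ser f} (ℕ.m≤m⊔n (degree f) (degree g)) (Deg≤ser f))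
      (Deg≤-mono {ser g} (ℕ.m≤n⊔m (degree f) (degree g)) (Deg≤ser g))
  ser (f *ᵖ g) = ser f ⋆ ser g
  degree (f *ᵖ g) = degree f ℕ.+ degree g
  Deg≤ser (f *ᵖ g) = Deg≤-⋆ (ser f) (ser g) (Deg≤ser f) (Deg≤ser g)

  -ᵖ_ : Poly → Poly
  ser (-ᵖ f) = ⊟ ser f
  degree (-ᵖ f) = degree f
  Deg≤ser (-ᵖ f) = Deg≤-⊟ {ser f} (Deg≤ser f)

  Cᵖ : Carrier → Poly
  ser (Cᵖ a) = C a
  degree (Cᵖ a) = 0
  Deg≤ser (Cᵖ a) = Deg≤-C a

  0ᵖ : Poly
  ser 0ᵖ = 𝟘
  degree 0ᵖ = 0
  Deg≤ser 0ᵖ i _ = refl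

  polyRing : CommutativeRing (c Level.⊔ ℓ) ℓ
  polyRing = record
    { Carrier = Poly
    ; _≈_ = _≈ᵖ_
    ; _+_ = _+ᵖ_
    ; _*_ = _*ᵖ_
    ; -_ = -ᵖ_
    ; 0# = 0ᵖ
    ; 1# = Cᵖ 1#
    ; isCommutativeRing = record
      { isRing = record
        { +-isAbelianGroup = record
          { isGroup = record
            { isMonoid = record
              { isSemigroup = record
                { isMagma = record
                  { isEquivalence = record
                    { refl = ≗⇒≈ᵖ S.refl
                    ; sym = λ p → ≗⇒≈ᵖ (S.sym (≈ᵖ⇒≗ p))
                    ; trans = λ p q → ≗⇒≈ᵖ (S.trans (≈ᵖ⇒≗ p) (≈ᵖ⇒≗ q))
                    }
                  ; ∙-cong = λ p q → ≗⇒≈ᵖ (S.+-cong (≈ᵖ⇒≗ p) (≈ᵖ⇒≗ q))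
                  }
                ; assoc = λ f g h → ≗⇒≈ᵖ (S.+-assoc _ _ _)
                }
              ; identity = (λ f → ≗⇒≈ᵖ (S.+-identityˡ _)) , (λ f → ≗⇒≈ᵖ (S.+-identityʳ _))
              }
            ; inverse = (λ f → ≗⇒≈ᵖ (S.-‿inverseˡ _)) , (λ f → ≗⇒≈ᵖ (S.-‿inverseʳ _))
            ; ⁻¹-cong = λ p → ≗⇒≈ᵖ (S.-‿cong (≈ᵖ⇒≗ p))
            }
          ; comm = λ f g → ≗⇒≈ᵖ (S.+-comm _ _)
          }
        ; *-cong = λ p q → ≗⇒≈ᵖ (S.*-cong (≈ᵖ⇒≗ p) (≈ᵖ⇒≗ q))
        ; *-assoc = λ f g h → ≗⇒≈ᵖ (S.*-assoc _ _ _)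
        ; *-identity = (λ f → ≗⇒≈ᵖ (S.*-identityˡ _)) , (λ f → ≗⇒≈ᵖ (S.*-identityʳ _))
        ; distrib = (λ f g h → ≗⇒≈ᵖ (S.distribˡ _ _ _)) , (λ f g h → ≗⇒≈ᵖ (S.distribʳ _ _ _))
        }
      ; *-comm = λ f g → ≗⇒≈ᵖ (S.*-comm _ _)
      }
    }

  module P = CommutativeRing polyRing
  module Pᵖ = Powers polyRing

  ser-^ : ∀ f n → ser (f Pᵖ.^ n) ≡ ser f Sᵖ.^ n
  ser-^ f zero    = ≡.refl
  ser-^ f (suc n) = ≡.cong (ser f ⋆_) (ser-^ f n)

  record Exact (f : Series) (d : ℕ) : Set (c Level.⊔ ℓ) where
    field
      deg≤ : Deg≤ f d
      lead : Unit (coef f d)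
  open Exact public

  -- The bound on g is lowered one step at a time. For b ≥ n the coefficient of the product in
  -- degree d + b is the leading coefficient of f, a unit, times that of g in degree b; it vanishes,
  -- so the latter does.
  cofactor-deg : ∀ {f d} → Exact f d → ∀ {n} b g → Deg< g b → Deg< (f ⋆ g) (d ℕ.+ n) → Deg< g n
  cofactor-deg ex zero g hg hfg = Deg<-mono {g} z≤n hg
  cofactor-deg {f} {d} ex {n} (suc b) g hg hfg with suc b ℕ.≤? n
  ... | yes b<n = Deg<-mono {g} b<n hg
  ... | no  b≮n = cofactor-deg ex b g (Deg<-pred {g} hg g_b≈0) hfg
    where
    open Powers R using (unit-cancel)
    g_b≈0 : coef g b ≈ 0#
    g_b≈0 = unit-cancel (lead ex) (trans (sym (top-⋆ f g (deg≤ ex) hg))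
      (trans (hfg (d ℕ.+ b) (ℕ.+-monoʳ-≤ d (ℕ.s≤s⁻¹ (ℕ.≰⇒> b≮n)))) (sym (zeroʳ _))))

  record DivMod (f : Series) (d : ℕ) (g : Series) : Set (c Level.⊔ ℓ) where
    field
      quotient remainder : Poly
      Deg<remainder : Deg< (ser remainder) d
      equation : g ≗ ser remainder ⊞ f ⋆ ser quotient

  division : ∀ {f d} → Exact f d → ∀ b g → Deg< g b → DivMod f d g
  division {f} {d} ex zero g hg = record
    { quotient = 0ᵖ
    ; remainder = 0ᵖ
    ; Deg<remainder = λ i _ → refl
    ; equation = S.trans (Deg<-0 hg) (S.sym (S.trans (S.+-identityˡ _) (S.zeroʳ f)))
    }
  division {f} {d} ex (suc b) g hg with suc b ℕ.≤? d
  ... | yes b<d = record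
    { quotient = 0ᵖ
    ; remainder = poly {g} {b} hg
    ; Deg<remainder = Deg<-mono {g} b<d hg
    ; equation = S.sym (S.trans (S.+-congˡ (S.zeroʳ f)) (S.+-identityʳ g))
    }
  ... | no b≮d = record
    { quotient = quotient rec +ᵖ poly {t} {b ∸ d ℕ.+ 0} (Deg≤-shift (b ∸ d) {C a} (Deg≤-C a))
    ; remainder = remainder rec
    ; Deg<remainder = Deg<remainder rec
    ; equation = begin
        g                                                            ≈⟨ S.+-identityʳ g ⟨
        g ⊞ 𝟘                                                        ≈⟨ S.+-congˡ (S.-‿inverseˡ (f ⋆ t)) ⟨
        g ⊞ (⊟ (f ⋆ t) ⊞ f ⋆ t)                                      ≈⟨ S.+-assoc _ _ _ ⟨
        g′ ⊞ f ⋆ t                                                   ≈⟨ S.+-congʳ (equation rec) ⟩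
        ser (remainder rec) ⊞ f ⋆ ser (quotient rec) ⊞ f ⋆ t         ≈⟨ S.+-assoc _ _ _ ⟩
        ser (remainder rec) ⊞ (f ⋆ ser (quotient rec) ⊞ f ⋆ t)       ≈⟨ S.+-congˡ (S.distribˡ f _ _) ⟨
        ser (remainder rec) ⊞ f ⋆ (ser (quotient rec) ⊞ t)           ∎
    }
    where
    open DivMod
    open Relation.Binary.Reasoning.Setoid S.setoid
    d≤b : d ≤ b
    d≤b = ℕ.s≤s⁻¹ (ℕ.≰⇒> b≮d)
    -- The monomial t = a x^(b - d) is chosen so that f t and g agree in degree b.
    a = proj₁ (lead ex) * coef g b
    t = shift (b ∸ d) (C a)
    g′ = g ⊞ ⊟ (f ⋆ t)

    ft-b : coef (f ⋆ t) b ≈ coef g b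
    ft-b = trans (reflexive (≡.cong (coef (f ⋆ t)) (≡.sym (ℕ.m+[n∸m]≡n d≤b))))
      (trans (top-⋆ f t (deg≤ ex) (≡.subst (Deg≤ t) (ℕ.+-identityʳ _) (Deg≤-shift (b ∸ d) {C a} (Deg≤-C a))))
      (trans (*-congˡ (reflexive (≡.trans (≡.cong (coef t) (≡.sym (ℕ.+-identityʳ _))) (coef-shift (b ∸ d) (C a) 0))))
      (trans (sym (*-assoc _ _ _)) (trans (*-congʳ (proj₂ (lead ex))) (*-identityˡ _)))))

    Deg≤ft : Deg≤ (f ⋆ t) b
    Deg≤ft = ≡.subst (Deg≤ (f ⋆ t)) (ℕ.m+[n∸m]≡n d≤b) (Deg≤-⋆ f t (deg≤ ex)
      (≡.subst (Deg≤ t) (ℕ.+-identityʳ _) (Deg≤-shift (b ∸ d) {C a} (Deg≤-C a))))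

    rec : DivMod f d g′
    rec = division ex b g′ (Deg<-pred {g′} (Deg≤-⊞ {g} {⊟ (f ⋆ t)} hg (Deg≤-⊟ {f ⋆ t} Deg≤ft))
      (trans (+-congˡ (-‿cong ft-b)) (-‿inverseʳ _)))

-- Enumeration of polynomials of bounded degree

funToFin-cong : ∀ {m n} {f g : Fin m → Fin n} → (∀ i → f i ≡ g i) → funToFin f ≡ funToFin g
funToFin-cong {zero}  f≗g = ≡.refl
funToFin-cong {suc m} f≗g = ≡.cong₂ Fin.combine (f≗g Fin.zero) (funToFin-cong (f≗g ∘ Fin.suc))

-- This finite search takes the place of an irreducibility test: it is applied to all residues
-- modulo f, one of which may exhibit a factorisation.
decide-all : ∀ {n a b} {A : Fin n → Set a} {B : Set b} → (∀ i → A i ⊎ B) → (∀ i → A i) ⊎ B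
decide-all {zero}  f = inj₁ λ ()
decide-all {suc n} f with f Fin.zero | decide-all (f ∘ Fin.suc)
... | inj₂ b | _      = inj₂ b
... | inj₁ _ | inj₂ b = inj₂ b
... | inj₁ a | inj₁ g = inj₁ λ { Fin.zero → a ; (Fin.suc i) → g i }

-- Kept general in the coefficient ring so that it can be iterated for two variables. There the
-- coefficients are series, of which only those of bounded degree are numbered; hence `box-boxIndex`
-- asks `elem ∘ index` to fix just the coefficients of the given series.
module Box {c ℓ} (R : CommutativeRing c ℓ) {N}
  (elem : Fin N → CommutativeRing.Carrier R) (index : CommutativeRing.Carrier R → Fin N) where

  open CommutativeRing R hiding (zero)
  open Polynomials R

  box : ∀ n → Fin (N ℕ.^ n) → Series
  coef (box n i) j with j ℕ.<? n
  ... | yes j<n = elem (finToFun i (fromℕ< j<n))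
  ... | no _    = 0#

  boxIndex : ∀ n → Series → Fin (N ℕ.^ n)
  boxIndex n f = funToFin {n} λ j → index (coef f (toℕ j))

  Deg<-box : ∀ n i → Deg< (box n i) n
  Deg<-box n i j n≤j with j ℕ.<? n
  ... | yes j<n = contradiction j<n (ℕ.≤⇒≯ n≤j)
  ... | no _    = refl

  box-boxIndex : ∀ n f → Deg< f n → (∀ j → j < n → elem (index (coef f j)) ≈ coef f j) → box n (boxIndex n f) ≗ f
  at (box-boxIndex n f h e) j with j ℕ.<? n
  ... | no j≮n = sym (h j (ℕ.≮⇒≥ j≮n))
  ... | yes j<n = trans (reflexive (≡.cong elem (≡.trans
    (Fin.finToFun-funToFin {n} (λ j → index (coef f (toℕ j))) (fromℕ< j<n))
      (≡.cong (index ∘ coef f) (Fin.toℕ-fromℕ< j<n)))))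
    (e j j<n)

  box-injective : (∀ i j → elem i ≈ elem j → i ≡ j) → ∀ n i j → box n i ≗ box n j → i ≡ j
  box-injective inj n i j p = ≡.trans (≡.sym (Fin.funToFin-finToFin {n} i))
    (≡.trans (funToFin-cong λ k → inj _ _ (same k)) (Fin.funToFin-finToFin {n} j))
    where
    box-toℕ : ∀ i (k : Fin n) → coef (box n i) (toℕ k) ≡ elem (finToFun i k)
    box-toℕ i k with toℕ k ℕ.<? n
    ... | yes k<n = ≡.cong (elem ∘ finToFun i) (Fin.fromℕ<-toℕ k k<n)
    ... | no k≮n  = contradiction (Fin.toℕ<n k) k≮n
    same : ∀ k → elem (finToFun i k) ≈ elem (finToFun j k)
    same k = trans (reflexive (≡.sym (box-toℕ i k))) (trans (at p (toℕ k)) (reflexive (box-toℕ j k)))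

-- Degrees of the factors of a polynomial over a finite field

module Factorisation {c ℓ} (R : CommutativeRing c ℓ) {q}
  (elem : Fin q → CommutativeRing.Carrier R) (index : CommutativeRing.Carrier R → Fin q)
  (elem∘index : ∀ a → CommutativeRing._≈_ R (elem (index a)) a)
  (elem-injective : ∀ i j → CommutativeRing._≈_ R (elem i) (elem j) → i ≡ j)
  (unit? : ∀ a → CommutativeRing._≈_ R a (CommutativeRing.0# R) ⊎ Powers.Unit R a) where

  open CommutativeRing R hiding (zero)
  open Polynomials R
  open Box R elem index
  open Powers R using (Unit)

  record Factors (f : Poly) (m : ℕ) : Set (c Level.⊔ ℓ) where
    field
      g h : Poly
      i j : ℕ
      exact-g : Exact (ser g) (suc i)
      exact-h : Exact (ser h) (suc j)
      degrees : suc i ℕ.+ suc j ≡ m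
      product : f ≈ᵖ g *ᵖ h

  X : Poly
  X = poly {shift 1 (C 1#)} (Deg≤-shift 1 {C 1#} (Deg≤-C 1#))

  x^qⁱ-x : ℕ → Poly
  x^qⁱ-x i = X Pᵖ.^ (q ℕ.^ i) +ᵖ (-ᵖ X)

  module Residues (f : Poly) {m} (ex : Exact (ser f) m) where

    open Quotient polyRing f
    module Q = CommutativeRing quotientRing
    module Qᵖ = Powers quotientRing

    residue : Fin (q ℕ.^ m) → Poly
    residue i = poly {box m i} {m} λ j m<j → Deg<-box m i j (ℕ.<⇒≤ m<j)

    divide-by-f : ∀ g → DivMod (ser f) m (ser g)
    divide-by-f g = division ex (suc (degree g)) (ser g) (Deg≤ser g)

    residueIndex : Poly → Fin (q ℕ.^ m)
    residueIndex g = boxIndex m (ser (DivMod.remainder (divide-by-f g)))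

    residue∘residueIndex : ∀ g → residue (residueIndex g) ≈ₘ g
    residue∘residueIndex g = Q.trans
      (≈⇒≈ₘ {b = DivMod.remainder (divide-by-f g)}
        (≗⇒≈ᵖ (box-boxIndex m _ (DivMod.Deg<remainder (divide-by-f g)) λ _ _ → elem∘index _)))
      (Q.sym {g} {DivMod.remainder (divide-by-f g)}
        (multiple (DivMod.quotient (divide-by-f g)) (≗⇒≈ᵖ (DivMod.equation (divide-by-f g)))))

    -- The difference of the two residues is a multiple f k of degree below m, which forces k = 0 by
    -- `cofactor-deg`.
    residue-injective : ∀ i j → residue i ≈ₘ residue j → i ≡ j
    residue-injective i j (multiple k e) = box-injective elem-injective m i j (begin
      box m i                    ≈⟨ ≈ᵖ⇒≗ e ⟩
      box m j ⊞ ser f ⋆ ser k    ≈⟨ S.+-congˡ (S.trans (S.*-congˡ (Deg<-0 k<0)) (S.zeroʳ (ser f))) ⟩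
      box m j ⊞ 𝟘                ≈⟨ S.+-identityʳ _ ⟩
      box m j                    ∎)
      where
      open Relation.Binary.Reasoning.Setoid S.setoid
      fk : ser f ⋆ ser k ≗ box m i ⊞ ⊟ box m j
      fk = begin
        ser f ⋆ ser k                              ≈⟨ S.+-identityˡ _ ⟨
        𝟘 ⊞ ser f ⋆ ser k                          ≈⟨ S.+-congʳ (S.-‿inverseˡ (box m j)) ⟨
        ⊟ box m j ⊞ box m j ⊞ ser f ⋆ ser k        ≈⟨ S.+-assoc _ _ _ ⟩
        ⊟ box m j ⊞ (box m j ⊞ ser f ⋆ ser k)      ≈⟨ S.+-congˡ (≈ᵖ⇒≗ e) ⟨
        ⊟ box m j ⊞ box m i                        ≈⟨ S.+-comm _ _ ⟩
        box m i ⊞ ⊟ box m j                        ∎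
      open Algebra.Properties.Ring ring using (-0#≈0#)
      k<0 : Deg< (ser k) 0
      k<0 = cofactor-deg ex (suc (degree k)) (ser k) (Deg≤ser k)
        (≡.subst (Deg< (ser f ⋆ ser k)) (≡.sym (ℕ.+-identityʳ m)) λ l m≤l →
          trans (at fk l) (trans (+-cong (Deg<-box m i l m≤l) (trans (-‿cong (Deg<-box m j l m≤l)) -0#≈0#))
            (+-identityˡ 0#)))

    unit-factor : ∀ {a b} → Unit (a * b) → Unit b
    unit-factor {a} {b} (y , e) = a * y , trans (sym (*-assoc _ _ _)) (trans (*-congʳ (*-comm b a)) e)

    -- Euclid's algorithm for f and g.
    classify : ∀ j g → Deg< (ser g) j → j ≤ m → (ser g ≗ 𝟘) ⊎ Qᵖ.Unit g ⊎ Factors f m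
    classify zero    g hg _ = inj₁ (Deg<-0 hg)
    classify (suc j) g hg j<m with unit? (coef (ser g) j)
    ... | inj₁ gⱼ≈0 = classify j g (Deg<-pred {ser g} hg gⱼ≈0) (ℕ.<⇒≤ j<m)
    ... | inj₂ u with division (record { deg≤ = hg ; lead = u }) (suc (degree f)) (ser f) (Deg≤ser f)
    ...   | record { quotient = k ; remainder = r ; Deg<remainder = hr ; equation = f≗ } with classify j r hr
      (ℕ.<⇒≤ j<m)
    ...     | inj₂ (inj₂ factors) = inj₂ (inj₂ factors)
    -- From f = r + g k follows g (- k) ≡ r modulo f, so an inverse of r yields one of g.
    ...     | inj₂ (inj₁ (r⁻¹ , e)) = inj₂ (inj₁ (-ᵖ k *ᵖ r⁻¹ , Q.trans (Q.sym (Q.*-assoc g (-ᵖ k) r⁻¹))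
      (Q.trans (Q.*-congʳ {r⁻¹} gk≈r) e)))
      where
      open Algebra.Properties.Ring P.ring using (-‿distribʳ-*)
      gk≈r : g *ᵖ (-ᵖ k) ≈ₘ r
      gk≈r = Q.trans (Q.trans (≈⇒≈ₘ (P.sym (-‿distribʳ-* g k))) (Q.sym (Q.+-identityʳ _)))
        (Q.trans (Q.+-congˡ { -ᵖ (g *ᵖ k)} (Q.sym {r +ᵖ g *ᵖ k} r+gk≈0))
        (Q.trans (Q.+-comm (-ᵖ (g *ᵖ k)) (r +ᵖ g *ᵖ k))
          (Q.trans (Q.+-assoc r (g *ᵖ k) (-ᵖ (g *ᵖ k)))
            (Q.trans (Q.+-congˡ {r} (Q.-‿inverseʳ (g *ᵖ k))) (Q.+-identityʳ r)))))
        where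
        r+gk≈0 : r +ᵖ g *ᵖ k ≈ₘ 0ᵖ
        r+gk≈0 = multiple (Cᵖ 1#) (P.trans (P.sym (≗⇒≈ᵖ f≗)) (P.sym (P.trans (P.+-identityˡ _) (P.*-identityʳ f))))
    -- Now g divides f. Its degree is j < m: a constant g is a unit, and any other g is a proper
    -- factor.
    ...     | inj₁ r≗0 with j
    ...       | zero   = inj₂ (inj₁ (Cᵖ (proj₁ u) , ≈⇒≈ₘ (≗⇒≈ᵖ (S.trans (S.*-congʳ (pointwise g≗C))
                  (S.trans (C-homo-⋆ (coef (ser g) 0) (proj₁ u)) (C-cong (proj₂ u)))))))
      where
      g≗C : ∀ n → coef (ser g) n ≈ coef (C (coef (ser g) 0)) n
      g≗C zero    = refl
      g≗C (suc n) = hg (suc n) (s≤s z≤n)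
    ...       | suc i  = inj₂ (inj₂ (record
      { g = g
      ; h = k
      ; exact-g = record { deg≤ = hg ; lead = u }
      ; exact-h = record { deg≤ = hk ; lead = unit-factor
        (proj₁ (lead ex) , trans (*-congʳ (sym top)) (proj₂ (lead ex))) }
      ; degrees = degrees
      ; product = ≗⇒≈ᵖ f≗gk
      }))
      where
      degrees : suc i ℕ.+ suc (m ∸ suc (suc i)) ≡ m
      degrees = ≡.trans (ℕ.+-suc (suc i) _) (ℕ.m+[n∸m]≡n j<m)
      f≗gk : ser f ≗ ser g ⋆ ser k
      f≗gk = S.trans f≗ (S.trans (S.+-congʳ r≗0) (S.+-identityˡ _))
      hk : Deg≤ (ser k) (suc (m ∸ suc (suc i)))
      hk = cofactor-deg {ser g} (record { deg≤ = hg ; lead = u }) (suc (degree k)) (ser k) (Deg≤ser k)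
        (≡.subst (Deg< (ser g ⋆ ser k)) (≡.sym (≡.trans (ℕ.+-suc (suc i) _) (≡.cong suc degrees)))
          (Deg<-cong f≗gk (deg≤ ex)))
      top : coef (ser f) m ≈ coef (ser g) (suc i) * coef (ser k) (suc (m ∸ suc (suc i)))
      top = trans (at f≗gk m) (trans (reflexive (≡.cong (coef (ser g ⋆ ser k)) (≡.sym degrees)))
        (top-⋆ (ser g) (ser k) hg hk))

    open Algebra.Properties.CommutativeSemigroup.Divisibility P.*-commutativeSemigroup using (_∣_; _,_)

    zero-unit-or-factors : ∀ i → (residue i ≈ₘ 0ᵖ ⊎ Qᵖ.Unit (residue i)) ⊎ Factors f m
    zero-unit-or-factors i with classify m (residue i) (Deg<-box m i) ℕ.≤-refl
    ... | inj₁ r≗0        = inj₁ (inj₁ (≈⇒≈ₘ (≗⇒≈ᵖ r≗0)))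
    ... | inj₂ (inj₁ u)   = inj₁ (inj₂ u)
    ... | inj₂ (inj₂ fac) = inj₂ fac

    -- If every residue is zero or a unit, the residues form a field with q^m elements, and Fermat's
    -- theorem for the class of X says that f divides X^(q^m) - X.
    field-or-factors : f ∣ x^qⁱ-x m ⊎ Factors f m
    field-or-factors with decide-all zero-unit-or-factors
    ... | inj₂ factors = inj₂ factors
    ... | inj₁ zero-or-unit = inj₁ (quotient x^≈x , P.trans (P.trans (P.*-comm _ _) fk≈)
      (P.+-congʳ (P.reflexive (^-quotient X (q ℕ.^ m)))))
      where
      quotient-unit? : ∀ a → a ≈ₘ 0ᵖ ⊎ Qᵖ.Unit a
      quotient-unit? a with zero-or-unit (residueIndex a)
      ... | inj₁ z       = inj₁ (Q.trans (Q.sym (residue∘residueIndex a)) z)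
      ... | inj₂ (y , e) = inj₂ (y , Q.trans (Q.*-congʳ {y} (Q.sym (residue∘residueIndex a))) e)
      x^≈x : (X Qᵖ.^ (q ℕ.^ m)) ≈ₘ X
      x^≈x = Qᵖ.fermat residue residueIndex residue∘residueIndex residue-injective quotient-unit? X
      fk≈ : f *ᵖ quotient x^≈x ≈ᵖ (X Qᵖ.^ (q ℕ.^ m)) +ᵖ (-ᵖ X)
      fk≈ = P.sym (P.trans (P.+-congʳ (P.trans (equation x^≈x) (P.+-comm X (f *ᵖ quotient x^≈x))))
        (P.trans (P.+-assoc (f *ᵖ quotient x^≈x) X (-ᵖ X))
          (P.trans (P.+-congˡ (P.-‿inverseʳ X)) (P.+-identityʳ (f *ᵖ quotient x^≈x)))))

  open Algebra.Properties.CommutativeSemigroup.Divisibility P.*-commutativeSemigroup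
    using (_∣_; _,_; ∙-cong-∣; ∣-trans; ∣-respˡ; ∣-respʳ)

  ∏ : List ℕ → Poly
  ∏ = foldr (λ i g → x^qⁱ-x i *ᵖ g) (Cᵖ 1#)

  ∏-++ : ∀ σ τ → ∏ σ *ᵖ ∏ τ ≈ᵖ ∏ (σ ++ τ)
  ∏-++ []      τ = P.*-identityˡ (∏ τ)
  ∏-++ (i ∷ σ) τ = P.trans (P.*-assoc (x^qⁱ-x i) (∏ σ) (∏ τ)) (P.*-congˡ {x^qⁱ-x i} (∏-++ σ τ))

  -- σ lists the degrees of the irreducible factors of f, with multiplicity.
  factor-degrees : ∀ m f → Exact (ser f) m → ∃[ σ ] All (1 ≤_) σ × ℕ.sum σ ≡ m × f ∣ ∏ σ
  factor-degrees = <-rec _ step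
    where
    step : ∀ m → (∀ {i} → i < m → ∀ f → Exact (ser f) i → ∃[ σ ] All (1 ≤_) σ × ℕ.sum σ ≡ i × f ∣ ∏ σ) →
      ∀ f → Exact (ser f) m → ∃[ σ ] All (1 ≤_) σ × ℕ.sum σ ≡ m × f ∣ ∏ σ
    step zero rec f ex = [] , [] , ≡.refl , (Cᵖ u⁻¹ , ≗⇒≈ᵖ (pointwise λ n → trans (C-⋆ u⁻¹ (ser f) n) (fₙ n)))
      where
      u⁻¹ = proj₁ (lead ex)
      fₙ : ∀ n → u⁻¹ * coef (ser f) n ≈ coef (C 1#) n
      fₙ zero    = trans (*-comm _ _) (proj₂ (lead ex))
      fₙ (suc n) = trans (*-congˡ (deg≤ ex (suc n) (s≤s z≤n))) (zeroʳ _)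
    step m@(suc _) rec f ex with Residues.field-or-factors f ex
    ... | inj₁ f∣ = m ∷ [] , s≤s z≤n ∷ [] , ℕ.+-identityʳ m , ∣-respʳ (P.sym (P.*-identityʳ (x^qⁱ-x m))) f∣
    ... | inj₂ record { g = g ; h = h ; i = i ; j = j ; exact-g = eg ; exact-h = eh ; degrees = d ; product = f≈gh }
      with rec (≡.subst (suc i <_) d (ℕ.m<m+n (suc i) (s≤s z≤n))) g eg
         | rec (≡.subst (suc j <_) d (ℕ.m<n+m (suc j) (s≤s z≤n))) h eh
    ...   | σ , pσ , sσ , g∣ | τ , pτ , sτ , h∣ =
      σ ++ τ , All.++⁺ pσ pτ , ≡.trans (sum-++ σ τ) (≡.trans (≡.cong₂ ℕ._+_ sσ sτ) d) ,
      ∣-respˡ (P.sym f≈gh) (∣-respʳ (∏-++ σ τ) (∙-cong-∣ g∣ h∣))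

  -- Modulo x^(q^i) - x, raising x to the power q^i changes nothing, and neither does doing so j
  -- times.
  x^qⁱ-x∣x^qⁱʲ-x : ∀ {i l} → i ℕ∣.∣ l → x^qⁱ-x i ∣ x^qⁱ-x l
  x^qⁱ-x∣x^qⁱʲ-x {i} (ℕ∣.divides j ≡.refl) = quotient (iterate j) , P.sym (begin
    X Pᵖ.^ (q ℕ.^ (j ℕ.* i)) +ᵖ (-ᵖ X)                ≈⟨ P.+-congʳ (P.trans (equation (iterate j)) (P.+-comm X _)) ⟩
    x^qⁱ-x i *ᵖ quotient (iterate j) +ᵖ X +ᵖ (-ᵖ X)    ≈⟨ P.+-assoc (x^qⁱ-x i *ᵖ quotient (iterate j)) X (-ᵖ X) ⟩
    x^qⁱ-x i *ᵖ quotient (iterate j) +ᵖ (X +ᵖ (-ᵖ X))  ≈⟨ P.+-congˡ (P.-‿inverseʳ X) ⟩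
    x^qⁱ-x i *ᵖ quotient (iterate j) +ᵖ 0ᵖ             ≈⟨ P.+-identityʳ _ ⟩
    x^qⁱ-x i *ᵖ quotient (iterate j)                   ≈⟨ P.*-comm (x^qⁱ-x i) _ ⟩
    quotient (iterate j) *ᵖ x^qⁱ-x i                   ∎)
    where
    open Relation.Binary.Reasoning.Setoid P.setoid
    open Quotient polyRing (x^qⁱ-x i)
    module Q = CommutativeRing quotientRing
    module Qᵖ = Powers quotientRing
    ^-congₘ : ∀ {a b} n → a ≈ₘ b → a Pᵖ.^ n ≈ₘ b Pᵖ.^ n
    ^-congₘ {a} {b} n e = Q.trans (Q.reflexive (≡.sym (^-quotient a n)))
      (Q.trans (Qᵖ.^-congˡ n e) (Q.reflexive (^-quotient b n)))
    iterate : ∀ j → X Pᵖ.^ (q ℕ.^ (j ℕ.* i)) ≈ₘ X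
    iterate zero    = ≈⇒≈ₘ (P.*-identityʳ X)
    iterate (suc j) = Q.trans (≈⇒≈ₘ (P.trans (Pᵖ.^-congʳ X (ℕ.^-distribˡ-+-* q i (j ℕ.* i)))
      (P.sym (Pᵖ.^-assocʳ X (q ℕ.^ i) (q ℕ.^ (j ℕ.* i))))))
      (Q.trans (^-congₘ (q ℕ.^ (j ℕ.* i)) x^qⁱ≈x) (iterate j))
      where
      x^qⁱ≈x : X Pᵖ.^ (q ℕ.^ i) ≈ₘ X
      x^qⁱ≈x = multiple (Cᵖ 1#) (P.sym (P.trans (P.+-congˡ {X} (P.*-identityʳ (x^qⁱ-x i)))
        (P.trans (P.+-comm X (x^qⁱ-x i))
        (P.trans (P.+-assoc (X Pᵖ.^ (q ℕ.^ i)) (-ᵖ X) X)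
          (P.trans (P.+-congˡ { X Pᵖ.^ (q ℕ.^ i)} (P.-‿inverseˡ X)) (P.+-identityʳ _))))))

  ∏-∣ : ∀ {l} σ → All (ℕ∣._∣ l) σ → ∏ σ ∣ x^qⁱ-x l Pᵖ.^ length σ
  ∏-∣ []      []      = Cᵖ 1# , P.*-identityˡ (Cᵖ 1#)
  ∏-∣ (i ∷ σ) (d ∷ p) = ∙-cong-∣ (x^qⁱ-x∣x^qⁱʲ-x d) (∏-∣ σ p)

-- Univariate orbits

parts-∣-lcm : ∀ σ → All (ℕ∣._∣ lcmOfParts σ) σ
parts-∣-lcm []      = []
parts-∣-lcm (i ∷ σ) = m∣lcm[m,n] i (lcmOfParts σ) ∷ All.map (λ d → ℕ∣.∣-trans d (n∣lcm[m,n] i (lcmOfParts σ)))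
  (parts-∣-lcm σ)

lcm-positive : ∀ {m n} → 0 < m → 0 < n → 0 < lcm m n
lcm-positive {m} {n} 0<m 0<n = ℕ.n≢0⇒n>0 λ lcm≡0 → ℕ.<⇒≢ (ℕ.*-mono-≤ 0<m 0<n)
  (≡.sym (ℕ∣.0∣⇒≡0 (≡.subst (ℕ∣._∣ m ℕ.* n) lcm≡0 (lcm-least {m} (ℕ∣.m∣m*n n) (ℕ∣.n∣m*n m)))))

lcmOfParts-positive : ∀ {σ} → All (1 ≤_) σ → 0 < lcmOfParts σ
lcmOfParts-positive []       = s≤s z≤n
lcmOfParts-positive (p ∷ ps) = lcm-positive p (lcmOfParts-positive ps)

length≤sum : ∀ {σ} → All (1 ≤_) σ → length σ ≤ ℕ.sum σ
length≤sum []      = z≤n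
length≤sum (p ∷ ps) = ℕ.+-mono-≤ p (length≤sum ps)

-- A border may have degree below n, whence the inequality on the sum. If there are no factors at
-- all, the partition 1 of 1 stands in, because the partitioned integer must be positive. Sorting
-- keeps each part a divisor of the lcm.
partition-of-degrees : ∀ {n} σ → All (1 ≤_) σ → ℕ.sum σ ≤ n → 1 ≤ n →
  ∃₂ λ k τ → 1 ≤ k × k ≤ n × IsPartition k τ × All (ℕ∣._∣ lcmOfParts τ) σ
partition-of-degrees []          _   _   1≤n = 1 , 1 ∷ [] , s≤s z≤n , 1≤n , ([-] , s≤s z≤n ∷ [] , ≡.refl) , []
partition-of-degrees σ@(i ∷ σ′) pos@(1≤i ∷ _) s≤n _ = ℕ.sum σ , sort σ , ℕ.≤-trans 1≤i (ℕ.m≤m+n i (ℕ.sum σ′)) , s≤n ,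
  (sort-↗ σ , All-resp-↭ (↭-sym (sort-↭ σ)) pos , sum-↭ (sort-↭ σ)) ,
  All-resp-↭ (sort-↭ σ) (parts-∣-lcm (sort σ))
  where open Data.List.Sort (Flip.decTotalOrder ℕ.≤-decTotalOrder)

module Univariate {c ℓ} (R : CommutativeRing c ℓ) {q′}
  (elem : Fin (suc q′) → CommutativeRing.Carrier R) (index : CommutativeRing.Carrier R → Fin (suc q′))
  (elem∘index : ∀ a → CommutativeRing._≈_ R (elem (index a)) a)
  (elem-injective : ∀ i j → CommutativeRing._≈_ R (elem i) (elem j) → i ≡ j)
  (unit? : ∀ a → CommutativeRing._≈_ R a (CommutativeRing.0# R) ⊎ Powers.Unit R a)
  (1<q : 1 < suc q′)
  (additive : Powers.Additive (PowerSeries.seriesRing R) (suc q′)) where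

  private q = suc q′

  open CommutativeRing R hiding (zero)
  open Polynomials R
  open Factorisation R elem index elem∘index elem-injective unit?
  open Powers R using (_^_; fermat)
  open Algebra.Properties.Ring ring using (-0#≈0#)

  -- Coefficients equal their q-th powers, so the identity qualifies as θ.
  frobenius-id : ∀ a b → a ^ q * b ≈ a * b
  frobenius-id a b = *-congʳ (fermat elem index elem∘index elem-injective unit? a)

  open Cartier R q (λ a → a) (λ e → e) (λ _ _ → refl) frobenius-id additive public

  exact? : ∀ n f → Deg< f n → f ≗ 𝟘 ⊎ ∃[ d ] d < n × Exact f d
  exact? zero    f h = inj₁ (Deg<-0 h)
  exact? (suc n) f h with unit? (coef f n)
  ... | inj₂ u = inj₂ (n , ℕ.≤-refl , record { deg≤ = h ; lead = u })
  ... | inj₁ z with exact? n f (Deg<-pred {f} h z)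
  ...   | inj₁ f≗0 = inj₁ f≗0
  ...   | inj₂ (d , d<n , ex) = inj₂ (d , ℕ.<-trans d<n ℕ.≤-refl , ex)

  module Geometric (L : ℕ) (0<L : 0 < L) where

    geometric 1-xᴸ : Series
    coef geometric n with L ℕ∣.∣? n
    ... | yes _ = 1#
    ... | no _  = 0#
    1-xᴸ = C 1# ⊞ ⊟ shift L (C 1#)

    1-xᴸ-⋆ : ∀ f → 1-xᴸ ⋆ f ≗ f ⊞ ⊟ shift L f
    1-xᴸ-⋆ f = S.trans (S.distribʳ f (C 1#) (⊟ shift L (C 1#))) (S.+-cong (S.*-identityˡ f)
      (S.trans (S.sym (-‿distribˡ-* (shift L (C 1#)) f))
        (S.-‿cong (S.trans (shift-⋆ L (C 1#) f) (shift-cong L (S.*-identityˡ f))))))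
      where open Algebra.Properties.Ring S.ring using (-‿distribˡ-*)

    inverse : 1-xᴸ ⋆ geometric ≗ C 1#
    inverse = S.trans (1-xᴸ-⋆ geometric) (pointwise go)
      where
      coef-+L : ∀ n → coef geometric (L ℕ.+ n) ≡ coef geometric n
      coef-+L n with L ℕ∣.∣? (L ℕ.+ n) | L ℕ∣.∣? n
      ... | yes _ | yes _ = ≡.refl
      ... | no _  | no _  = ≡.refl
      ... | yes d | no ¬d = contradiction (ℕ∣.∣m+n∣m⇒∣n d ℕ∣.∣-refl) ¬d
      ... | no ¬d | yes d = contradiction (ℕ∣.∣m∣n⇒∣m+n ℕ∣.∣-refl d) ¬d
      small : ∀ n → n < L → coef geometric n ≈ coef (C 1#) n
      small n n<L with L ℕ∣.∣? n
      small zero    n<L | yes _ = refl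
      small (suc n) n<L | yes d = contradiction (ℕ∣.∣⇒≤ d) (ℕ.<⇒≱ n<L)
      small zero    n<L | no ¬d = contradiction (L ℕ∣.∣0) ¬d
      small (suc n) n<L | no _  = refl
      go : ∀ n → coef geometric n - coef (shift L geometric) n ≈ coef (C 1#) n
      go n with n ℕ.<? L
      ... | yes n<L = trans (+-congˡ (trans (-‿cong (coef-shift-< L geometric n n<L)) -0#≈0#))
        (trans (+-identityʳ _) (small n n<L))
      ... | no n≮L = trans (reflexive (≡.cong (λ i → coef geometric i - coef (shift L geometric) i) (≡.sym n≡)))
            (trans (+-cong (reflexive (coef-+L (n ∸ L))) (-‿cong (reflexive (coef-shift L geometric (n ∸ L)))))
            (trans (-‿inverseʳ _) (C-large n (ℕ.<-≤-trans 0<L (ℕ.≮⇒≥ n≮L)))))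
        where
        n≡ : L ℕ.+ (n ∸ L) ≡ n
        n≡ = ℕ.m+[n∸m]≡n (ℕ.≮⇒≥ n≮L)
        C-large : ∀ n → 0 < n → 0# ≈ coef (C 1#) n
        C-large (suc n) _ = refl

    cancel : ∀ {f g} → 1-xᴸ ⋆ f ≗ 1-xᴸ ⋆ g → f ≗ g
    cancel = Sᵖ.unit-cancel (geometric , inverse)

    -- From y - x^L y = u, the coefficients of y at L + i and i agree once L + i exceeds the degree
    -- of u.
    periodic : ∀ {u d} y → 1-xᴸ ⋆ y ≗ u → Deg≤ u (d ℕ.+ L) → ∀ t i → d < i → coef y (t ℕ.* L ℕ.+ i) ≈ coef y i
    periodic y e h zero    i d<i = refl
    periodic {u} {d} y e h (suc t) i d<i = trans (reflexive (≡.cong (coef y) (ℕ.+-assoc L (t ℕ.* L) i)))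
      (trans (step (t ℕ.* L ℕ.+ i) (ℕ.<-≤-trans d<i (ℕ.m≤n+m i _))) (periodic y e h t i d<i))
      where
      step : ∀ i → d < i → coef y (L ℕ.+ i) ≈ coef y i
      step i d<i = x∙y⁻¹≈ε⇒x≈y _ _ (trans (+-congˡ (-‿cong (reflexive (≡.sym (coef-shift L y i)))))
        (trans (sym (at (1-xᴸ-⋆ y) (L ℕ.+ i))) (trans (at e (L ℕ.+ i))
          (h (L ℕ.+ i) (≡.subst (_< L ℕ.+ i) (ℕ.+-comm L d) (ℕ.+-monoʳ-< L d<i))))))
        where open Algebra.Properties.Group +-group using (x∙y⁻¹≈ε⇒x≈y)

  -- Multiplication by x^{(q-1)K} followed by Λ₀ maps x^{K+qj} to x^{K+j}: it is
  -- the Cartier operator on x^{-K} F[[x]].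
  module Laurent (K : ℕ) where

    V : Series → Series
    V z = Λ 0 (shift (q′ ℕ.* K) z)

    V^ : ℕ → Series → Series
    V^ zero    z = z
    V^ (suc e) z = V (V^ e z)

    coef-V^ : ∀ e z j → coef (V^ e z) (K ℕ.+ j) ≡ coef z (K ℕ.+ q ℕ.^ e ℕ.* j)
    coef-V^ zero    z j = ≡.cong (λ i → coef z (K ℕ.+ i)) (≡.sym (ℕ.+-identityʳ j))
    coef-V^ (suc e) z j = ≡.trans (≡.cong (coef (shift (q′ ℕ.* K) (V^ e z))) index≡)
      (≡.trans (coef-shift (q′ ℕ.* K) (V^ e z) (K ℕ.+ q ℕ.* j))
      (≡.trans (coef-V^ e z (q ℕ.* j)) (≡.cong (λ i → coef z (K ℕ.+ i))
        (≡.trans (≡.sym (ℕ.*-assoc (q ℕ.^ e) q j)) (≡.cong (ℕ._* j) (ℕ.*-comm (q ℕ.^ e) q))))))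
      where
      open ≡.≡-Reasoning
      index≡ : q ℕ.* (K ℕ.+ j) ℕ.+ 0 ≡ q′ ℕ.* K ℕ.+ (K ℕ.+ q ℕ.* j)
      index≡ = begin
        q ℕ.* (K ℕ.+ j) ℕ.+ 0                ≡⟨ ℕ.+-identityʳ _ ⟩
        q ℕ.* (K ℕ.+ j)                      ≡⟨ ℕ.*-distribˡ-+ q K j ⟩
        K ℕ.+ q′ ℕ.* K ℕ.+ q ℕ.* j           ≡⟨ ≡.cong (ℕ._+ q ℕ.* j) (ℕ.+-comm K (q′ ℕ.* K)) ⟩
        q′ ℕ.* K ℕ.+ K ℕ.+ q ℕ.* j           ≡⟨ ℕ.+-assoc (q′ ℕ.* K) K _ ⟩
        q′ ℕ.* K ℕ.+ (K ℕ.+ q ℕ.* j)         ∎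

    -- Position i = K - j carries the exponent - j. After e steps its coefficient would come from
    -- the exponent - q^e j, which lies below - K and is absent from z.
    coef-V^-< : ∀ e z i j → i ℕ.+ j ≡ K → K < q ℕ.^ e ℕ.* j → coef (V^ e z) i ≈ 0#
    coef-V^-< zero z i j i+j≡K K<j = contradiction (ℕ.≤-trans (ℕ.m≤n+m j i) (ℕ.≤-reflexive i+j≡K))
      (ℕ.<⇒≱ (≡.subst (K <_) (ℕ.+-identityʳ j) K<j))
    coef-V^-< (suc e) z i j i+j≡K K<j with q ℕ.* i ℕ.+ 0 ℕ.<? q′ ℕ.* K
    ... | yes qi<  = coef-shift-< (q′ ℕ.* K) (V^ e z) _ qi<
    ... | no  qi≮  = trans (reflexive (≡.trans (≡.cong (coef (shift (q′ ℕ.* K) (V^ e z))) (≡.sym qi≡))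
      (coef-shift (q′ ℕ.* K) (V^ e z) i′)))
      (coef-V^-< e z i′ (q ℕ.* j) i′+qj≡K (≡.subst (K <_)
        (≡.trans (≡.cong (ℕ._* j) (ℕ.*-comm q (q ℕ.^ e))) (ℕ.*-assoc (q ℕ.^ e) q j)) K<j))
      where
      i′ = q ℕ.* i ℕ.+ 0 ∸ q′ ℕ.* K
      qi≡ : q′ ℕ.* K ℕ.+ i′ ≡ q ℕ.* i ℕ.+ 0
      qi≡ = ℕ.m+[n∸m]≡n (ℕ.≮⇒≥ qi≮)
      open ≡.≡-Reasoning
      i′+qj≡K : i′ ℕ.+ q ℕ.* j ≡ K
      i′+qj≡K = ℕ.+-cancelˡ-≡ (q′ ℕ.* K) _ _ (begin
        q′ ℕ.* K ℕ.+ (i′ ℕ.+ q ℕ.* j)     ≡⟨ ℕ.+-assoc (q′ ℕ.* K) i′ _ ⟨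
        q′ ℕ.* K ℕ.+ i′ ℕ.+ q ℕ.* j       ≡⟨ ≡.cong (ℕ._+ q ℕ.* j) (≡.trans qi≡ (ℕ.+-identityʳ _)) ⟩
        q ℕ.* i ℕ.+ q ℕ.* j               ≡⟨ ℕ.*-distribˡ-+ q i j ⟨
        q ℕ.* (i ℕ.+ j)                   ≡⟨ ≡.cong (q ℕ.*_) i+j≡K ⟩
        K ℕ.+ q′ ℕ.* K                    ≡⟨ ℕ.+-comm K _ ⟩
        q′ ℕ.* K ℕ.+ K                    ∎)

  -- The numerators s e of an orbit with denominator f: after multiplying
  -- numerator and denominator by G, the denominator becomes x^K (1 - x^{KN}).
  module Orbit (e₀ N : ℕ) (0<N : 0 < N) {f G : Series} {n} (n<K : n < q ℕ.^ e₀)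
    (Gf : G ⋆ f ≗ shift (q ℕ.^ e₀) (C 1# ⊞ ⊟ shift (q ℕ.^ e₀ ℕ.* N) (C 1#)))
    (Deg≤G : Deg≤ G (q ℕ.^ e₀ ℕ.+ q ℕ.^ e₀ ℕ.* N))
    (s : ℕ → Series) (Deg≤s : Deg≤ (s 0) n)
    (step : ∀ e → s (suc e) ≗ Λ 0 (f Sᵖ.^ q′ ⋆ s e)) where

    K L : ℕ
    K = q ℕ.^ e₀
    L = K ℕ.* N

    0<K : 0 < K
    0<K = ℕ.≤-<-trans z≤n n<K

    open Geometric L (ℕ.*-mono-≤ 0<K 0<N)
    open Laurent K
    open Algebra.Properties.CommutativeSemigroup S.*-commutativeSemigroup using (interchange)

    y : Series
    y = geometric ⋆ (G ⋆ s 0)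

    -- G enters Λ₀ as G^q and turns f^(q-1) s into (G f)^(q-1) (G s). Since G f = x^K (1 - x^L), and
    -- G s brings one more factor 1 - x^L, a full q-th power of 1 - x^L leaves Λ₀ as 1 - x^L. What
    -- remains inside is the step `V`.
    invariant : ∀ e → G ⋆ s e ≗ 1-xᴸ ⋆ V^ e y
    invariant zero = S.sym (S.trans (S.sym (S.*-assoc 1-xᴸ geometric (G ⋆ s 0)))
      (S.trans (S.*-congʳ inverse) (S.*-identityˡ (G ⋆ s 0))))
    invariant (suc e) = begin
      G ⋆ s (suc e)                                      ≈⟨ S.*-congˡ (step e) ⟩
      G ⋆ Λ 0 (f Sᵖ.^ q′ ⋆ s e)                          ≈⟨ Λ-frobenius 0 (s≤s z≤n) G (f Sᵖ.^ q′ ⋆ s e) ⟨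
      Λ 0 (G ⋆ G Sᵖ.^ q′ ⋆ (f Sᵖ.^ q′ ⋆ s e))
        ≈⟨ Λ-cong 0 (S.trans (S.*-congʳ (S.*-comm G (G Sᵖ.^ q′))) (interchange (G Sᵖ.^ q′) G (f Sᵖ.^ q′) (s e))) ⟩
      Λ 0 (G Sᵖ.^ q′ ⋆ f Sᵖ.^ q′ ⋆ (G ⋆ s e))
        ≈⟨ Λ-cong 0 (S.*-cong (S.trans (S.sym (Sᵖ.^-distrib-* G f q′))
          (S.trans (Sᵖ.^-congˡ q′ Gf) (shift-^ K 1-xᴸ q′))) (invariant e)) ⟩
      Λ 0 (shift (q′ ℕ.* K) (1-xᴸ Sᵖ.^ q′) ⋆ (1-xᴸ ⋆ V^ e y))
        ≈⟨ Λ-cong 0 (S.trans (shift-⋆ (q′ ℕ.* K) (1-xᴸ Sᵖ.^ q′) (1-xᴸ ⋆ V^ e y))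
          (S.trans (shift-cong (q′ ℕ.* K) power) (S.sym (⋆-shift (q′ ℕ.* K) (1-xᴸ Sᵖ.^ q) (V^ e y))))) ⟩
      Λ 0 (1-xᴸ Sᵖ.^ q ⋆ shift (q′ ℕ.* K) (V^ e y))      ≈⟨ Λ-frobenius 0 (s≤s z≤n) 1-xᴸ (shift (q′ ℕ.* K) (V^ e y)) ⟩
      1-xᴸ ⋆ V^ (suc e) y                                ∎
      where
      open Relation.Binary.Reasoning.Setoid S.setoid
      power : 1-xᴸ Sᵖ.^ q′ ⋆ (1-xᴸ ⋆ V^ e y) ≗ 1-xᴸ ⋆ 1-xᴸ Sᵖ.^ q′ ⋆ V^ e y
      power = S.trans (S.sym (S.*-assoc (1-xᴸ Sᵖ.^ q′) 1-xᴸ (V^ e y))) (S.*-congʳ (S.*-comm (1-xᴸ Sᵖ.^ q′) 1-xᴸ))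

    y-periodic : ∀ t i → K ℕ.+ n < i → coef y (t ℕ.* L ℕ.+ i) ≈ coef y i
    y-periodic = periodic y (S.sym (invariant 0)) (≡.subst (Deg≤ (G ⋆ s 0)) deg≡ (Deg≤-⋆ G (s 0) Deg≤G Deg≤s))
      where
      deg≡ : K ℕ.+ L ℕ.+ n ≡ K ℕ.+ n ℕ.+ L
      deg≡ = ≡.trans (ℕ.+-assoc K L n) (≡.trans (≡.cong (K ℕ.+_) (ℕ.+-comm L n)) (≡.sym (ℕ.+-assoc K n L)))

    -- Three ranges of exponents: negative ones have disappeared, exponent 0 is fixed by `V`, and a
    -- positive exponent j reads y at q^e j. Passing from e to l + e moves that place by N q^e j =
    -- q^(e - e₀) j L, a multiple of the period of y.
    V^-periodic : ∀ l → q ℕ.^ l ≡ suc N → ∀ e → suc e₀ ≤ e → V^ (l ℕ.+ e) y ≗ V^ e y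
    at (V^-periodic l qˡ≡ e e₀<e) i with i ℕ.<? K
    ... | yes i<K = trans (below (l ℕ.+ e) (ℕ.≤-trans e₀<e (ℕ.m≤n+m e l))) (sym (below e e₀<e))
      where
      below : ∀ e → suc e₀ ≤ e → coef (V^ e y) i ≈ 0#
      -- The inequality e₀ < e has to be strict: for K - i = 1 the requirement is K < q^e. This is
      -- the additional step of the preperiod.
      below e e₀<e = coef-V^-< e y i (K ∸ i) (ℕ.m+[n∸m]≡n (ℕ.<⇒≤ i<K))
        (ℕ.<-≤-trans (ℕ.^-monoʳ-< q 1<q e₀<e) (ℕ.m≤m*n (q ℕ.^ e) (K ∸ i) {{ℕ.>-nonZero (ℕ.m<n⇒0<n∸m i<K)}}))
    ... | no i≮K = ≡.subst (λ i → coef (V^ (l ℕ.+ e) y) i ≈ coef (V^ e y) i) (ℕ.m+[n∸m]≡n (ℕ.≮⇒≥ i≮K)) (above (i ∸ K))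
      where
      split : ∀ j → K ℕ.+ q ℕ.^ (l ℕ.+ e) ℕ.* j ≡ (q ℕ.^ (e ∸ e₀) ℕ.* j) ℕ.* L ℕ.+ (K ℕ.+ q ℕ.^ e ℕ.* j)
      split j = begin
        K ℕ.+ q ℕ.^ (l ℕ.+ e) ℕ.* j
          ≡⟨ ≡.cong (λ z → K ℕ.+ z ℕ.* j) (≡.trans (ℕ.^-distribˡ-+-* q l e) (≡.cong (ℕ._* q ℕ.^ e) qˡ≡)) ⟩
        K ℕ.+ (q ℕ.^ e ℕ.+ N ℕ.* q ℕ.^ e) ℕ.* j      ≡⟨ ≡.cong (λ z → K ℕ.+ (q ℕ.^ e ℕ.+ N ℕ.* z) ℕ.* j) qᵉ≡ ⟩
        K ℕ.+ (q ℕ.^ e ℕ.+ N ℕ.* (q ℕ.^ (e ∸ e₀) ℕ.* K)) ℕ.* j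
          ≡⟨ solve 5 (λ K Q N T j → K :+ (Q :+ N :* (T :* K)) :* j := (T :* j) :* (K :* N) :+
            (K :+ Q :* j)) ≡.refl K (q ℕ.^ e) N (q ℕ.^ (e ∸ e₀)) j ⟩
        (q ℕ.^ (e ∸ e₀) ℕ.* j) ℕ.* (K ℕ.* N) ℕ.+ (K ℕ.+ q ℕ.^ e ℕ.* j) ∎
        where
        open ≡.≡-Reasoning
        open +-*-Solver
        qᵉ≡ : q ℕ.^ e ≡ q ℕ.^ (e ∸ e₀) ℕ.* K
        qᵉ≡ = ≡.trans (≡.cong (q ℕ.^_) (≡.sym (ℕ.m∸n+n≡m (ℕ.<⇒≤ e₀<e)))) (ℕ.^-distribˡ-+-* q (e ∸ e₀) e₀)
      above : ∀ j → coef (V^ (l ℕ.+ e) y) (K ℕ.+ j) ≈ coef (V^ e y) (K ℕ.+ j)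
      above zero = reflexive (≡.trans (coef-V^ (l ℕ.+ e) y 0) (≡.trans (≡.cong (λ z → coef y (K ℕ.+ z))
        (≡.trans (ℕ.*-zeroʳ (q ℕ.^ (l ℕ.+ e))) (≡.sym (ℕ.*-zeroʳ (q ℕ.^ e))))) (≡.sym (coef-V^ e y 0))))
      above j@(suc _) = trans (reflexive (≡.trans (coef-V^ (l ℕ.+ e) y j) (≡.cong (coef y) (split j))))
        (trans (y-periodic (q ℕ.^ (e ∸ e₀) ℕ.* j) (K ℕ.+ q ℕ.^ e ℕ.* j)
          (ℕ.+-monoʳ-< K (ℕ.<-≤-trans n<K (ℕ.≤-trans (ℕ.^-monoʳ-≤ q (ℕ.<⇒≤ e₀<e)) (ℕ.m≤m*n (q ℕ.^ e) j)))))
        (reflexive (≡.sym (coef-V^ e y j))))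

    -- `invariant` gives the period for G s. Multiplying by f replaces G by x^K (1 - x^L), and both
    -- of these factors can be cancelled.
    orbit-periodic : ∀ l → q ℕ.^ l ≡ suc N → ∀ e → suc e₀ ≤ e → s (l ℕ.+ e) ≗ s e
    orbit-periodic l qˡ≡ e e₀<e = cancel (shift-injective K (begin
      shift K (1-xᴸ ⋆ s (l ℕ.+ e))     ≈⟨ clear (s (l ℕ.+ e)) ⟨
      f ⋆ (G ⋆ s (l ℕ.+ e))
        ≈⟨ S.*-congˡ (S.trans (invariant (l ℕ.+ e))
          (S.trans (S.*-congˡ (V^-periodic l qˡ≡ e e₀<e)) (S.sym (invariant e)))) ⟩
      f ⋆ (G ⋆ s e)                    ≈⟨ clear (s e) ⟩
      shift K (1-xᴸ ⋆ s e)             ∎))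
      where
      open Relation.Binary.Reasoning.Setoid S.setoid
      clear : ∀ t → f ⋆ (G ⋆ t) ≗ shift K (1-xᴸ ⋆ t)
      clear t = S.trans (S.sym (S.*-assoc f G t)) (S.trans (S.*-congʳ (S.trans (S.*-comm f G) Gf)) (shift-⋆ K 1-xᴸ t))

  -- f divides ∏ (x^{qⁱ} - x), hence also (x^{qˡ} - x)^K = x^{K qˡ} - x^K; multiplicities
  -- are absorbed by K, so the factors of f need not be coprime.
  common-multiple : ∀ {m f} → Exact f m → ∃[ σ ] All (1 ≤_) σ × ℕ.sum σ ≡ m ×
    (∀ l N e₀ → All (ℕ∣._∣ l) σ → q ℕ.^ l ≡ suc N → m ≤ q ℕ.^ e₀ →
    ∃[ G ] G ⋆ f ≗ shift (q ℕ.^ e₀) (C 1# ⊞ ⊟ shift (q ℕ.^ e₀ ℕ.* N) (C 1#)) × Deg≤ G (q ℕ.^ e₀ ℕ.+ q ℕ.^ e₀ ℕ.* N))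
  common-multiple {m} {f} ex with factor-degrees m (poly {f} {m} (deg≤ ex)) ex
  ... | σ , pos , sum≡ , f∣ = σ , pos , sum≡ , λ l N e₀ σ∣l qˡ≡ m≤K → cofactor l N e₀ qˡ≡
    (∣-trans (∣-trans f∣ (∏-∣ σ σ∣l))
      (^-∣ (x^qⁱ-x l) (ℕ.≤-trans (length≤sum pos) (ℕ.≤-trans (ℕ.≤-reflexive sum≡) m≤K))))
    where
    open Algebra.Properties.CommutativeSemigroup.Divisibility P.*-commutativeSemigroup using (_∣_; _,_; ∣-trans)
    open Relation.Binary.Reasoning.Setoid S.setoid

    ^-∣ : ∀ a {i j} → i ≤ j → a Pᵖ.^ i ∣ a Pᵖ.^ j
    ^-∣ a {i} {j} i≤j = a Pᵖ.^ (j ∸ i) , P.trans (P.sym (Pᵖ.^-homo-* a (j ∸ i) i)) (Pᵖ.^-congʳ a (ℕ.m∸n+n≡m i≤j))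

    cofactor : ∀ l N e₀ → q ℕ.^ l ≡ suc N → poly {f} {m} (deg≤ ex) ∣ x^qⁱ-x l Pᵖ.^ (q ℕ.^ e₀) →
      ∃[ G ] G ⋆ f ≗ shift (q ℕ.^ e₀) (C 1# ⊞ ⊟ shift (q ℕ.^ e₀ ℕ.* N) (C 1#)) × Deg≤ G (q ℕ.^ e₀ ℕ.+ q ℕ.^ e₀ ℕ.* N)
    -- The sign turns x^(K + L) - x^K into x^K (1 - x^L). For the degree of the cofactor the degree
    -- K + L of the whole product is bound enough.
    cofactor l N e₀ qˡ≡ (H , Hf) = ⊟ ser H , Gf , cofactor-deg ex (suc (degree H)) (⊟ ser H)
      (Deg≤-⊟ {ser H} (Deg≤ser H))
        (Deg<-cong (S.trans (S.sym Gf) (S.*-comm (⊟ ser H) f))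
          (Deg<-mono {shift K E} (ℕ.≤-trans (ℕ.≤-reflexive (≡.sym (ℕ.+-suc K L)))
            (ℕ.≤-trans (ℕ.≤-reflexive (ℕ.+-suc K L)) (ℕ.m≤n+m (suc (K ℕ.+ L)) m))) (Deg≤-shift K {E} Deg≤E)))
      where
      K = q ℕ.^ e₀
      L = K ℕ.* N
      E = C 1# ⊞ ⊟ shift L (C 1#)
      Deg≤E : Deg≤ E L
      Deg≤E = Deg≤-⊞ {C 1#} {⊟ shift L (C 1#)} (Deg≤-mono {C 1#} z≤n (Deg≤-C 1#))
        (Deg≤-⊟ {shift L (C 1#)} (≡.subst (Deg≤ (shift L (C 1#))) (ℕ.+-identityʳ L)
          (Deg≤-shift L {C 1#} (Deg≤-C 1#))))

      open Algebra.Properties.Ring S.ring using (-‿distribˡ-*; -‿+-comm; -‿involutive)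

      x^ : ∀ j k → shift j (C 1#) Sᵖ.^ k ≗ shift (k ℕ.* j) (C 1#)
      x^ j k = S.trans (shift-^ j (C 1#) k) (shift-cong (k ℕ.* j) (Sᵖ.1^ k))

      power : (shift (q ℕ.^ l) (C 1#) ⊞ ⊟ shift 1 (C 1#)) Sᵖ.^ K ≗ shift (K ℕ.+ L) (C 1#) ⊞ ⊟ shift K (C 1#)
      power = S.trans (Sᵖ.additive-minus {K} (Sᵖ.additive-^ {q} additive e₀) (shift (q ℕ.^ l) (C 1#))
        (shift 1 (C 1#)))
        (S.+-cong (S.trans (x^ (q ℕ.^ l) K) (S.reflexive
          (≡.cong (λ i → shift i (C 1#)) (≡.trans (≡.cong (K ℕ.*_) qˡ≡) (ℕ.*-suc K N)))))
          (S.-‿cong (S.trans (x^ 1 K) (S.reflexive (≡.cong (λ i → shift i (C 1#)) (ℕ.*-identityʳ K))))))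

      base : ser (x^qⁱ-x l) ≗ shift (q ℕ.^ l) (C 1#) ⊞ ⊟ shift 1 (C 1#)
      base = S.+-congʳ (S.trans (S.reflexive (ser-^ X (q ℕ.^ l)))
        (S.trans (x^ 1 (q ℕ.^ l)) (S.reflexive (≡.cong (λ i → shift i (C 1#)) (ℕ.*-identityʳ (q ℕ.^ l))))))

      shift-⊟ : ∀ k g → ⊟ shift k g ≗ shift k (⊟ g)
      shift-⊟ zero    g = ≗-refl
      shift-⊟ (suc k) g = S.trans (pointwise λ { zero → -0#≈0# ; (suc n) → refl }) (x·-cong (shift-⊟ k g))

      shift-⊞ : ∀ k g h → shift k (g ⊞ h) ≗ shift k g ⊞ shift k h
      shift-⊞ zero    g h = ≗-refl
      shift-⊞ (suc k) g h = S.trans (x·-cong (shift-⊞ k g h))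
        (pointwise λ { zero → sym (+-identityˡ 0#) ; (suc n) → refl })

      Gf : ⊟ ser H ⋆ f ≗ shift K E
      Gf = begin
        ⊟ ser H ⋆ f                                              ≈⟨ -‿distribˡ-* (ser H) f ⟨
        ⊟ (ser H ⋆ f)                                            ≈⟨ S.-‿cong (≈ᵖ⇒≗ Hf) ⟩
        ⊟ ser (x^qⁱ-x l Pᵖ.^ K)
          ≈⟨ S.-‿cong (S.trans (S.reflexive (ser-^ (x^qⁱ-x l) K)) (S.trans (Sᵖ.^-congˡ K base) power)) ⟩
        ⊟ (shift (K ℕ.+ L) (C 1#) ⊞ ⊟ shift K (C 1#))
          ≈⟨ -‿+-comm (shift (K ℕ.+ L) (C 1#)) (⊟ shift K (C 1#)) ⟨
        ⊟ shift (K ℕ.+ L) (C 1#) ⊞ ⊟ (⊟ shift K (C 1#))          ≈⟨ S.+-comm _ _ ⟩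
        ⊟ (⊟ shift K (C 1#)) ⊞ ⊟ shift (K ℕ.+ L) (C 1#)
          ≈⟨ S.+-cong (-‿involutive (shift K (C 1#))) (S.-‿cong (S.reflexive (≡.sym (shift-shift K L (C 1#))))) ⟩
        shift K (C 1#) ⊞ ⊟ shift K (shift L (C 1#))              ≈⟨ S.+-congˡ (shift-⊟ K (shift L (C 1#))) ⟩
        shift K (C 1#) ⊞ shift K (⊟ shift L (C 1#))              ≈⟨ shift-⊞ K (C 1#) (⊟ shift L (C 1#)) ⟨
        shift K E                                                ∎

  -- The partition is chosen from f alone, before the orbit, so one period serves every starting
  -- numerator. For f = 0 the factor f^(q-1) kills the orbit after one step, as q > 1, and period 1
  -- suffices.
  univariate-orbit : ∀ n f → 1 ≤ n → Deg≤ f n → ∃₂ λ k σ → 1 ≤ k × k ≤ n × IsPartition k σ ×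
    (∀ e₀ → n < q ℕ.^ e₀ → (s : ℕ → Series) → Deg≤ (s 0) n → (∀ e → s (suc e) ≗ Λ 0 (f Sᵖ.^ q′ ⋆ s e)) →
      ∀ e → suc e₀ ≤ e → s (lcmOfParts σ ℕ.+ e) ≗ s e)
  univariate-orbit n f 1≤n h with exact? (suc n) f h
  ... | inj₁ f≗0 = 1 , 1 ∷ [] , s≤s z≤n , 1≤n , ([-] , s≤s z≤n ∷ [] , ≡.refl) , λ e₀ n<K s _ step e e₀<e →
          S.trans (vanishes s step (suc e) (s≤s z≤n)) (S.sym (vanishes s step e (ℕ.≤-trans (s≤s z≤n) e₀<e)))
    where
    vanishes : ∀ s → (∀ e → s (suc e) ≗ Λ 0 (f Sᵖ.^ q′ ⋆ s e)) → ∀ e → 1 ≤ e → s e ≗ 𝟘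
    vanishes s step (suc e) _ = S.trans (step e) (S.trans (Λ-cong 0 (S.trans
      (S.*-congʳ (S.trans (Sᵖ.^-congˡ q′ f≗0) (Sᵖ.0^ (ℕ.s≤s⁻¹ 1<q)))) (S.zeroˡ (s e)))) (pointwise λ _ → refl))
  ... | inj₂ (m , s≤s m≤n , ex) with common-multiple ex
  ...   | σ , pos , sum≡ , multiple with partition-of-degrees σ pos (ℕ.≤-trans (ℕ.≤-reflexive sum≡) m≤n) 1≤n
  ...     | k , τ , 1≤k , k≤n , isPartition@(_ , posτ , _) , σ∣ = k , τ , 1≤k , k≤n , isPartition , λ e₀ n<K s Deg≤s step e e₀<e →
    let N = q ℕ.^ lcmOfParts τ ∸ 1
        1<M = ℕ.^-monoʳ-< q 1<q (lcmOfParts-positive posτ)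
        qˡ≡ = ≡.sym (ℕ.m+[n∸m]≡n {1} (ℕ.<⇒≤ 1<M))
        G , Gf , Deg≤G = multiple (lcmOfParts τ) N e₀ σ∣ qˡ≡ (ℕ.≤-trans m≤n (ℕ.<⇒≤ n<K))
    in Orbit.orbit-periodic e₀ N (ℕ.m<n⇒0<n∸m 1<M) n<K Gf Deg≤G s Deg≤s step (lcmOfParts τ) qˡ≡ e e₀<e

-- Numerators of bivariate fractions

∈⇒≤max : ∀ {x xs} → x ∈ xs → x ≤ max 0 xs
∈⇒≤max {xs = xs} x∈ = All.lookup (xs≤max 0 xs) x∈

lcm₄≤𝓛 : ∀ {n₁ n₂ n₃ n₄ σ₁ σ₂ σ₃ σ₄} → σ₁ ∈ partitionsUpTo n₁ → σ₂ ∈ partitionsUpTo n₂ →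
  σ₃ ∈ partitionsUpTo n₃ → σ₄ ∈ partitionsUpTo n₄ → lcm₄ (σ₁ , σ₂ , σ₃ , σ₄) ≤ 𝓛 n₁ n₂ n₃ n₄
lcm₄≤𝓛 p₁ p₂ p₃ p₄ = ∈⇒≤max (∈-map⁺ lcm₄ (∈-cartesianProduct⁺ p₁
  (∈-cartesianProduct⁺ p₂ (∈-cartesianProduct⁺ p₃ p₄))))

cover-size : ∀ q h d {l L} e → l ≤ L →
  (q ℕ.^ d) ℕ.^ h ℕ.+ (l ℕ.* (q ℕ.^ (d ∸ 1)) ℕ.^ (h ∸ 1) ℕ.+ e) ≤ q ℕ.^ (h ℕ.* d) ℕ.+ q ℕ.^
    ((h ∸ 1) ℕ.* (d ∸ 1)) ℕ.* L ℕ.+ e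
cover-size q h d {l} {L} e l≤L = begin
  (q ℕ.^ d) ℕ.^ h ℕ.+ (l ℕ.* (q ℕ.^ (d ∸ 1)) ℕ.^ (h ∸ 1) ℕ.+ e)
    ≡⟨ ≡.cong₂ (λ x y → x ℕ.+ (l ℕ.* y ℕ.+ e)) (power h d) (power (h ∸ 1) (d ∸ 1)) ⟩
  q ℕ.^ (h ℕ.* d) ℕ.+ (l ℕ.* q ℕ.^ ((h ∸ 1) ℕ.* (d ∸ 1)) ℕ.+ e)
    ≤⟨ ℕ.+-monoʳ-≤ (q ℕ.^ (h ℕ.* d)) (ℕ.+-monoˡ-≤ e (ℕ.≤-trans (ℕ.*-monoˡ-≤ _ l≤L) (ℕ.≤-reflexive (ℕ.*-comm L _)))) ⟩
  q ℕ.^ (h ℕ.* d) ℕ.+ (q ℕ.^ ((h ∸ 1) ℕ.* (d ∸ 1)) ℕ.* L ℕ.+ e)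
    ≡⟨ ℕ.+-assoc (q ℕ.^ (h ℕ.* d)) _ e ⟨
  q ℕ.^ (h ℕ.* d) ℕ.+ q ℕ.^ ((h ∸ 1) ℕ.* (d ∸ 1)) ℕ.* L ℕ.+ e ∎
  where
  open ℕ.≤-Reasoning
  power : ∀ h d → (q ℕ.^ d) ℕ.^ h ≡ q ℕ.^ (h ℕ.* d)
  power h d = ≡.trans (ℕ.^-*-assoc q d h) (≡.cong (q ℕ.^_) (ℕ.*-comm d h))

module Bivariate {c ℓ} (R : CommutativeRing c ℓ) {q′}
  (elem : Fin (suc q′) → CommutativeRing.Carrier R) (index : CommutativeRing.Carrier R → Fin (suc q′))
  (elem∘index : ∀ a → CommutativeRing._≈_ R (elem (index a)) a)
  (elem-injective : ∀ i j → CommutativeRing._≈_ R (elem i) (elem j) → i ≡ j)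
  (unit? : ∀ a → CommutativeRing._≈_ R a (CommutativeRing.0# R) ⊎ Powers.Unit R a)
  (1<q : 1 < suc q′)
  (additive₁ : Powers.Additive (PowerSeries.seriesRing R) (suc q′))
  (additive₂ : Powers.Additive (PowerSeries.seriesRing (PowerSeries.seriesRing R)) (suc q′)) where

  private q = suc q′

  module S₁ = Polynomials R
  module S₂ = Polynomials S₁.seriesRing
  module U = Univariate R elem index elem∘index elem-injective unit? 1<q additive₁

  open CommutativeRing R hiding (zero)
  open S₂ using (coef; at; _≗_; _⋆_; _⊞_; ⊟_; pointwise; module S; module Sᵖ)

  Series² : Set c
  Series² = S₂.Series

  coef² : Series² → ℕ → ℕ → Carrier
  coef² f m n = S₁.coef (coef f m) n

  at² : ∀ {f g} → f ≗ g → ∀ m n → coef² f m n ≈ coef² g m n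
  at² p m n = S₁.at (at p m) n

  pointwise² : ∀ {f g} → (∀ m n → coef² f m n ≈ coef² g m n) → f ≗ g
  pointwise² h = pointwise λ m → S₁.pointwise λ n → h m n

  open Algebra.Properties.CommutativeMonoid.Sum +-commutativeMonoid using (sum; ∑-comm; sum⁺-syntax)

  coef²-⋆ : ∀ f g m n → coef² (f ⋆ g) m n ≈ ∑[ i ≤ m ] ∑[ j ≤ n ]
    (coef² f (toℕ i) (toℕ j) * coef² g (m ∸ toℕ i) (n ∸ toℕ j))
  coef²-⋆ f g m n = reflexive (coef-sum (suc m) λ i → coef f (toℕ i) S₁.⋆ coef g (m ∸ toℕ i))
    where
    module ∑₁ = Algebra.Properties.CommutativeMonoid.Sum S₁.S.+-commutativeMonoid
    coef-sum : ∀ m (t : Fin m → S₁.Series) → S₁.coef (∑₁.sum t) n ≡ sum (λ i → S₁.coef (t i) n)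
    coef-sum zero    t = ≡.refl
    coef-sum (suc m) t = ≡.cong (S₁.coef (t Fin.zero) n +_) (coef-sum m (t ∘ Fin.suc))

  swap : Series² → Series²
  S₁.coef (coef (swap f) n) m = coef² f m n

  swap-⋆ : ∀ f g → swap (f ⋆ g) ≗ swap f ⋆ swap g
  swap-⋆ f g = pointwise² λ n m → trans (coef²-⋆ f g m n) (trans
    (∑-comm {suc m} {suc n} λ i j → coef² f (toℕ i) (toℕ j) * coef² g (m ∸ toℕ i) (n ∸ toℕ j))
    (sym (coef²-⋆ (swap f) (swap g) n m)))

  -- The operator in y is the θ of the operator in x, with the same r in both variables. Hence the
  -- diagonal of Λᵣ A at n is, by computation, the diagonal of A at q n + r.
  module C₂ (r : ℕ) (r<q : r < q) =
    Cartier S₁.seriesRing q (U.Λ r) (U.Λ-cong r) (U.Λ-⊞ r) (U.Λ-frobenius r r<q) additive₂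

  Λ : ∀ r → r < q → Series² → Series²
  Λ r r<q = C₂.Λ r r<q r

  0<q : 0 < q
  0<q = s≤s z≤n

  diagonal : Series² → ℕ → Carrier
  diagonal A n = coef² A n n

  numerator-Λ : ∀ Q A r r<q → Q ⋆ Λ r r<q A ≗ Λ r r<q (Q Sᵖ.^ q′ ⋆ (Q ⋆ A))
  numerator-Λ Q A r r<q = begin
    Q ⋆ Λ r r<q A                       ≈⟨ C₂.Λ-frobenius r r<q r r<q Q A ⟨
    Λ r r<q (Q ⋆ Q Sᵖ.^ q′ ⋆ A)         ≈⟨ C₂.Λ-cong r r<q r (S.*-congʳ (S.*-comm Q (Q Sᵖ.^ q′))) ⟩
    Λ r r<q (Q Sᵖ.^ q′ ⋆ Q ⋆ A)         ≈⟨ C₂.Λ-cong r r<q r (S.*-assoc (Q Sᵖ.^ q′) Q A) ⟩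
    Λ r r<q (Q Sᵖ.^ q′ ⋆ (Q ⋆ A))       ∎
    where open Relation.Binary.Reasoning.Setoid S.setoid

  Λ-vanish : ∀ r r<q f m → coef f (q ℕ.* m ℕ.+ r) S₁.≗ S₁.𝟘 → coef (Λ r r<q f) m S₁.≗ S₁.𝟘
  Λ-vanish r r<q f m z = S₁.S.trans (U.Λ-cong r z) (S₁.pointwise λ _ → refl)

  -- Q^(q-1) (Q A) has degree at most (q - 1) h + b, and coefficient m of its image is read at q m +
  -- r; the last hypothesis puts this index out of range.
  numerator-deg : ∀ Q A {h b B} r r<q → S₂.Deg≤ Q h → S₂.Deg≤ (Q ⋆ A) b →
    (∀ m → B ≤ m → q′ ℕ.* h ℕ.+ b < q ℕ.* m ℕ.+ r) → S₂.Deg< (Q ⋆ Λ r r<q A) B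
  numerator-deg Q A r r<q hQ hN lt m B≤m = S₁.S.trans (at (numerator-Λ Q A r r<q) m)
    (Λ-vanish r r<q (Q Sᵖ.^ q′ ⋆ (Q ⋆ A)) m (S₂.Deg≤-⋆ (Q Sᵖ.^ q′) (Q ⋆ A) (S₂.Deg≤-^ Q q′ hQ) hN _ (lt m B≤m)))

  numerator-deg-0 : ∀ Q A {h} r r<q → S₂.Deg≤ Q h → S₂.Deg≤ (Q ⋆ A) h → S₂.Deg≤ (Q ⋆ Λ r r<q A) h
  numerator-deg-0 Q A {h} r r<q hQ hN = numerator-deg Q A r r<q hQ hN λ m h<m → ℕ.<-≤-trans
    (≡.subst (_< q ℕ.* m) (ℕ.+-comm h (q′ ℕ.* h)) (ℕ.*-monoʳ-< q h<m)) (ℕ.m≤m+n (q ℕ.* m) r)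

  -- At m = h the index q h + r exceeds the degree q h precisely because r is positive; this gains
  -- one degree.
  numerator-deg-1 : ∀ Q A {h} r r<q → 0 < r → S₂.Deg≤ Q h → S₂.Deg≤ (Q ⋆ A) h → S₂.Deg< (Q ⋆ Λ r r<q A) h
  numerator-deg-1 Q A {h} r r<q 0<r hQ hN = numerator-deg Q A r r<q hQ hN λ m h≤m → ℕ.≤-<-trans
    (≡.subst (_≤ q ℕ.* m) (ℕ.+-comm h (q′ ℕ.* h)) (ℕ.*-monoʳ-≤ q h≤m)) (ℕ.m<m+n (q ℕ.* m) 0<r)

  -- With a numerator of degree at most h - 1 the total degree (q - 1) h + (h - 1) is already below
  -- q h, so r = 0 is allowed.
  numerator-deg-< : ∀ Q A {h} r r<q → 0 < h → S₂.Deg≤ Q h → S₂.Deg< (Q ⋆ A) h → S₂.Deg< (Q ⋆ Λ r r<q A) h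
  numerator-deg-< Q A {suc h} r r<q 0<h hQ hN = numerator-deg Q A r r<q hQ hN λ m h<m → ℕ.<-≤-trans
    (≡.subst (_< q ℕ.* m) (ℕ.+-comm h (q′ ℕ.* suc h)) (ℕ.<-≤-trans (s≤s ℕ.≤-refl) (ℕ.*-monoʳ-≤ q h<m)))
      (ℕ.m≤m+n (q ℕ.* m) r)

  PeriodicFrom : ℕ → ℕ → (ℕ → S₁.Series) → Set ℓ
  PeriodicFrom e₁ l s = ∀ e → e₁ ≤ e → s (l ℕ.+ e) S₁.≗ s e

  periodic-∣ : ∀ {e₁ l l′ s} → l ℕ∣.∣ l′ → PeriodicFrom e₁ l s → PeriodicFrom e₁ l′ s
  periodic-∣ {e₁} {l} {s = s} (ℕ∣.divides t ≡.refl) per = go t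
    where
    go : ∀ t → PeriodicFrom e₁ (t ℕ.* l) s
    go zero    e _ = S₁.S.refl
    go (suc t) e e₁≤e = S₁.S.trans (S₁.S.reflexive (≡.cong s (ℕ.+-assoc l (t ℕ.* l) e)))
      (S₁.S.trans (per (t ℕ.* l ℕ.+ e) (ℕ.≤-trans e₁≤e (ℕ.m≤n+m e _))) (go t e e₁≤e))

  PartitionUpTo : ℕ → Set
  PartitionUpTo n = ∃₂ λ k σ → 1 ≤ k × k ≤ n × IsPartition k σ

  period : ∀ {n} → PartitionUpTo n → ℕ
  period (_ , σ , _) = lcmOfParts σ

  period-positive : ∀ {n} (σ : PartitionUpTo n) → 0 < period σ
  period-positive (_ , σ , _ , _ , _ , pos , _) = lcmOfParts-positive pos

  -- The coefficients of x⁰ and xʰ in the numerators are orbits of univariate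
  -- Cartier operators.
  borders : ∀ Q {h d} → 1 ≤ d → S₂.Deg≤ Q h → (∀ m → S₁.Deg≤ (coef Q m) d) →
    ∃₂ λ (σ τ : PartitionUpTo d) → ∀ e₀ → d < q ℕ.^ e₀ → (A : ℕ → Series²) → (∀ e → A (suc e) ≗ Λ 0 0<q (A e)) →
      (∀ e → S₂.Deg≤ (Q ⋆ A e) h) → (∀ m → S₁.Deg≤ (coef (Q ⋆ A 0) m) d) →
      PeriodicFrom (suc e₀) (period σ) (λ e → coef (Q ⋆ A e) 0) × PeriodicFrom (suc e₀) (period τ)
        (λ e → coef (Q ⋆ A e) h)
  borders Q {h} {d} 1≤d hQ dQ with U.univariate-orbit d (coef Q 0) 1≤d (dQ 0) | U.univariate-orbit d (coef Q h) 1≤d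
    (dQ h)
  ... | k , σ , 1≤k , k≤d , pσ , perσ | k′ , τ , 1≤k′ , k′≤d , pτ , perτ =
    (k , σ , 1≤k , k≤d , pσ) , (k′ , τ , 1≤k′ , k′≤d , pτ) , λ e₀ d<K A step hN dN →
      perσ e₀ d<K (λ e → coef (Q ⋆ A e) 0) (dN 0) (λ e → low (A e) (A (suc e)) (step e)) ,
      perτ e₀ d<K (λ e → coef (Q ⋆ A e) h) (dN h) (λ e → high (A e) (A (suc e)) (step e) (hN e))
    where
    step′ : ∀ A A′ → A′ ≗ Λ 0 0<q A → ∀ m → coef (Q ⋆ A′) m S₁.≗ U.Λ 0 (coef (Q Sᵖ.^ q′ ⋆ (Q ⋆ A)) (q ℕ.* m ℕ.+ 0))
    step′ A A′ A′≗ m = at (S.trans (S.*-congˡ A′≗) (numerator-Λ Q A 0 0<q)) m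
    -- The indices 0 and q h are the extreme ones of Q^(q-1) (Q A), so the coefficients there are
    -- products of extreme coefficients.
    low : ∀ A A′ → A′ ≗ Λ 0 0<q A → coef (Q ⋆ A′) 0 S₁.≗ U.Λ 0 (coef Q 0 S₁.Sᵖ.^ q′ S₁.⋆ coef (Q ⋆ A) 0)
    low A A′ A′≗ = S₁.S.trans (step′ A A′ A′≗ 0) (U.Λ-cong 0 (S₁.S.trans
      (S₁.S.reflexive (≡.cong (coef (Q Sᵖ.^ q′ ⋆ (Q ⋆ A))) (≡.trans (ℕ.+-identityʳ _) (ℕ.*-zeroʳ q))))
      (S₁.S.trans (S₂.head-⋆ (Q Sᵖ.^ q′) (Q ⋆ A)) (S₁.S.*-congʳ (S₂.head-^ Q q′)))))
    high : ∀ A A′ → A′ ≗ Λ 0 0<q A → S₂.Deg≤ (Q ⋆ A) h → coef (Q ⋆ A′) h S₁.≗ U.Λ 0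
      (coef Q h S₁.Sᵖ.^ q′ S₁.⋆ coef (Q ⋆ A) h)
    high A A′ A′≗ hN = S₁.S.trans (step′ A A′ A′≗ h) (U.Λ-cong 0 (S₁.S.trans
      (S₁.S.reflexive (≡.cong (coef (Q Sᵖ.^ q′ ⋆ (Q ⋆ A))) (≡.trans (ℕ.+-identityʳ _) (ℕ.+-comm h (q′ ℕ.* h)))))
      (S₁.S.trans (S₂.top-⋆ (Q Sᵖ.^ q′) (Q ⋆ A) (S₂.Deg≤-^ Q q′ hQ) hN) (S₁.S.*-congʳ (S₂.top-^ Q q′ hQ)))))

  module Box₂ (n : ℕ) = Box S₁.seriesRing (Box.box R elem index n) (Box.boxIndex R elem index n)

  box² : ∀ h d → Fin ((q ℕ.^ d) ℕ.^ h) → Series²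
  box² h d = Box₂.box d h

  box²Index : ∀ h d → Series² → Fin ((q ℕ.^ d) ℕ.^ h)
  box²Index h d = Box₂.boxIndex d h

  box²-box²Index : ∀ h d f → (∀ m n → h ≤ m ⊎ d ≤ n → coef² f m n ≈ 0#) → box² h d (box²Index h d f) ≗ f
  box²-box²Index h d f z = Box₂.box-boxIndex d h f (λ m h≤m → S₁.pointwise λ n → z m n (inj₁ h≤m)) λ m m<h →
    Box.box-boxIndex R elem index d (coef f m) (λ n d≤n → z m n (inj₂ d≤n)) λ _ _ → elem∘index _

  xy· : Series² → Series²
  coef (xy· f) zero    = S₁.𝟘
  coef (xy· f) (suc m) = S₁.x· coef f m

  xy·-cong : ∀ {f g} → f ≗ g → xy· f ≗ xy· g
  xy·-cong p = pointwise λ { zero → S₁.S.refl ; (suc m) → S₁.x·-cong (at p m) }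

  interior : Series² → Series²
  S₁.coef (coef (interior f) m) n = coef² f (suc m) (suc n)

  xy·-interior : ∀ f → (∀ n → coef² f 0 n ≈ 0#) → (∀ m → coef² f m 0 ≈ 0#) → xy· (interior f) ≗ f
  xy·-interior f left bottom = pointwise² λ where
    zero    n       → sym (left n)
    (suc m) zero    → sym (bottom (suc m))
    (suc m) (suc n) → refl

  -- Q stands for the denominator, with inverse Q⁻¹, and A for the expanded
  -- fraction, with numerator Q ⋆ A.
  module Kernel (Q Q⁻¹ : Series²) (QQ⁻¹≗1 : Q ⋆ Q⁻¹ ≗ S₂.C (S₁.C 1#))
    {h d} (1≤h : 1 ≤ h) (1≤d : 1 ≤ d) (degˣQ : S₂.Deg≤ Q h) (degʸQ : S₂.Deg≤ (swap Q) d) where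

    -- The degree in y is stated after `swap`, so that the lemmas on the degree in x apply to both
    -- variables.
    record V (A : Series²) : Set ℓ where
      field
        degˣ : S₂.Deg≤ (Q ⋆ A) h
        degʸ : S₂.Deg≤ (swap Q ⋆ swap A) d

    record V° (A : Series²) : Set ℓ where
      field
        degˣ : S₂.Deg< (Q ⋆ A) h
        degʸ : S₂.Deg< (swap Q ⋆ swap A) d

    swap-Λ : ∀ r r<q A → swap Q ⋆ swap (Λ r r<q A) ≗ swap Q ⋆ Λ r r<q (swap A)
    swap-Λ r r<q A = S.*-congˡ {swap Q} (pointwise² λ _ _ → refl)

    V-Λ : ∀ r r<q {A} → V A → V (Λ r r<q A)
    V-Λ r r<q {A} v = record
      { degˣ = numerator-deg-0 Q A r r<q degˣQ (V.degˣ v)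
      ; degʸ = S₂.Deg≤-cong (S.sym (swap-Λ r r<q A)) (numerator-deg-0 (swap Q) (swap A) r r<q degʸQ (V.degʸ v))
      }

    V°-Λ : ∀ r r<q {A} → V° A → V° (Λ r r<q A)
    V°-Λ r r<q {A} v = record
      { degˣ = numerator-deg-< Q A r r<q 1≤h degˣQ (V°.degˣ v)
      ; degʸ = S₂.Deg<-cong (S.sym (swap-Λ r r<q A)) (numerator-deg-< (swap Q) (swap A) r r<q 1≤d degʸQ (V°.degʸ v))
      }

    V⇒V° : ∀ r r<q → 0 < r → ∀ {A} → V A → V° (Λ r r<q A)
    V⇒V° r r<q 0<r {A} v = record
      { degˣ = numerator-deg-1 Q A r r<q 0<r degˣQ (V.degˣ v)
      ; degʸ = S₂.Deg<-cong (S.sym (swap-Λ r r<q A)) (numerator-deg-1 (swap Q) (swap A) r r<q 0<r degʸQ (V.degʸ v))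
      }

    orbit : Series² → ℕ → Series²
    orbit A zero    = A
    orbit A (suc e) = Λ 0 0<q (orbit A e)

    orbit-Λ : ∀ A e → orbit (Λ 0 0<q A) e ≡ orbit A (suc e)
    orbit-Λ A zero    = ≡.refl
    orbit-Λ A (suc e) = ≡.cong (Λ 0 0<q) (orbit-Λ A e)

    V-orbit : ∀ {A} → V A → ∀ e → V (orbit A e)
    V-orbit v zero    = v
    V-orbit v (suc e) = V-Λ 0 0<q (V-orbit v e)

    _≋ᵈ_ : (ℕ → Carrier) → Series² → Set ℓ
    s ≋ᵈ B = ∀ n → s n ≈ diagonal B n

    -- The least significant base-q digit of r selects the operator applied first, and r / q
    -- supplies the others.
    digit : ∀ e r n → q ℕ.^ suc e ℕ.* n ℕ.+ r ≡ q ℕ.* (q ℕ.^ e ℕ.* n ℕ.+ r / q) ℕ.+ r % q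
    digit e r n = begin
      q ℕ.^ suc e ℕ.* n ℕ.+ r
        ≡⟨ ≡.cong₂ ℕ._+_ (ℕ.*-assoc q (q ℕ.^ e) n)
          (≡.trans (m≡m%n+[m/n]*n r q) (≡.trans (ℕ.+-comm (r % q) _) (≡.cong (ℕ._+ r % q) (ℕ.*-comm (r / q) q)))) ⟩
      q ℕ.* (q ℕ.^ e ℕ.* n) ℕ.+ (q ℕ.* (r / q) ℕ.+ r % q)    ≡⟨ ℕ.+-assoc (q ℕ.* (q ℕ.^ e ℕ.* n)) _ _ ⟨
      q ℕ.* (q ℕ.^ e ℕ.* n) ℕ.+ q ℕ.* (r / q) ℕ.+ r % q
        ≡⟨ ≡.cong (ℕ._+ r % q) (ℕ.*-distribˡ-+ q (q ℕ.^ e ℕ.* n) (r / q)) ⟨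
      q ℕ.* (q ℕ.^ e ℕ.* n ℕ.+ r / q) ℕ.+ r % q              ∎
      where open ≡.≡-Reasoning

    r/q< : ∀ e r → r < q ℕ.^ suc e → r / q < q ℕ.^ e
    r/q< e r r<qᵉ = m<n*o⇒m/o<n {n = q ℕ.^ e} (≡.subst (r <_) (ℕ.*-comm q (q ℕ.^ e)) r<qᵉ)

    kernel-V° : ∀ e r → r < q ℕ.^ e → ∀ A → V° A → ∃[ B ] V° B × (λ n → diagonal A (q ℕ.^ e ℕ.* n ℕ.+ r)) ≋ᵈ B
    kernel-V° zero    zero _ A v = A , v , λ n → reflexive
      (≡.cong (diagonal A) (≡.trans (ℕ.+-identityʳ _) (ℕ.+-identityʳ n)))
    kernel-V° zero    (suc r) (s≤s ()) A v
    kernel-V° (suc e) r r<qᵉ A v with kernel-V° e (r / q) (r/q< e r r<qᵉ) (Λ (r % q) (m%n<n r q) A)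
      (V°-Λ (r % q) (m%n<n r q) v)
    ... | B , vB , eq = B , vB , λ n → trans (reflexive (≡.cong (diagonal A) (digit e r n))) (eq n)

    -- Digits of r are consumed from the least significant one. The first nonzero digit leads into
    -- `V°`, which is never left; if there is none, only Λ₀ is applied and the result lies on the
    -- orbit of A.
    kernel-V : ∀ e r → r < q ℕ.^ e → ∀ A → V A →
      (∃[ B ] V° B × (λ n → diagonal A (q ℕ.^ e ℕ.* n ℕ.+ r)) ≋ᵈ B) ⊎ ∃[ e′ ]
        (λ n → diagonal A (q ℕ.^ e ℕ.* n ℕ.+ r)) ≋ᵈ orbit A e′
    kernel-V zero    zero _ A v = inj₂ (0 , λ n → reflexive
      (≡.cong (diagonal A) (≡.trans (ℕ.+-identityʳ _) (ℕ.+-identityʳ n))))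
    kernel-V zero    (suc r) (s≤s ()) A v
    kernel-V (suc e) r r<qᵉ A v with r % q | m%n<n r q | digit e r
    ... | suc r₀ | r₀<q | digits with kernel-V° e (r / q) (r/q< e r r<qᵉ) (Λ (suc r₀) r₀<q A)
      (V⇒V° (suc r₀) r₀<q (s≤s z≤n) v)
    ...   | B , vB , eq = inj₁ (B , vB , λ n → trans (reflexive (≡.cong (diagonal A) (digits n))) (eq n))
    kernel-V (suc e) r r<qᵉ A v | zero | r₀<q | digits with kernel-V e (r / q) (r/q< e r r<qᵉ) (Λ 0 0<q A)
      (V-Λ 0 0<q v)
    ...   | inj₁ (B , vB , eq) = inj₁ (B , vB , λ n → trans (reflexive (≡.cong (diagonal A) (digits n))) (eq n))
    ...   | inj₂ (e′ , eq) = inj₂ (suc e′ , λ n → trans (reflexive (≡.cong (diagonal A) (digits n)))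
              (trans (eq n) (reflexive (≡.cong (λ B → diagonal B n) (orbit-Λ A e′)))))

    fraction : Series² → Series²
    fraction N = Q⁻¹ ⋆ N

    fraction-numerator : ∀ {A N} → Q ⋆ A ≗ N → A ≗ fraction N
    fraction-numerator {A} {N} e = S.trans (S.sym (S.trans (S.sym (S.*-assoc Q⁻¹ Q A)) (S.trans (S.*-congʳ
      (S.trans (S.*-comm Q⁻¹ Q) QQ⁻¹≗1)) (S.*-identityˡ A)))) (S.*-congˡ {Q⁻¹} e)

    degʸ⇒coef : ∀ A m n → coef (swap Q ⋆ swap A) n S₁.≗ S₁.𝟘 → coef² (Q ⋆ A) m n ≈ 0#
    degʸ⇒coef A m n z = trans (at² (swap-⋆ Q A) n m) (S₁.at z m)

    degʸ⇒degʸ-coef : ∀ Q {d} → S₂.Deg≤ (swap Q) d → ∀ m → S₁.Deg≤ (coef Q m) d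
    degʸ⇒degʸ-coef Q h m n d<n = S₁.at (h n d<n) m

    Border : ℕ → ℕ → Set
    Border m n = (m ≡ 0 ⊎ m ≡ h) ⊎ (n ≡ 0 ⊎ n ≡ d)

    module Count (A : Series²) (v : V A) (e₁ l : ℕ) (0<l : 0 < l)
      (periodic-border : ∀ e → e₁ ≤ e → ∀ t m n → Border m n → coef² (Q ⋆ orbit A (t ℕ.* l ℕ.+ e)) m n ≈ coef²
        (Q ⋆ orbit A e) m n) where

      N : ℕ → Series²
      N e = Q ⋆ orbit A e

      -- The difference of the two numerators vanishes on the border and beyond the bidegree (h ,
      -- d), so it is x y times one of the q^((h - 1)(d - 1)) interior polynomials.
      same-border : ∀ e e′ → (∀ m n → Border m n → coef² (N e) m n ≈ coef² (N e′) m n) →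
        ∃[ i ] N e ≗ N e′ ⊞ xy· (box² (h ∸ 1) (d ∸ 1) i)
      same-border e e′ same = box²Index (h ∸ 1) (d ∸ 1) (interior D) , (begin
        N e                                ≈⟨ S.+-identityˡ (N e) ⟨
        S₂.𝟘 ⊞ N e                         ≈⟨ S.+-congʳ (S.-‿inverseʳ (N e′)) ⟨
        N e′ ⊞ ⊟ N e′ ⊞ N e                ≈⟨ S.+-assoc (N e′) (⊟ N e′) (N e) ⟩
        N e′ ⊞ (⊟ N e′ ⊞ N e)              ≈⟨ S.+-congˡ (S.+-comm (⊟ N e′) (N e)) ⟩
        N e′ ⊞ D
          ≈⟨ S.+-congˡ (xy·-interior D (λ n → zero-at 0 n (inj₁ (inj₁ ≡.refl)))
            (λ m → zero-at m 0 (inj₂ (inj₁ ≡.refl)))) ⟨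
        N e′ ⊞ xy· (interior D)
          ≈⟨ S.+-congˡ (xy·-cong (box²-box²Index (h ∸ 1) (d ∸ 1) (interior D) outside)) ⟨
        N e′ ⊞ xy· (box² (h ∸ 1) (d ∸ 1) (box²Index (h ∸ 1) (d ∸ 1) (interior D))) ∎)
        where
        open Relation.Binary.Reasoning.Setoid S.setoid
        open Algebra.Properties.Ring ring using (-0#≈0#)
        D = N e ⊞ ⊟ N e′
        zero-at : ∀ m n → Border m n → coef² D m n ≈ 0#
        zero-at m n b = trans (+-congʳ (same m n b)) (-‿inverseʳ _)
        vanish : ∀ {a b} → a ≈ 0# → b ≈ 0# → a - b ≈ 0#
        vanish a≈0 b≈0 = trans (+-cong a≈0 (trans (-‿cong b≈0) -0#≈0#)) (+-identityˡ 0#)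
        outside : ∀ m n → h ∸ 1 ≤ m ⊎ d ∸ 1 ≤ n → coef² D (suc m) (suc n) ≈ 0#
        outside m n (inj₁ h-1≤m) with ℕ.m≤n⇒m<n∨m≡n (ℕ.≤-trans (ℕ.m≤n+m∸n h 1) (s≤s h-1≤m))
        ... | inj₁ h<1+m = vanish (S₁.at (V.degˣ (V-orbit v e) (suc m) h<1+m) (suc n))
          (S₁.at (V.degˣ (V-orbit v e′) (suc m) h<1+m) (suc n))
        ... | inj₂ h≡1+m = zero-at (suc m) (suc n) (inj₁ (inj₂ (≡.sym h≡1+m)))
        outside m n (inj₂ d-1≤n) with ℕ.m≤n⇒m<n∨m≡n (ℕ.≤-trans (ℕ.m≤n+m∸n d 1) (s≤s d-1≤n))
        ... | inj₁ d<1+n = vanish (degʸ⇒coef (orbit A e) (suc m) (suc n) (V.degʸ (V-orbit v e) (suc n) d<1+n))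
                                  (degʸ⇒coef (orbit A e′) (suc m) (suc n) (V.degʸ (V-orbit v e′) (suc n) d<1+n))
        ... | inj₂ d≡1+n = zero-at (suc m) (suc n) (inj₂ (inj₂ (≡.sym d≡1+n)))

      M : ℕ
      M = (q ℕ.^ (d ∸ 1)) ℕ.^ (h ∸ 1)

      V°-sequence : Fin ((q ℕ.^ d) ℕ.^ h) → ℕ → Carrier
      V°-sequence i = diagonal (fraction (box² h d i))

      orbit-sequence : Fin e₁ → ℕ → Carrier
      orbit-sequence e = diagonal (orbit A (toℕ e))

      -- Phase j is represented by the orbit element e₁ + j. Later elements of the same phase share
      -- its border and differ from it by an interior polynomial.
      border-sequence′ : Fin l × Fin M → ℕ → Carrier
      border-sequence′ (j , i) = diagonal (fraction (N (e₁ ℕ.+ toℕ j) ⊞ xy· (box² (h ∸ 1) (d ∸ 1) i)))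

      border-sequence : Fin (l ℕ.* M) → ℕ → Carrier
      border-sequence z = border-sequence′ (remQuot M z)

      -- The three blocks are the three contributions to the bound: the numerators of `V°`, the
      -- periodic part of the orbit, and its preperiod. Entries outside the kernel are harmless for
      -- an upper bound.
      kernel-list : List (ℕ → Carrier)
      kernel-list = tabulate V°-sequence ++ tabulate border-sequence ++ tabulate orbit-sequence

      length-kernel-list : length kernel-list ≡ (q ℕ.^ d) ℕ.^ h ℕ.+ (l ℕ.* M ℕ.+ e₁)
      length-kernel-list = ≡.trans (length-++ (tabulate V°-sequence)) (≡.cong₂ ℕ._+_ (length-tabulate V°-sequence)
        (≡.trans (length-++ (tabulate border-sequence))
          (≡.cong₂ ℕ._+_ (length-tabulate border-sequence) (length-tabulate orbit-sequence))))

      diagonal-cong : ∀ {B B′} → B ≗ B′ → ∀ n → diagonal B n ≈ diagonal B′ n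
      diagonal-cong p n = at² p n n

      in-V° : ∀ {B} → V° B → ∃[ i ] ∀ n → diagonal B n ≈ V°-sequence i n
      in-V° {B} vB = box²Index h d (Q ⋆ B) , diagonal-cong (fraction-numerator {B} (S.sym (box²-box²Index h d (Q ⋆ B) λ where
        m n (inj₁ h≤m) → S₁.at (V°.degˣ vB m h≤m) n
        m n (inj₂ d≤n) → degʸ⇒coef B m n (V°.degʸ vB n d≤n))))

      in-orbit : ∀ e → (e<e₁ : e < e₁) → ∀ n → diagonal (orbit A e) n ≈ orbit-sequence (fromℕ< e<e₁) n
      in-orbit e e<e₁ n = reflexive (≡.cong (λ e → diagonal (orbit A e) n) (≡.sym (Fin.toℕ-fromℕ< e<e₁)))

      in-border : ∀ e → e₁ ≤ e → ∃[ z ] ∀ n → diagonal (orbit A e) n ≈ border-sequence z n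
      in-border e e₁≤e = combine j i , λ n → trans (diagonal-cong (fraction-numerator N≗) n)
        (reflexive (≡.cong (λ z → border-sequence′ z n) (≡.sym (Fin.remQuot-combine j i))))
        where
        instance
          l≢0 : ℕ.NonZero l
          l≢0 = ℕ.>-nonZero 0<l
        f = e ∸ e₁
        j : Fin l
        j = fromℕ< (m%n<n f l)
        e≡ : e ≡ f / l ℕ.* l ℕ.+ (e₁ ℕ.+ toℕ j)
        e≡ = begin
          e                                    ≡⟨ ℕ.m+[n∸m]≡n e₁≤e ⟨
          e₁ ℕ.+ f                             ≡⟨ ≡.cong (e₁ ℕ.+_) (m≡m%n+[m/n]*n f l) ⟩
          e₁ ℕ.+ (f % l ℕ.+ f / l ℕ.* l)       ≡⟨ ℕ.+-assoc e₁ (f % l) _ ⟨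
          e₁ ℕ.+ f % l ℕ.+ f / l ℕ.* l         ≡⟨ ℕ.+-comm (e₁ ℕ.+ f % l) _ ⟩
          f / l ℕ.* l ℕ.+ (e₁ ℕ.+ f % l)
            ≡⟨ ≡.cong (λ k → f / l ℕ.* l ℕ.+ (e₁ ℕ.+ k)) (Fin.toℕ-fromℕ< (m%n<n f l)) ⟨
          f / l ℕ.* l ℕ.+ (e₁ ℕ.+ toℕ j)       ∎
          where open ≡.≡-Reasoning
        found : ∃[ i ] N e ≗ N (e₁ ℕ.+ toℕ j) ⊞ xy· (box² (h ∸ 1) (d ∸ 1) i)
        found = same-border e (e₁ ℕ.+ toℕ j) λ m n b → trans (reflexive (≡.cong (λ e → coef² (N e) m n) e≡))
          (periodic-border (e₁ ℕ.+ toℕ j) (ℕ.m≤m+n _ _) (f / l) m n b)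
        i = proj₁ found
        N≗ = proj₂ found

      in-kernel-list : ∀ e r → r < q ℕ.^ e → ∀ (s : ℕ → Carrier) → (∀ n → s n ≈ diagonal A (q ℕ.^ e ℕ.* n ℕ.+ r)) →
        Any (λ (t : ℕ → Carrier) → ∀ n → s n ≈ t n) kernel-list
      in-kernel-list e r r<qᵉ s s≈ with kernel-V e r r<qᵉ A v
      ... | inj₁ (B , vB , eq) = let i , eq′ = in-V° vB in
            Any.++⁺ˡ (Any.tabulate⁺ {f = V°-sequence} i λ n → trans (s≈ n) (trans (eq n) (eq′ n)))
      ... | inj₂ (e′ , eq) with e′ ℕ.<? e₁
      ...   | yes e′<e₁ = Any.++⁺ʳ (tabulate V°-sequence) (Any.++⁺ʳ (tabulate border-sequence)
              (Any.tabulate⁺ {f = orbit-sequence} (fromℕ< e′<e₁) λ n → trans (s≈ n)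
                (trans (eq n) (in-orbit e′ e′<e₁ n))))
      ...   | no e′≮e₁ = let z , eq′ = in-border e′ (ℕ.≮⇒≥ e′≮e₁) in Any.++⁺ʳ (tabulate V°-sequence)
              (Any.++⁺ˡ (Any.tabulate⁺ {f = border-sequence} z λ n → trans (s≈ n) (trans (eq n) (eq′ n))))

    module Bound (A : Series²) (v : V A) (e₀ : ℕ) (h<K : h < q ℕ.^ e₀) (d<K : d < q ℕ.^ e₀) where

      private
        xBorders = borders Q 1≤d degˣQ (degʸ⇒degʸ-coef Q degʸQ)
        -- The borders n = 0 and n = d are polynomials in x, so their partitions are bounded by h;
        -- the other two are bounded by d.
        yBorders = borders (swap Q) 1≤h degʸQ (degʸ⇒degʸ-coef (swap Q) λ m h<m → S₁.pointwise (S₁.at (degˣQ m h<m)))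

      σ₁ σ₂ : PartitionUpTo h
      σ₁ = proj₁ yBorders
      σ₂ = proj₁ (proj₂ yBorders)

      σ₃ σ₄ : PartitionUpTo d
      σ₃ = proj₁ xBorders
      σ₄ = proj₁ (proj₂ xBorders)

      l : ℕ
      l = lcm (period σ₁) (lcm (period σ₂) (lcm (period σ₃) (period σ₄)))

      σ₁∣l : period σ₁ ℕ∣.∣ l
      σ₁∣l = m∣lcm[m,n] (period σ₁) _
      σ₂∣l : period σ₂ ℕ∣.∣ l
      σ₂∣l = ℕ∣.∣-trans (m∣lcm[m,n] (period σ₂) _) (n∣lcm[m,n] (period σ₁) _)
      σ₃∣l : period σ₃ ℕ∣.∣ l
      σ₃∣l = ℕ∣.∣-trans (m∣lcm[m,n] (period σ₃) _) (ℕ∣.∣-trans (n∣lcm[m,n] (period σ₂) _) (n∣lcm[m,n] (period σ₁) _))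
      σ₄∣l : period σ₄ ℕ∣.∣ l
      σ₄∣l = ℕ∣.∣-trans (n∣lcm[m,n] (period σ₃) _) (ℕ∣.∣-trans (n∣lcm[m,n] (period σ₂) _) (n∣lcm[m,n] (period σ₁) _))

      left-right : PeriodicFrom (suc e₀) (period σ₃) (λ e → coef (Q ⋆ orbit A e) 0) × PeriodicFrom (suc e₀)
        (period σ₄) (λ e → coef (Q ⋆ orbit A e) h)
      left-right = proj₂ (proj₂ xBorders) e₀ d<K (orbit A) (λ _ → S.refl) (λ e → V.degˣ (V-orbit v e))
        (λ m n d<n → degʸ⇒coef A m n (V.degʸ v n d<n))

      bottom-top : PeriodicFrom (suc e₀) (period σ₁) (λ e → coef (swap Q ⋆ swap (orbit A e)) 0) ×
                   PeriodicFrom (suc e₀) (period σ₂) (λ e → coef (swap Q ⋆ swap (orbit A e)) d)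
      bottom-top = proj₂ (proj₂ yBorders) e₀ h<K (swap ∘ orbit A) (λ e → pointwise² λ _ _ → refl)
        (λ e → V.degʸ (V-orbit v e))
        (λ n m h<m → trans (sym (at² (swap-⋆ Q A) n m)) (S₁.at (V.degˣ v m h<m) n))

      periodic-border : ∀ e → suc e₀ ≤ e → ∀ t m n → Border m n → coef² (Q ⋆ orbit A (t ℕ.* l ℕ.+ e)) m n ≈ coef²
        (Q ⋆ orbit A e) m n
      periodic-border e e₁≤e t m n (inj₁ (inj₁ ≡.refl)) = S₁.at
        (periodic-∣ {s = λ e → coef (Q ⋆ orbit A e) 0} (ℕ∣.∣n⇒∣m*n t σ₃∣l) (proj₁ left-right) e e₁≤e) n
      periodic-border e e₁≤e t m n (inj₁ (inj₂ ≡.refl)) = S₁.at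
        (periodic-∣ {s = λ e → coef (Q ⋆ orbit A e) h} (ℕ∣.∣n⇒∣m*n t σ₄∣l) (proj₂ left-right) e e₁≤e) n
      periodic-border e e₁≤e t m n (inj₂ (inj₁ ≡.refl)) = trans (at² (swap-⋆ Q (orbit A (t ℕ.* l ℕ.+ e))) 0 m)
        (trans (S₁.at (periodic-∣ {s = λ e → coef (swap Q ⋆ swap (orbit A e)) 0} (ℕ∣.∣n⇒∣m*n t σ₁∣l)
          (proj₁ bottom-top) e e₁≤e) m) (sym (at² (swap-⋆ Q (orbit A e)) 0 m)))
      periodic-border e e₁≤e t m n (inj₂ (inj₂ ≡.refl)) = trans (at² (swap-⋆ Q (orbit A (t ℕ.* l ℕ.+ e))) d m)
        (trans (S₁.at (periodic-∣ {s = λ e → coef (swap Q ⋆ swap (orbit A e)) d} (ℕ∣.∣n⇒∣m*n t σ₂∣l)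
          (proj₂ bottom-top) e e₁≤e) m) (sym (at² (swap-⋆ Q (orbit A e)) d m)))

      0<l : 0 < l
      0<l = lcm-positive (period-positive σ₁) (lcm-positive (period-positive σ₂)
        (lcm-positive (period-positive σ₃) (period-positive σ₄)))

    ∈-partitions : ∀ {n} (σ : PartitionUpTo n) → proj₁ (proj₂ σ) ∈ partitionsUpTo n
    ∈-partitions (_ , _ , 1≤k , k≤n , p) = ∈-partitionsUpTo⁺ 1≤k k≤n p

    kernel-cover : ∀ A → V A → ∀ e₀ → h < q ℕ.^ e₀ → d < q ℕ.^ e₀ → ∃[ ts ]
      length ts ≤ q ℕ.^ (h ℕ.* d) ℕ.+ q ℕ.^ ((h ∸ 1) ℕ.* (d ∸ 1)) ℕ.* 𝓛 h h d d ℕ.+ suc e₀ ×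
      (∀ e r → r < q ℕ.^ e → ∀ (s : ℕ → Carrier) → (∀ n → s n ≈ diagonal A (q ℕ.^ e ℕ.* n ℕ.+ r)) → Any
        (λ (t : ℕ → Carrier) → ∀ n → s n ≈ t n) ts)
    kernel-cover A v e₀ h<K d<K = C.kernel-list ,
      ℕ.≤-trans (ℕ.≤-reflexive C.length-kernel-list) (cover-size q h d (suc e₀) l≤𝓛) ,
      C.in-kernel-list
      where
      module B = Bound A v e₀ h<K d<K
      module C = Count A v (suc e₀) B.l B.0<l B.periodic-border
      l≤𝓛 : B.l ≤ 𝓛 h h d d
      l≤𝓛 = lcm₄≤𝓛 {h} {h} {d} {d} (∈-partitions B.σ₁) (∈-partitions B.σ₂) (∈-partitions B.σ₃) (∈-partitions B.σ₄)

-- The logarithm and the specialisation to finite fields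

n<m^n : ∀ {m} → 1 < m → ∀ n → n < m ℕ.^ n
n<m^n 1<m zero    = s≤s z≤n
n<m^n {m} 1<m (suc n) = ℕ.≤-<-trans (n<m^n 1<m n) (ℕ.^-monoʳ-< m 1<m (ℕ.n<1+n n))

-- Otherwise the successor of the logarithm would itself be in the searched list, because k < q ^ k
-- ≤ m.
m<q^[1+⌊log⌋] : ∀ {q m} → 1 < q → m < q ℕ.^ suc ⌊log[ q ] m ⌋
m<q^[1+⌊log⌋] {q} {m} 1<q = ℕ.≰⇒> λ qᵏ≤m → ℕ.<-irrefl ≡.refl (∈⇒≤max
  (∈-filter⁺ (λ k → q ℕ.^ k ℕ.≤? m) (∈-upTo⁺ (ℕ.<-≤-trans (n<m^n 1<q _) qᵏ≤m)) qᵏ≤m))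

prime-power>1 : ∀ {q} → PrimePower q → 1 < q
prime-power>1 (p , k , pp , 1≤k , ≡.refl) = ℕ.≤-<-trans 1≤k (n<m^n (ℕ.nonTrivial⇒n>1 p {{prime⇒nonTrivial pp}}) k)

series-characteristic : ∀ {c ℓ} (R : CommutativeRing c ℓ) p → let open CommutativeRing R in
  Powers._·_ R p 1# ≈ 0# → CommutativeRing._≈_ (PowerSeries.seriesRing R)
    (Powers._·_ (PowerSeries.seriesRing R) p (PowerSeries.C R 1#)) (PowerSeries.𝟘 R)
series-characteristic R p p×1≈0 = S.trans (C-homo-× p)
  (S.trans (C-cong p×1≈0) (pointwise λ { zero → refl ; (suc n) → refl }))
  where
  open SeriesProperties R
  open CommutativeRing R using (refl)

module FieldFacts {c ℓ₁ ℓ₂ q′} (pp : PrimePower (suc q′)) (𝔽 : FiniteField c ℓ₁ ℓ₂ (suc q′)) where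

  open FiniteField 𝔽 hiding (zero)
  private
    module E = Inverse enumeration
    R = commutativeRing
    q = suc q′

  elem : Fin q → Carrier
  elem = E.from

  index : Carrier → Fin q
  index = E.to

  elem∘index : ∀ a → elem (index a) ≈ a
  elem∘index = E.strictlyInverseʳ

  elem-injective : ∀ i j → elem i ≈ elem j → i ≡ j
  elem-injective i j e = ≡.trans (≡.sym (E.strictlyInverseˡ i)) (≡.trans (E.to-cong e) (E.strictlyInverseˡ j))

  unit? : ∀ a → a ≈ 0# ⊎ Powers.Unit R a
  unit? a with a ≈? 0#
  ... | yes a≈0 = inj₁ a≈0
  ... | no  a≉0 with invertible a≉0
  ...   | y , _ , e = inj₂ (y , e)

  p : ℕ
  p = proj₁ pp

  -- Translation by 1 gives q · 1 = 0 with q = p ^ k, and `characteristic` descends to p.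
  p×1≈0 : Powers._·_ R p 1# ≈ 0#
  p×1≈0 = Powers.characteristic R p (proj₁ (proj₂ pp)) (unit? _)
    (≡.subst (λ n → Powers._·_ R n 1# ≈ 0#) (proj₂ (proj₂ (proj₂ (proj₂ pp))))
      (Powers.Translation.N×1≈0 R elem index elem∘index elem-injective))

  additive : ∀ {c ℓ} (A : CommutativeRing c ℓ) → let module A = CommutativeRing A in
    Powers._·_ A p A.1# A.≈ A.0# → Powers.Additive A q
  additive A p×1≈0 = ≡.subst (Powers.Additive A) (≡.sym (proj₂ (proj₂ (proj₂ (proj₂ pp)))))
    (Powers.additive-^ A {p} (Powers.frobenius A (proj₁ (proj₂ (proj₂ pp))) p×1≈0) (proj₁ (proj₂ pp)))

  additive₁ : Powers.Additive (PowerSeries.seriesRing R) q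
  additive₁ = additive (PowerSeries.seriesRing R) (series-characteristic R p p×1≈0)

  additive₂ : Powers.Additive (PowerSeries.seriesRing (PowerSeries.seriesRing R)) q
  additive₂ = additive (PowerSeries.seriesRing (PowerSeries.seriesRing R))
    (series-characteristic (PowerSeries.seriesRing R) p (series-characteristic R p p×1≈0))

  open Bivariate R elem index elem∘index elem-injective unit? (prime-power>1 pp) additive₁ additive₂ public

  bivariate : PowerSeries 𝔽 → Series²
  S₁.coef (S₂.coef (bivariate f) m) n = f m n

  open Polynomial

  coeff-degˣ : ∀ (P : Polynomial 𝔽) i j → degˣ P < i → coeff P i j ≈ 0#
  coeff-degˣ P i j deg<i with coeff P i j ≈? 0#
  ... | yes z = z
  ... | no ≉0 with i ℕ.<? bound P | j ℕ.<? bound P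
  ...   | no i≮ | _     = contradiction (vanishing P i j (inj₁ (ℕ.≮⇒≥ i≮))) ≉0
  ...   | _     | no j≮ = contradiction (vanishing P i j (inj₂ (ℕ.≮⇒≥ j≮))) ≉0
  ...   | yes i< | yes j< = contradiction (∈⇒≤max (∈-filter⁺
    (λ i → any? (λ j → ¬? (coeff P i j ≈? 0#)) (upTo (bound P)))
            (∈-upTo⁺ i<) (lose (∈-upTo⁺ j<) ≉0))) (ℕ.<⇒≱ deg<i)

  coeff-degʸ : ∀ (P : Polynomial 𝔽) i j → degʸ P < j → coeff P i j ≈ 0#
  coeff-degʸ P i j deg<j with coeff P i j ≈? 0#
  ... | yes z = z
  ... | no ≉0 with i ℕ.<? bound P | j ℕ.<? bound P
  ...   | no i≮ | _     = contradiction (vanishing P i j (inj₁ (ℕ.≮⇒≥ i≮))) ≉0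
  ...   | _     | no j≮ = contradiction (vanishing P i j (inj₂ (ℕ.≮⇒≥ j≮))) ≉0
  ...   | yes i< | yes j< = contradiction (∈⇒≤max (∈-filter⁺
    (λ j → any? (λ i → ¬? (coeff P i j ≈? 0#)) (upTo (bound P)))
            (∈-upTo⁺ j<) (lose (∈-upTo⁺ i<) ≉0))) (ℕ.<⇒≱ deg<j)

  quotient-numerator : ∀ P Q (Q₀≉0 : ¬ Q 0 0 ≈ 0#) → bivariate Q S₂.⋆ bivariate
    (Division.quotient 𝔽 P Q Q₀≉0) S₂.≗ bivariate P
  quotient-numerator P Q Q₀≉0 = pointwise² λ m n → trans
    (coef²-⋆ (bivariate Q) (bivariate (Division.quotient 𝔽 P Q Q₀≉0)) m n)
    (Division.quotient-correct 𝔽 P Q Q₀≉0 m n)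

  module Fraction (P Q : Polynomial 𝔽) (Q₀≉0 : ¬ coeff Q 0 0 ≈ 0#) {h d}
    (h≡ : h ≡ degˣ P ℕ.⊔ degˣ Q) (d≡ : d ≡ degʸ P ℕ.⊔ degʸ Q) (1≤h : 1 ≤ h) (1≤d : 1 ≤ d) where

    -- Q is inverted by the same division that defines P / Q, applied to the constant series 1.
    one : PowerSeries 𝔽
    one = coef² (S₂.C (S₁.C 1#))

    inverse : bivariate (coeff Q) S₂.⋆ bivariate (Division.quotient 𝔽 one (coeff Q) Q₀≉0) S₂.≗ S₂.C (S₁.C 1#)
    inverse = S₂.S.trans (quotient-numerator one (coeff Q) Q₀≉0) (pointwise² λ _ _ → refl)

    numerator : bivariate (coeff Q) S₂.⋆ bivariate (divide 𝔽 P Q Q₀≉0) S₂.≗ bivariate (coeff P)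
    numerator = quotient-numerator (coeff P) (coeff Q) Q₀≉0

    degˣ-Q : S₂.Deg≤ (bivariate (coeff Q)) h
    degˣ-Q m h<m = S₁.pointwise λ n → coeff-degˣ Q m n
      (ℕ.≤-<-trans (ℕ.m≤n⊔m (degˣ P) (degˣ Q)) (≡.subst (_< m) h≡ h<m))

    degʸ-Q : S₂.Deg≤ (swap (bivariate (coeff Q))) d
    degʸ-Q n d<n = S₁.pointwise λ m → coeff-degʸ Q m n
      (ℕ.≤-<-trans (ℕ.m≤n⊔m (degʸ P) (degʸ Q)) (≡.subst (_< n) d≡ d<n))

    open Kernel (bivariate (coeff Q)) (bivariate (Division.quotient 𝔽 one
      (coeff Q) Q₀≉0)) inverse 1≤h 1≤d degˣ-Q degʸ-Q

    V-divide : V (bivariate (divide 𝔽 P Q Q₀≉0))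
    V-divide = record
      { degˣ = λ m h<m → S₁.pointwise λ n → trans (at² numerator m n)
          (coeff-degˣ P m n (ℕ.≤-<-trans (ℕ.m≤m⊔n (degˣ P) (degˣ Q)) (≡.subst (_< m) h≡ h<m)))
      ; degʸ = λ n d<n → S₁.pointwise λ m → trans (sym
        (at² (swap-⋆ (bivariate (coeff Q)) (bivariate (divide 𝔽 P Q Q₀≉0))) n m)) (trans (at² numerator m n)
          (coeff-degʸ P m n (ℕ.≤-<-trans (ℕ.m≤m⊔n (degʸ P) (degʸ Q)) (≡.subst (_< n) d≡ d<n))))
      }

    ker-size : ∀ e₀ → h < q ℕ.^ e₀ → d < q ℕ.^ e₀ → ∃[ k ] HasSize≤ 𝔽 (ker 𝔽 q (𝒟 𝔽 (divide 𝔽 P Q Q₀≉0))) k ×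
      k ≤ q ℕ.^ (h ℕ.* d) ℕ.+ q ℕ.^ ((h ∸ 1) ℕ.* (d ∸ 1)) ℕ.* 𝓛 h h d d ℕ.+ suc e₀
    ker-size e₀ h<K d<K = let ts , size , cover = kernel-cover (bivariate (divide 𝔽 P Q Q₀≉0)) V-divide e₀ h<K d<K in
      length ts , (ts , ℕ.≤-refl , λ s (e , r , r<qᵉ , s≋) → cover e r r<qᵉ s s≋) , size

kernel-bound : ∀ {c ℓ₁ ℓ₂} q h d → KernelBound c ℓ₁ ℓ₂ q h d λ k →
  k ≤ q ℕ.^ (h ℕ.* d) ℕ.+ q ℕ.^ ((h ∸ 1) ℕ.* (d ∸ 1)) ℕ.* 𝓛 h h d d ℕ.+ 2 ℕ.* ⌊log[ q ] h ℕ.⊔ d ⌋ ℕ.+ 2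
kernel-bound zero    h d pp = contradiction (prime-power>1 pp) λ ()
kernel-bound q@(suc _) h d pp 𝔽 P Q Q₀≉0 h≡ d≡ 1≤h 1≤d =
  -- The choice e₀ = L + 1 makes q^e₀ exceed h and d. The preperiod then contributes e₀ + 1 = L + 2
  -- elements, at most 2 L + 2.
  let k , size , k≤ = FieldFacts.Fraction.ker-size pp 𝔽 P Q Q₀≉0 h≡ d≡ 1≤h 1≤d (suc L)
                        (ℕ.≤-<-trans (ℕ.m≤m⊔n h d) m<) (ℕ.≤-<-trans (ℕ.m≤n⊔m h d) m<)
  in k , size , ℕ.≤-trans k≤ (ℕ.≤-trans (ℕ.+-monoʳ-≤ B preperiod) (ℕ.≤-reflexive (≡.sym (ℕ.+-assoc B (2 ℕ.* L) 2))))
  where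
  B = q ℕ.^ (h ℕ.* d) ℕ.+ q ℕ.^ ((h ∸ 1) ℕ.* (d ∸ 1)) ℕ.* 𝓛 h h d d
  L = ⌊log[ q ] h ℕ.⊔ d ⌋
  m< : h ℕ.⊔ d < q ℕ.^ suc L
  m< = m<q^[1+⌊log⌋] (prime-power>1 pp)
  preperiod : 2 ℕ.+ L ≤ 2 ℕ.* L ℕ.+ 2
  preperiod = ℕ.≤-trans (ℕ.+-monoʳ-≤ 2 (ℕ.m≤m+n L (L ℕ.+ 0))) (ℕ.≤-reflexive (ℕ.+-comm 2 (2 ℕ.* L)))

open import Data.Integer.Base using (+_)
open import Data.Nat.Base using (_+_; _*_; _^_; _⊔_; _!)

-- Asymptotics

square-cancel-≤ : ∀ {x y} → x * x ≤ y * y → x ≤ y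
square-cancel-≤ xx≤yy = ℕ.≮⇒≥ λ y<x → ℕ.<⇒≱ (ℕ.*-mono-< y<x y<x) xx≤yy

infix 9 _⁴
-- Two of the four partitions belong to the growing parameter n, so an exponent above 2 is wanted.
-- With 4 the product of their lcms is at most a constant times 2^(n/2), which leaves 2^(n/2) to
-- absorb a factor n + 1. As a square of a square it suits `square-cancel-≤`.
_⁴ : ℕ → ℕ
x ⁴ = (x * x) * (x * x)

*-⁴ : ∀ x y → (x * y) ⁴ ≡ x ⁴ * y ⁴
*-⁴ = solve 2 (λ x y → ((x :* y) :* (x :* y)) :* ((x :* y) :* (x :* y)) := ((x :* x) :* (x :* x)) :*
  ((y :* y) :* (y :* y))) ≡.refl
  where open +-*-Solver

⁴-mono-≤ : ∀ {x y} → x ≤ y → x ⁴ ≤ y ⁴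
⁴-mono-≤ x≤y = ℕ.*-mono-≤ (ℕ.*-mono-≤ x≤y x≤y) (ℕ.*-mono-≤ x≤y x≤y)

n≤n⁴ : ∀ n → n ≤ n ⁴
n≤n⁴ zero        = z≤n
n≤n⁴ n@(suc _) = ℕ.≤-trans (ℕ.m≤m*n n n) (ℕ.m≤m*n (n * n) (n * n))

-- The induction step is (1 + m)⁴ ≤ (17/16)⁴ m⁴ ≤ 2 m⁴.
m⁴≤2ᵐ : ∀ j → (16 + j) ⁴ ≤ 2 ^ (16 + j)
m⁴≤2ᵐ zero    = ℕ.≤ᵇ⇒≤ (16 ⁴) (2 ^ 16) tt
m⁴≤2ᵐ (suc j) = ℕ.≤-trans double (ℕ.*-monoʳ-≤ 2 (m⁴≤2ᵐ j))
  where
  m = 16 + j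
  open ℕ.≤-Reasoning
  ratio : suc m * 16 ≤ 17 * m
  ratio = begin
    16 + m * 16  ≤⟨ ℕ.+-monoˡ-≤ (m * 16) (ℕ.m≤m+n 16 j) ⟩
    m + m * 16   ≡⟨ ≡.cong (_+_ m) (ℕ.*-comm m 16) ⟩
    17 * m       ∎
  double : suc m ⁴ ≤ 2 * m ⁴
  double = ℕ.*-cancelʳ-≤ (suc m ⁴) (2 * m ⁴) (16 ⁴) (begin
    suc m ⁴ * 16 ⁴      ≡⟨ *-⁴ (suc m) 16 ⟨
    (suc m * 16) ⁴      ≤⟨ ⁴-mono-≤ ratio ⟩
    (17 * m) ⁴          ≡⟨ *-⁴ 17 m ⟩
    17 ⁴ * m ⁴          ≤⟨ ℕ.*-monoˡ-≤ (m ⁴) (ℕ.≤ᵇ⇒≤ (17 ⁴) (16 ⁴ * 2) tt) ⟩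
    16 ⁴ * 2 * m ⁴      ≡⟨ ≡.trans (ℕ.*-assoc (16 ⁴) 2 (m ⁴)) (ℕ.*-comm (16 ⁴) (2 * m ⁴)) ⟩
    2 * m ⁴ * 16 ⁴      ∎)

[1+n]²≤4*2ⁿ : ∀ n → suc n * suc n ≤ 4 * 2 ^ n
[1+n]²≤4*2ⁿ 0 = ℕ.≤ᵇ⇒≤ 1 4 tt
[1+n]²≤4*2ⁿ 1 = ℕ.≤ᵇ⇒≤ 4 8 tt
[1+n]²≤4*2ⁿ (suc (suc n)) = go n
  where
  open ℕ.≤-Reasoning
  open +-*-Solver
  -- The step (x + 1)² ≤ 2 x² holds from x = 3 on, which is why two smaller cases are checked apart.
  go : ∀ n → (3 + n) * (3 + n) ≤ 4 * 2 ^ (2 + n)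
  go zero    = ℕ.≤ᵇ⇒≤ 9 16 tt
  go (suc n) = begin
    (4 + n) * (4 + n)                              ≤⟨ ℕ.m≤m+n _ (n * n + 4 * n + 2) ⟩
    (4 + n) * (4 + n) + (n * n + 4 * n + 2)
      ≡⟨ solve 1 (λ n → (con 4 :+ n) :* (con 4 :+ n) :+ (n :* n :+ con 4 :* n :+ con 2) := con 2 :*
        ((con 3 :+ n) :* (con 3 :+ n))) ≡.refl n ⟩
    2 * ((3 + n) * (3 + n))                        ≤⟨ ℕ.*-monoʳ-≤ 2 (go n) ⟩
    2 * (4 * 2 ^ (2 + n))
      ≡⟨ solve 1 (λ x → con 2 :* (con 4 :* x) := con 4 :* (con 2 :* x)) ≡.refl (2 ^ (2 + n)) ⟩
    4 * 2 ^ (3 + n)                                ∎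

abstract
  -- Hidden, since unfolding products with 15! is expensive.
  F : ℕ
  F = 15 !

  ∣F : ∀ {m} → 1 ≤ m → m ≤ 15 → m ℕ∣.∣ F
  ∣F {suc m} _ m≤15 = ℕ∣.∣-trans (ℕ∣.m∣m*n (m !)) (ℕ∣.m≤n⇒m!∣n! m≤15)

  F≢0 : ℕ.NonZero F
  F≢0 = 15 ℕ.!≢0

-- The small parts of σ are absorbed by 15!, and w is the product of the others.
lcmOfParts-weight : ∀ σ → All (1 ≤_) σ → ∃[ w ] 0 < w × lcmOfParts σ ℕ∣.∣ F * w × w ⁴ ≤ 2 ^ ℕ.sum σ
lcmOfParts-weight []      []        = 1 , s≤s z≤n , ℕ∣.divides (F * 1) (≡.sym (ℕ.*-identityʳ (F * 1))) , s≤s z≤n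
lcmOfParts-weight (m ∷ σ) (1≤m ∷ pos) with lcmOfParts-weight σ pos | m ℕ.≤? 15
... | w , 0<w , lcm∣ , w⁴≤ | yes m≤15 = w , 0<w , lcm-least {m} (ℕ∣.∣-trans (∣F 1≤m m≤15) (ℕ∣.m∣m*n w)) lcm∣ ,
      ℕ.≤-trans w⁴≤ (ℕ.^-monoʳ-≤ 2 (ℕ.m≤n+m (ℕ.sum σ) m))
... | w , 0<w , lcm∣ , w⁴≤ | no m≰15 = m * w , ℕ.*-mono-≤ 1≤m 0<w ,
      lcm-least {m} (ℕ∣.∣-trans (ℕ∣.m∣m*n w) (ℕ∣.n∣m*n F)) (ℕ∣.∣-trans lcm∣ (ℕ∣.*-monoʳ-∣ F (ℕ∣.n∣m*n m))) ,
      (begin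
        (m * w) ⁴          ≡⟨ *-⁴ m w ⟩
        m ⁴ * w ⁴
          ≤⟨ ℕ.*-mono-≤ (≡.subst (λ m → m ⁴ ≤ 2 ^ m) (ℕ.m+[n∸m]≡n (ℕ.≰⇒> m≰15)) (m⁴≤2ᵐ (m ∸ 16))) w⁴≤ ⟩
        2 ^ m * 2 ^ ℕ.sum σ  ≡⟨ ℕ.^-distribˡ-+-* 2 m (ℕ.sum σ) ⟨
        2 ^ (m + ℕ.sum σ)    ∎)
      where open ℕ.≤-Reasoning

lcm-≤-* : ∀ {m n} → 0 < m → 0 < n → lcm m n ≤ m * n
lcm-≤-* {m} {n} 0<m 0<n = ℕ∣.∣⇒≤ {{ℕ.>-nonZero (ℕ.*-mono-≤ 0<m 0<n)}} (lcm-least {m} (ℕ∣.m∣m*n n) (ℕ∣.n∣m*n m))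

partition-weight : ∀ {n σ} → σ ∈ partitionsUpTo n → 0 < lcmOfParts σ × ∃[ w ] lcmOfParts σ ≤ F * w × w ⁴ ≤ 2 ^ n
partition-weight {n} {σ} σ∈ with ∈-partitionsUpTo⁻ {n} σ∈
... | k , _ , k≤n , _ , pos , ≡.refl with lcmOfParts-weight σ pos
...   | w , 0<w , lcm∣ , w⁴≤ = lcmOfParts-positive pos , w ,
        ℕ∣.∣⇒≤ {{ℕ.m*n≢0 F w {{F≢0}} {{ℕ.>-nonZero 0<w}}}} lcm∣ , ℕ.≤-trans w⁴≤ (ℕ.^-monoʳ-≤ 2 k≤n)

-- Up to the factor F², the two lcms are at most w w′ ≤ 2^(n/2), while n + 1 ≤ 2 · 2^(n/2). Both
-- estimates are carried out on squares to avoid roots.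
pair-bound : ∀ {n σ τ} → σ ∈ partitionsUpTo n → τ ∈ partitionsUpTo n →
  lcmOfParts σ * lcmOfParts τ * suc n ≤ F * F * 2 * 2 ^ n
pair-bound {n} {σ} {τ} σ∈ τ∈ with partition-weight {n} σ∈ | partition-weight {n} τ∈
... | _ , w , σ≤ , w⁴≤ | _ , w′ , τ≤ , w′⁴≤ = begin
  lcmOfParts σ * lcmOfParts τ * suc n   ≤⟨ ℕ.*-monoˡ-≤ (suc n) (ℕ.*-mono-≤ σ≤ τ≤) ⟩
  F * w * (F * w′) * suc n
    ≡⟨ solve 4 (λ f w v n → f :* w :* (f :* v) :* n := f :* f :* (w :* v :* n)) ≡.refl F w w′ (suc n) ⟩
  F * F * (w * w′ * suc n)              ≤⟨ ℕ.*-monoʳ-≤ (F * F) ww′n ⟩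
  F * F * (2 * 2 ^ n)                   ≡⟨ ℕ.*-assoc (F * F) 2 (2 ^ n) ⟨
  F * F * 2 * 2 ^ n                     ∎
  where
  open ℕ.≤-Reasoning
  open +-*-Solver
  W = w * w′
  W²≤ : W * W ≤ 2 ^ n
  W²≤ = square-cancel-≤ (ℕ.≤-trans (ℕ.≤-reflexive (*-⁴ w w′)) (ℕ.*-mono-≤ w⁴≤ w′⁴≤))
  ww′n : W * suc n ≤ 2 * 2 ^ n
  ww′n = square-cancel-≤ (begin
    W * suc n * (W * suc n)          ≡⟨ solve 2 (λ w n → w :* n :* (w :* n) := w :* w :* (n :* n)) ≡.refl W (suc n) ⟩
    W * W * (suc n * suc n)          ≤⟨ ℕ.*-mono-≤ W²≤ ([1+n]²≤4*2ⁿ n) ⟩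
    2 ^ n * (4 * 2 ^ n)
      ≡⟨ solve 1 (λ x → x :* (con 4 :* x) := con 2 :* x :* (con 2 :* x)) ≡.refl (2 ^ n) ⟩
    2 * 2 ^ n * (2 * 2 ^ n)          ∎)

single-bound : ∀ {n σ} → σ ∈ partitionsUpTo n → lcmOfParts σ ≤ F * 2 ^ n
single-bound {n} σ∈ with partition-weight {n} σ∈
... | _ , w , σ≤ , w⁴≤ = ℕ.≤-trans σ≤ (ℕ.*-monoʳ-≤ F (ℕ.≤-trans (n≤n⁴ w) w⁴≤))

-- A maximum over a list is an entry or the default value 0, whence the premise `P 0`.
𝓛-all : ∀ {a b} (P : ℕ → Set) → P 0 → (∀ {σ₁ σ₂ σ₃ σ₄} → σ₁ ∈ partitionsUpTo a → σ₂ ∈ partitionsUpTo a →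
  σ₃ ∈ partitionsUpTo b → σ₄ ∈ partitionsUpTo b → P (lcm₄ (σ₁ , σ₂ , σ₃ , σ₄))) → P (𝓛 a a b b)
𝓛-all {a} {b} P P0 Pσ = argmax-all (λ x → x) {P = P} P0 (All.tabulate λ x∈ → case (∈-map⁻ lcm₄ x∈))
  where
  Σs = cartesianProduct (partitionsUpTo a) (cartesianProduct (partitionsUpTo a)
    (cartesianProduct (partitionsUpTo b) (partitionsUpTo b)))
  case : ∀ {x} → ∃[ σ ] σ ∈ Σs × x ≡ lcm₄ σ → P x
  case ((σ₁ , σ₂ , σ₃ , σ₄) , σ∈ , ≡.refl) with ∈-cartesianProduct⁻ (partitionsUpTo a) _ σ∈
  ... | σ₁∈ , σ∈′ with ∈-cartesianProduct⁻ (partitionsUpTo a) _ σ∈′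
  ...   | σ₂∈ , σ∈″ with ∈-cartesianProduct⁻ (partitionsUpTo b) (partitionsUpTo b) σ∈″
  ...     | σ₃∈ , σ₄∈ = Pσ σ₁∈ σ₂∈ σ₃∈ σ₄∈

lcm₄-≤-* : ∀ {a b σ₁ σ₂ σ₃ σ₄} → σ₁ ∈ partitionsUpTo a → σ₂ ∈ partitionsUpTo a → σ₃ ∈ partitionsUpTo b → σ₄ ∈ partitionsUpTo b →
  lcm₄ (σ₁ , σ₂ , σ₃ , σ₄) ≤ (lcmOfParts σ₁ * lcmOfParts σ₂) * (lcmOfParts σ₃ * lcmOfParts σ₄)
lcm₄-≤-* {a} {b} {σ₁} {σ₂} {σ₃} {σ₄} σ₁∈ σ₂∈ σ₃∈ σ₄∈ = begin
  lcm l₁ (lcm l₂ (lcm l₃ l₄))    ≤⟨ lcm-≤-* p₁ (lcm-positive p₂ (lcm-positive p₃ p₄)) ⟩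
  l₁ * lcm l₂ (lcm l₃ l₄)        ≤⟨ ℕ.*-monoʳ-≤ l₁ (lcm-≤-* p₂ (lcm-positive p₃ p₄)) ⟩
  l₁ * (l₂ * lcm l₃ l₄)          ≤⟨ ℕ.*-monoʳ-≤ l₁ (ℕ.*-monoʳ-≤ l₂ (lcm-≤-* p₃ p₄)) ⟩
  l₁ * (l₂ * (l₃ * l₄))          ≡⟨ ℕ.*-assoc l₁ l₂ (l₃ * l₄) ⟨
  l₁ * l₂ * (l₃ * l₄)            ∎
  where
  open ℕ.≤-Reasoning
  l₁ = lcmOfParts σ₁
  l₂ = lcmOfParts σ₂
  l₃ = lcmOfParts σ₃
  l₄ = lcmOfParts σ₄
  p₁ = proj₁ (partition-weight {a} σ₁∈)
  p₂ = proj₁ (partition-weight {a} σ₂∈)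
  p₃ = proj₁ (partition-weight {b} σ₃∈)
  p₄ = proj₁ (partition-weight {b} σ₄∈)

𝓛-growth : ℕ → ℕ
𝓛-growth b = F * F * 2 * (F * 2 ^ b * (F * 2 ^ b))

𝓛-boundˡ : ∀ a b → 𝓛 a a b b * suc a ≤ 𝓛-growth b * 2 ^ a
𝓛-boundˡ a b = 𝓛-all {a} {b} (λ x → x * suc a ≤ 𝓛-growth b * 2 ^ a) z≤n λ {σ₁} {σ₂} {σ₃} {σ₄} σ₁∈ σ₂∈ σ₃∈ σ₄∈ →
  let l₁ = lcmOfParts σ₁ ; l₂ = lcmOfParts σ₂ ; l₃ = lcmOfParts σ₃ ; l₄ = lcmOfParts σ₄ in begin
  lcm₄ (σ₁ , σ₂ , σ₃ , σ₄) * suc a             ≤⟨ ℕ.*-monoˡ-≤ (suc a) (lcm₄-≤-* {a} {b} σ₁∈ σ₂∈ σ₃∈ σ₄∈) ⟩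
  l₁ * l₂ * (l₃ * l₄) * suc a
    ≡⟨ solve 3 (λ x y n → x :* y :* n := x :* n :* y) ≡.refl (l₁ * l₂) (l₃ * l₄) (suc a) ⟩
  l₁ * l₂ * suc a * (l₃ * l₄)
    ≤⟨ ℕ.*-mono-≤ (pair-bound {a} σ₁∈ σ₂∈) (ℕ.*-mono-≤ (single-bound {b} σ₃∈) (single-bound {b} σ₄∈)) ⟩
  F * F * 2 * 2 ^ a * (F * 2 ^ b * (F * 2 ^ b))
    ≡⟨ solve 3 (λ x y n → x :* y :* n := x :* n :* y) ≡.refl (F * F * 2) (2 ^ a) (F * 2 ^ b * (F * 2 ^ b)) ⟩
  𝓛-growth b * 2 ^ a                           ∎
  where
  open ℕ.≤-Reasoning
  open +-*-Solver

𝓛-boundʳ : ∀ a b → 𝓛 a a b b * suc b ≤ 𝓛-growth a * 2 ^ b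
𝓛-boundʳ a b = 𝓛-all {a} {b} (λ x → x * suc b ≤ 𝓛-growth a * 2 ^ b) z≤n λ {σ₁} {σ₂} {σ₃} {σ₄} σ₁∈ σ₂∈ σ₃∈ σ₄∈ →
  let l₁ = lcmOfParts σ₁ ; l₂ = lcmOfParts σ₂ ; l₃ = lcmOfParts σ₃ ; l₄ = lcmOfParts σ₄ in begin
  lcm₄ (σ₁ , σ₂ , σ₃ , σ₄) * suc b             ≤⟨ ℕ.*-monoˡ-≤ (suc b) (lcm₄-≤-* {a} {b} σ₁∈ σ₂∈ σ₃∈ σ₄∈) ⟩
  l₁ * l₂ * (l₃ * l₄) * suc b
    ≡⟨ solve 3 (λ x y n → x :* y :* n := y :* n :* x) ≡.refl (l₁ * l₂) (l₃ * l₄) (suc b) ⟩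
  l₃ * l₄ * suc b * (l₁ * l₂)
    ≤⟨ ℕ.*-mono-≤ (pair-bound {b} σ₃∈ σ₄∈) (ℕ.*-mono-≤ (single-bound {a} σ₁∈) (single-bound {a} σ₂∈)) ⟩
  F * F * 2 * 2 ^ b * (F * 2 ^ a * (F * 2 ^ a))
    ≡⟨ solve 3 (λ x y n → x :* y :* n := x :* n :* y) ≡.refl (F * F * 2) (2 ^ b) (F * 2 ^ a * (F * 2 ^ a)) ⟩
  𝓛-growth a * 2 ^ b                           ∎
  where
  open ℕ.≤-Reasoning
  open +-*-Solver

⌊log⌋≤ : ∀ q m → ⌊log[ q ] m ⌋ ≤ m
⌊log⌋≤ q m = max≤v⁺ {xs = filter (λ k → q ^ k ℕ.≤? m) (upTo m)} z≤n
  (All.tabulate λ k∈ → ℕ.<⇒≤ (∈-upTo⁻ (proj₁ (∈-filter⁻ (λ k → q ^ k ℕ.≤? m) {xs = upTo m} k∈))))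

-- Rational error terms

ε : ℕ → ℕ → ℚ
ε K n = + K ℚ./ suc n

ε-tends-to-zero : ∀ K → TendsToZero (ε K)
-- For δ = (a + 1) / b the threshold K b works: K b < n + 1 ≤ (a + 1) (n + 1).
ε-tends-to-zero K δ@(mkℚ (+ suc a) b-1 _) _ = K * suc b-1 , λ n N≤n → ≡.subst (ℚ._< δ)
  (≡.sym (ℚ.0≤p⇒∣p∣≡p (ε-nonneg n)))
  (ℚ.toℚᵘ-cancel-< (ℚᵘ.<-respˡ-≃ (ℚᵘ.≃-sym (ℚ.toℚᵘ-fromℚᵘ (mkℚᵘ (+ K) n)))
    (*<* (≡.subst₂ ℤ._<_ (ℤ.pos-* K (suc b-1)) (ℤ.pos-* (suc a) (suc n))
      (ℤ.+<+ (ℕ.<-≤-trans (s≤s N≤n) (ℕ.m≤m+n (suc n) (a * suc n))))))))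
  where
  ε-nonneg : ∀ n → 0ℚ ℚ.≤ ε K n
  ε-nonneg n = ℚ.nonNegative⁻¹ (ε K n) {{ℚ.normalize-nonNeg K (suc n)}}
ε-tends-to-zero K (mkℚ (+ zero) _ _) (ℚ.*<* (ℤ.+<+ ()))
ε-tends-to-zero K (mkℚ ℤ.-[1+ _ ] _ _) (ℚ.*<* ())

-- The denominators are cleared in the unnormalised rationals, where numerators and denominators
-- compute.
≤-[1+ε] : ∀ K n k T → k * suc n ≤ (suc n + K) * T → + k ℚ./ 1 ℚ.≤ (1ℚ ℚ.+ ε K n) ℚ.* (+ T ℚ./ 1)
≤-[1+ε] K n k T le = ℚ.toℚᵘ-cancel-≤ (ℚᵘ.≤-respˡ-≃ (ℚᵘ.≃-sym (ℚ.toℚᵘ-fromℚᵘ (mkℚᵘ (+ k) 0)))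
  (ℚᵘ.≤-respʳ-≃ (ℚᵘ.≃-sym rhs) (*≤* integers)))
  where
  one+ε = mkℚᵘ (+ 1) 0 ℚᵘ.+ mkℚᵘ (+ K) n
  rhs : ℚ.toℚᵘ ((1ℚ ℚ.+ ε K n) ℚ.* (+ T ℚ./ 1)) ℚᵘ.≃ one+ε ℚᵘ.* mkℚᵘ (+ T) 0
  rhs = ℚᵘ.≃-trans (ℚ.toℚᵘ-homo-* (1ℚ ℚ.+ ε K n) (+ T ℚ./ 1)) (ℚᵘ.*-cong
    (ℚᵘ.≃-trans (ℚ.toℚᵘ-homo-+ 1ℚ (ε K n)) (ℚᵘ.+-congʳ (mkℚᵘ (+ 1) 0) (ℚ.toℚᵘ-fromℚᵘ (mkℚᵘ (+ K) n))))
    (ℚ.toℚᵘ-fromℚᵘ (mkℚᵘ (+ T) 0)))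
  integers : + k ℤ.* ℚᵘ.↧ (one+ε ℚᵘ.* mkℚᵘ (+ T) 0) ℤ.≤ ℚᵘ.↥ (one+ε ℚᵘ.* mkℚᵘ (+ T) 0) ℤ.* + 1
  integers = ≡.subst₂ ℤ._≤_
    (≡.trans (ℤ.pos-* k (suc n)) (≡.cong (λ i → + k ℤ.* + i)
      (≡.sym (≡.trans (ℕ.*-identityʳ (1 * suc n)) (ℕ.*-identityˡ (suc n))))))
    (≡.trans (≡.cong (λ i → + i) (≡.cong (_* T) (≡.sym (≡.cong₂ _+_ (ℕ.*-identityˡ (suc n)) (ℕ.*-identityʳ K)))))
      (≡.trans (ℤ.pos-* (1 * suc n + K * 1) T)
      (≡.trans (≡.cong (ℤ._* + T) (≡.cong₂ ℤ._+_ (ℤ.pos-* 1 (suc n)) (ℤ.pos-* K 1))) (≡.sym (ℤ.*-identityʳ _)))))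
    (ℤ.+≤+ le)

-- A T will be the main term q^(h d) and A S the error; the hypothesis on S makes the error at most
-- the fraction K / (n + 1) of the main term.
scaled-bound : ∀ {A T S K n B k} → k ≤ B → B ≤ A * T + A * S → S * suc n ≤ K * T → k * suc n ≤ (suc n + K) * (A * T)
scaled-bound {A} {T} {S} {K} {n} {B} {k} k≤B B≤ S≤ = begin
  k * suc n                         ≤⟨ ℕ.*-monoˡ-≤ (suc n) (ℕ.≤-trans k≤B B≤) ⟩
  (A * T + A * S) * suc n
    ≡⟨ solve 4 (λ a t s n → (a :* t :+ a :* s) :* n := n :* (a :* t) :+ a :* (s :* n)) ≡.refl A T S (suc n) ⟩
  suc n * (A * T) + A * (S * suc n) ≤⟨ ℕ.+-monoʳ-≤ (suc n * (A * T)) (ℕ.*-monoʳ-≤ A S≤) ⟩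
  suc n * (A * T) + A * (K * T)
    ≡⟨ solve 4 (λ a t k n → n :* (a :* t) :+ a :* (k :* t) := (n :+ k) :* (a :* t)) ≡.refl A T K (suc n) ⟩
  (suc n + K) * (A * T)             ∎
  where
  open ℕ.≤-Reasoning
  open +-*-Solver

-- The exponents satisfy h d = (h - 1) (d - 1) + (h + d - 1).
asymptotic : ∀ {c ℓ₁ ℓ₂} K n q h d →
  (1 < q → 1 ≤ h → 1 ≤ d → (𝓛 h h d d + (2 * (h ⊔ d) + 2)) * suc n ≤ K * q ^ (h ∸ 1 + d)) →
  KernelBound c ℓ₁ ℓ₂ q h d λ k → + k ℚ./ 1 ℚ.≤ (1ℚ ℚ.+ ε K n) ℚ.* (+ (q ^ (h * d)) ℚ./ 1)
asymptotic K n q h@(suc h′) d@(suc d′) hyp pp 𝔽 P Q Q₀≉0 h≡ d≡ 1≤h 1≤d =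
  let k , size , k≤ = kernel-bound q h d pp 𝔽 P Q Q₀≉0 h≡ d≡ 1≤h 1≤d in
  k , size , ≤-[1+ε] K n k (q ^ (h * d)) (≡.subst (λ x → k * suc n ≤ (suc n + K) * x) (≡.sym power)
    (scaled-bound {A} {T} {S} {K} {n} k≤ total (hyp 1<q 1≤h 1≤d)))
  where
  open ℕ.≤-Reasoning
  open +-*-Solver
  1<q : 1 < q
  1<q = prime-power>1 pp
  A = q ^ (h′ * d′)
  T = q ^ (h′ + d)
  -- The logarithmic terms, with the logarithm bounded by `h ⊔ d`, join 𝓛 at the cost of the factor
  -- A ≥ 1.
  S = 𝓛 h h d d + (2 * (h ⊔ d) + 2)
  L = ⌊log[ q ] h ⊔ d ⌋
  power : q ^ (h * d) ≡ A * T
  power = ≡.trans (≡.cong (q ^_) (solve 2 (λ x y → (con 1 :+ x) :* (con 1 :+ y) := x :* y :+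
    (x :+ (con 1 :+ y))) ≡.refl h′ d′))
    (ℕ.^-distribˡ-+-* q (h′ * d′) (h′ + d))
  0<A : 0 < A
  0<A = ℕ.m^n>0 q {{ℕ.>-nonZero (ℕ.<-trans (s≤s z≤n) 1<q)}} (h′ * d′)
  total : q ^ (h * d) + A * 𝓛 h h d d + 2 * L + 2 ≤ A * T + A * S
  total = begin
    q ^ (h * d) + A * 𝓛 h h d d + 2 * L + 2
      ≡⟨ ≡.trans (ℕ.+-assoc (q ^ (h * d) + A * 𝓛 h h d d) (2 * L) 2)
        (ℕ.+-assoc (q ^ (h * d)) (A * 𝓛 h h d d) (2 * L + 2)) ⟩
    q ^ (h * d) + (A * 𝓛 h h d d + (2 * L + 2))
      ≤⟨ ℕ.+-mono-≤ (ℕ.≤-reflexive power) (ℕ.+-monoʳ-≤ (A * 𝓛 h h d d) (ℕ.≤-trans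
                                                              (ℕ.+-monoˡ-≤ 2 (ℕ.*-monoʳ-≤ 2 (⌊log⌋≤ q (h ⊔ d))))
                                                                (ℕ.m≤n*m (2 * (h ⊔ d) + 2) A {{ℕ.>-nonZero 0<A}}))) ⟩
    A * T + (A * 𝓛 h h d d + A * (2 * (h ⊔ d) + 2))
      ≡⟨ ≡.cong (_+_ (A * T)) (ℕ.*-distribˡ-+ A (𝓛 h h d d) (2 * (h ⊔ d) + 2)) ⟨
    A * T + A * S                                        ∎

-- Here n grows and o is fixed. From n + o + 1 ≤ (n + 1) (o + 1) the linear term, times n + 1, is at
-- most 2 (o + 1) (n + 1)², and `[1+n]²≤4*2ⁿ` makes the constant 8 = 2 · 4.
linear-estimate : ∀ {l m G} n o → m ≤ n + o → l * suc n ≤ G * 2 ^ n → (l + (2 * m + 2)) * suc n ≤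
  (G + 8 * suc o) * 2 ^ n
linear-estimate {l} {m} {G} n o m≤ l≤ = begin
  (l + (2 * m + 2)) * suc n                  ≡⟨ ℕ.*-distribʳ-+ (suc n) l (2 * m + 2) ⟩
  l * suc n + (2 * m + 2) * suc n
    ≤⟨ ℕ.+-mono-≤ l≤ (ℕ.*-monoˡ-≤ (suc n) (ℕ.+-monoˡ-≤ 2 (ℕ.*-monoʳ-≤ 2 (ℕ.≤-trans m≤ (ℕ.m≤m+n (n + o) (n * o)))))) ⟩
  G * 2 ^ n + (2 * (n + o + n * o) + 2) * suc n
    ≡⟨ ≡.cong (_+_ (G * 2 ^ n)) (solve 2 (λ n o → (con 2 :* (n :+ o :+ n :* o) :+ con 2) :* (con 1 :+ n) := con 2 :*
      (con 1 :+ o) :* ((con 1 :+ n) :* (con 1 :+ n))) ≡.refl n o) ⟩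
  G * 2 ^ n + 2 * suc o * (suc n * suc n)    ≤⟨ ℕ.+-monoʳ-≤ (G * 2 ^ n) (ℕ.*-monoʳ-≤ (2 * suc o) ([1+n]²≤4*2ⁿ n)) ⟩
  G * 2 ^ n + 2 * suc o * (4 * 2 ^ n)
    ≡⟨ solve 3 (λ g o x → g :* x :+ con 2 :* o :* (con 4 :* x) := (g :+ con 8 :* o) :* x) ≡.refl G (suc o) (2 ^ n) ⟩
  (G + 8 * suc o) * 2 ^ n                    ∎
  where
  open ℕ.≤-Reasoning
  open +-*-Solver

-- The three limits

2ⁿ≤q^m : ∀ {q m n} → 1 < q → n ≤ m → 2 ^ n ≤ q ^ m
2ⁿ≤q^m {q} {m} {n} 1<q n≤m = ℕ.≤-trans (ℕ.^-monoˡ-≤ n 1<q)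
  (ℕ.^-monoʳ-≤ q {{ℕ.>-nonZero (ℕ.<-trans (s≤s z≤n) 1<q)}} n≤m)

-- With h and d fixed S is constant, and q^(h + d - 1) ≥ q supplies the factor q + 1 ≤ 2 q.
q-asymptotic : ∀ {c ℓ₁ ℓ₂} h d → ∃[ ε ] TendsToZero ε × (∀ q → KernelBound c ℓ₁ ℓ₂ q h d λ k →
  + k ℚ./ 1 ℚ.≤ (1ℚ ℚ.+ ε q) ℚ.* (+ (q ^ (h * d)) ℚ./ 1))
q-asymptotic h d = ε K , ε-tends-to-zero K , λ q → asymptotic K q q h d (estimate q)
  where
  open ℕ.≤-Reasoning
  S = 𝓛 h h d d + (2 * (h ⊔ d) + 2)
  K = S * 2
  estimate : ∀ q → 1 < q → 1 ≤ h → 1 ≤ d → S * suc q ≤ K * q ^ (h ∸ 1 + d)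
  estimate q 1<q 1≤h 1≤d = begin
    S * suc q
      ≤⟨ ℕ.*-monoʳ-≤ S (ℕ.≤-trans (ℕ.+-monoˡ-≤ q (ℕ.<⇒≤ 1<q))
        (ℕ.≤-reflexive (≡.cong (_+_ q) (≡.sym (ℕ.+-identityʳ q))))) ⟩
    S * (2 * q)                  ≡⟨ ℕ.*-assoc S 2 q ⟨
    K * q
      ≤⟨ ℕ.*-monoʳ-≤ K (ℕ.≤-trans (ℕ.≤-reflexive (≡.sym (ℕ.^-identityʳ q)))
        (ℕ.^-monoʳ-≤ q {{ℕ.>-nonZero (ℕ.<-trans (s≤s z≤n) 1<q)}} (ℕ.≤-trans 1≤d (ℕ.m≤n+m d (h ∸ 1))))) ⟩
    K * q ^ (h ∸ 1 + d)          ∎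

-- Since d ≥ 1, the exponent h - 1 + d is at least h, so the missing factor dominates the 2^h of
-- `𝓛-boundˡ` even for q = 2 and d = 1.
h-asymptotic : ∀ {c ℓ₁ ℓ₂} q d → ∃[ ε ] TendsToZero ε × (∀ h → KernelBound c ℓ₁ ℓ₂ q h d λ k →
  + k ℚ./ 1 ℚ.≤ (1ℚ ℚ.+ ε h) ℚ.* (+ (q ^ (h * d)) ℚ./ 1))
h-asymptotic q d = ε K , ε-tends-to-zero K , λ h → asymptotic K h q h d λ 1<q 1≤h 1≤d →
  ℕ.≤-trans (linear-estimate {𝓛 h h d d} {h ⊔ d} {𝓛-growth d} h d (ℕ.m⊔n≤m+n h d) (𝓛-boundˡ h d))
    (ℕ.*-monoʳ-≤ K (2ⁿ≤q^m 1<q (ℕ.≤-trans (ℕ.≤-reflexive (≡.sym (ℕ.m∸n+n≡m 1≤h))) (ℕ.+-monoʳ-≤ (h ∸ 1) 1≤d))))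
  where K = 𝓛-growth d + 8 * suc d

d-asymptotic : ∀ {c ℓ₁ ℓ₂} q h → ∃[ ε ] TendsToZero ε × (∀ d → KernelBound c ℓ₁ ℓ₂ q h d λ k →
  + k ℚ./ 1 ℚ.≤ (1ℚ ℚ.+ ε d) ℚ.* (+ (q ^ (h * d)) ℚ./ 1))
d-asymptotic q h = ε K , ε-tends-to-zero K , λ d → asymptotic K d q h d λ 1<q 1≤h 1≤d →
  ℕ.≤-trans (linear-estimate {𝓛 h h d d} {h ⊔ d} {𝓛-growth h} d h
    (ℕ.≤-trans (ℕ.m⊔n≤m+n h d) (ℕ.≤-reflexive (ℕ.+-comm h d))) (𝓛-boundʳ h d))
    (ℕ.*-monoʳ-≤ K (2ⁿ≤q^m 1<q (ℕ.m≤n+m d (h ∸ 1))))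
  where K = 𝓛-growth h + 8 * suc h

theorem35 : ∀ {c ℓ₁ ℓ₂ : Level} →
    (∀ q h d → KernelBound c ℓ₁ ℓ₂ q h d λ k →
    k ≤ q ^ (h * d) + q ^ ((h ∸ 1) * (d ∸ 1)) * 𝓛 h h d d + 2 * ⌊log[ q ] h ⊔ d ⌋ + 2) ×
    (∀ h d → ∃[ ε ] TendsToZero ε × (∀ q → KernelBound c ℓ₁ ℓ₂ q h d λ k →
    + k ℚ./ 1 ℚ.≤ (1ℚ ℚ.+ ε q) ℚ.* (+ (q ^ (h * d)) ℚ./ 1))) ×
    (∀ q d → ∃[ ε ] TendsToZero ε × (∀ h → KernelBound c ℓ₁ ℓ₂ q h d λ k →
    + k ℚ./ 1 ℚ.≤ (1ℚ ℚ.+ ε h) ℚ.* (+ (q ^ (h * d)) ℚ./ 1))) ×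
    (∀ q h → ∃[ ε ] TendsToZero ε × (∀ d → KernelBound c ℓ₁ ℓ₂ q h d λ k →
    + k ℚ./ 1 ℚ.≤ (1ℚ ℚ.+ ε d) ℚ.* (+ (q ^ (h * d)) ℚ./ 1)))
theorem35 = kernel-bound , q-asymptotic , h-asymptotic , d-asymptotic
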